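{- Let $\mathbb F_q$ be the finite field with $q$ elements, $p=\mathrm{char}\,\mathbb F_q$. For $A=\begin{pmatrix}a&b\\c&d\end{pmatrix}\in \mathrm{GL}_2(\mathbb F_q)$ and an irreducible $f\in\mathbb F_q[x]$ of degree $n\ge 2$, define $A\circ f=(cx+d)^n f\!\left(\frac{ax+b}{cx+d}\right)$. For a subgroup $H\subseteq \mathrm{GL}_2(\mathbb F_q)$ and an integer $n\ge 2$, let $I_H(n)$ be the set of monic irreducible polynomials $f\in\mathbb F_q[x]$ of degree $n$ such that $A\circ f=f$ for all $A\in H$. Let $H$ be a subgroup of $\mathrm{GL}_2(\mathbb F_q)$ of order $p^r$ with $r\ge 1$. Then: (a) if $r>1$ or $p\nmid n$, then $|I_H(n)|=0$; (b) if $r=1$ and $n=pm$ with $m$ a positive integer, then $$|I_H(n)|=\frac{p-1}{pm}\sum_{d\mid m,\ \gcd(d,p)=1}q^{m/d}\mu(d),$$ where $\mu$ is the Möbius function.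
   Context: The action $A\circ f$ is defined on irreducible polynomials of degree at least $2$; it preserves degree and satisfies $A\circ(B\circ f)=(AB)\circ f$. -}

module Defs where

open import Level using (0ℓ)
open import Data.Nat as ℕ using (ℕ; zero; suc; _∸_; _≤_; _<_)
open import Data.Nat.Divisibility using (_∣_; _∣?_)
open import Data.Nat.Primality using (prime?)
open import Data.Nat.GCD using (gcd)
open import Data.Nat.DivMod using (_/_)
open import Data.Integer as ℤ using (ℤ; +_)
open import Data.Fin using (Fin)
open import Data.List as L using (List; []; _∷_; upTo; length; filter)
open import Data.List.Membership.Propositional using (_∈_)
open import Data.List.Relation.Unary.Unique.Propositional using (Unique)
open import Data.Vec using (Vec; toList)
open import Data.Product using (Σ; ∃; _×_; _,_)
open import Data.Sum using (_⊎_)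
open import Function.Bundles using (_↔_; _⇔_)
open import Algebra.Core using (Op₁; Op₂)
open import Algebra.Structures using (IsCommutativeRing)
open import Relation.Binary.PropositionalEquality using (_≡_; _≢_)
open import Relation.Nullary using (¬_; yes; no)
open import Relation.Nullary.Decidable using (_×-dec_; ¬?)
open import Data.Nat using (_≟_)

HasSize : {A : Set} → (A → Set) → ℕ → Set
HasSize {A} P k = Σ (List A) λ l → Unique l × length l ≡ k × (∀ x → P x ⇔ x ∈ l)

record FiniteField : Set₁ where
  infixl 6 _+_
  infixl 7 _*_
  field
    Carrier           : Set
    _+_ _*_           : Op₂ Carrier
    -_                : Op₁ Carrier
    0# 1#             : Carrier
    isCommutativeRing : IsCommutativeRing _≡_ _+_ _*_ -_ 0# 1#
    0≢1               : 0# ≢ 1#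
    inverse           : ∀ x → x ≢ 0# → ∃ λ y → x * y ≡ 1#
    q                 : ℕ
    enumeration       : Carrier ↔ Fin q

module Over (K : FiniteField) where
  open FiniteField K

  ι : ℕ → Carrier
  ι zero    = 0#
  ι (suc n) = 1# + ι n

  -- K has characteristic p (p prime is assumed separately)
  HasCharacteristic : ℕ → Set
  HasCharacteristic p = ι p ≡ 0#

  -- Polynomials in K[x]: coefficient lists, lowest degree first.
  -- Trailing zeros allowed; equality is coefficientwise.

  Poly : Set
  Poly = List Carrier

  coeff : Poly → ℕ → Carrier
  coeff []       _       = 0#
  coeff (a ∷ f)  zero    = a
  coeff (a ∷ f)  (suc i) = coeff f i

  infix 4 _≈ₚ_
  _≈ₚ_ : Poly → Poly → Set
  f ≈ₚ g = ∀ i → coeff f i ≡ coeff g i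

  infixl 6 _+ₚ_
  _+ₚ_ : Poly → Poly → Poly
  []      +ₚ g       = g
  (a ∷ f) +ₚ []      = a ∷ f
  (a ∷ f) +ₚ (b ∷ g) = (a + b) ∷ (f +ₚ g)

  scale : Carrier → Poly → Poly
  scale c = L.map (c *_)

  infixl 7 _*ₚ_
  _*ₚ_ : Poly → Poly → Poly
  []      *ₚ g = []
  (a ∷ f) *ₚ g = scale a g +ₚ (0# ∷ (f *ₚ g))

  infixr 8 _^ₚ_
  _^ₚ_ : Poly → ℕ → Poly
  f ^ₚ zero  = 1# ∷ []
  f ^ₚ suc n = f *ₚ (f ^ₚ n)

  HasDegree : Poly → ℕ → Set
  HasDegree f n = coeff f n ≢ 0# × (∀ i → n < i → coeff f i ≡ 0#)

  IsConstant : Poly → Set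
  IsConstant f = ∀ i → 1 ≤ i → coeff f i ≡ 0#

  -- irreducible over K: non-constant, and every factorisation has a
  -- constant (= unit, since f ≠ 0) factor
  Irreducible : Poly → Set
  Irreducible f = ¬ IsConstant f ×
    (∀ g h → f ≈ₚ g *ₚ h → IsConstant g ⊎ IsConstant h)

  monic : {n : ℕ} → Vec Carrier n → Poly
  monic v = toList v L.++ (1# ∷ [])

  record Mat2 : Set where
    constructor mat
    field a b c d : Carrier

  det : Mat2 → Carrier
  det (mat a b c d) = a * d + - (b * c)

  _·_ : Mat2 → Mat2 → Mat2
  mat a b c d · mat a' b' c' d' =
    mat (a * a' + b * c') (a * b' + b * d') (c * a' + d * c') (c * b' + d * d')

  I₂ : Mat2
  I₂ = mat 1# 0# 0# 1#

  record IsSubgroupGL2 (H : Mat2 → Set) : Set where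
    field
      ⊆GL₂   : ∀ A → H A → det A ≢ 0#
      has-I  : H I₂
      closed : ∀ A B → H A → H B → H (A · B)
      inv    : ∀ A → H A → ∃ λ B → H B × A · B ≡ I₂ × B · A ≡ I₂

  -- A ∘ f = (cx+d)^n f((ax+b)/(cx+d)) = Σ_{i ≤ n} f_i (ax+b)^i (cx+d)^(n-i),
  -- for f of degree n
  act : Mat2 → ℕ → Poly → Poly
  act (mat a b c d) n f = go n
    where
    term : ℕ → Poly
    term i = scale (coeff f i) (((b ∷ a ∷ []) ^ₚ i) *ₚ ((d ∷ c ∷ []) ^ₚ (n ∸ i)))
    go : ℕ → Poly
    go zero    = term zero
    go (suc i) = term (suc i) +ₚ go i

  -- I_H(n): monic irreducible f of degree n with A ∘ f = f for all A ∈ H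
  -- (monic polynomials of degree n are identified with their lower
  -- coefficient vectors)
  I : (Mat2 → Set) → (n : ℕ) → Vec Carrier n → Set
  I H n v = Irreducible (monic v) × (∀ A → H A → act A n (monic v) ≈ₚ monic v)

-- Möbius function: μ(d) = 0 if some k ≥ 2 has k² ∣ d, else (-1)^ω(d)
-- where ω(d) = number of primes dividing d.  (μ 0 is irrelevant.)

candidates : ℕ → List ℕ
candidates n = L.map suc (upTo n)

ω : ℕ → ℕ
ω n = length (filter (λ k → prime? k ×-dec (k ∣? n)) (candidates n))

squareDivisors : ℕ → List ℕ
squareDivisors n = filter (λ k → (2 ℕ.≤? k) ×-dec (k ℕ.* k ∣? n)) (candidates n)

μ : ℕ → ℤ
μ n with squareDivisors n
... | []    = (ℤ.- ℤ.1ℤ) ℤ.^ ω n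
... | _ ∷ _ = ℤ.0ℤ

divisorSum : (q p m : ℕ) → ℤ
divisorSum q p m = L.foldr ℤ._+_ ℤ.0ℤ (L.map term (upTo m))
  where
  term : ℕ → ℤ
  term k with suc k ∣? m | gcd (suc k) p ≟ 1
  ... | yes _ | yes _ = (+ (q ℕ.^ (m / suc k))) ℤ.* μ (suc k)
  ... | _     | _     = ℤ.0ℤ

-- A group of order p^r acting on a finite set X with p ∣ |X| never has exactly one fixed point.
-- Applied to K² and, through the determinant, to K, this conjugates H to a group of
-- translations x ↦ x + t, and conjugation is a bijection on monic irreducible polynomials.
--
-- Let f be irreducible of degree n with f(x + c) = f(x), c ≠ 0. Modulo f the roots of f are the
-- powers x^(q^i), so x + c ≡ x^(q^i) for some i with n ∣ p i and n ∤ i. Hence p ∣ n, and at most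
-- p translations leave f invariant. If f(x + 1) = f(x), n = p d, m = d e and p ∤ e, it also follows
-- that x^(q^m) ≡ x + c for exactly one c ∈ 𝔽ₚ \ 0. So the irreducible factors of the squarefree
-- polynomials x^(q^m) - x - c, c ∈ 𝔽ₚ \ 0, are the N(p m / e) invariant irreducible polynomials
-- of the degrees p m / e with e ∣ m and p ∤ e, each occurring once. Comparing degrees gives
-- Σ_{e ∣ m, p ∤ e} (p m / e) N(p m / e) = (p - 1) q^m, and Möbius inversion gives N(p m).

module Submission where

open import Defs
open import Data.Nat as ℕ using (ℕ; zero; suc; _≤_; _<_; s≤s; z≤n; NonZero)
import Data.Nat.Properties as ℕ
open import Data.Product using (_×_; _,_; ∃; ∃₂; proj₁; proj₂)
open import Data.Sum using (_⊎_; inj₁; inj₂)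
open import Data.List using (List; []; _∷_; length; map)
open import Data.List.Membership.Propositional using (_∈_)
open import Data.List.Relation.Unary.Unique.Propositional using (Unique)
open import Data.Nat.Primality using (Prime)
open import Relation.Nullary using (Dec; yes; no; ¬_; contradiction)
open import Level using (0ℓ)
open import Algebra.Bundles using (CommutativeRing)

-- No splitting field is built: the roots of f that are needed all lie in the residue field
-- K[X]/(f), realised as `Poly` with congruence modulo f as its equality. There the conjugates of X
-- are its images under iterates of Frobenius, and invariance under a translation becomes an
-- equation X^(q^i) = X + c. Frobenius is additive without binomial coefficients modulo p: (X + 1)^q
-- - X^q - 1 has degree below q and q roots in K, and homogenising the resulting identity gives (u +
-- v)^q = u^q + v^q in every K-algebra. The same identity, read at the coefficient of X, gives p ∣
-- q, the divisibility that the fixed point argument asks of K and K². In coordinates whose first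
-- basis vector is a nonzero fixed vector, H consists of translations; rescaling that vector makes
-- one of them x ↦ x + 1. The translations then contain the prime field, so for r = 1 they are
-- exactly the prime field, and for r > 1 there are more than p of them. A transformed polynomial is
-- monic only after division by its leading coefficient; as the action is linear, this scalar does
-- not disturb the equation A ∘ f = f.

module Lists where
  open import Data.Nat.Properties using (≤-trans; ≤-reflexive; +-suc; <⇒≱; ≤-antisym; m≤m+n)
  open import Data.List using (_++_)
  open import Data.List.Properties using (length-++; ++-identityʳ)
  open import Data.List.Membership.Propositional.Properties using (∈-∃++)
  open import Data.List.Relation.Binary.Permutation.Propositional using (_↭_; ↭-refl; ↭-reflexive; ↭-trans; prep)
  open import Data.List.Relation.Binary.Permutation.Propositional.Properties using (shift; ↭-length; ∈-resp-↭)
  open import Data.List.Relation.Unary.All as All using ()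
  open import Data.List.Relation.Unary.All.Properties using (¬Any⇒All¬; map⁺)
  open import Data.List.Relation.Unary.AllPairs using ([]; _∷_)
  open import Data.List.Relation.Unary.Any using (here; there; any?)
  open import Relation.Binary.Definitions using (DecidableEquality)
  open import Relation.Binary.PropositionalEquality using (_≡_; refl; sym; trans)

  private variable
    A : Set
    x : A
    xs ys : List A

  ∈⇒↭ : x ∈ xs → ∃ λ ys → xs ↭ x ∷ ys
  ∈⇒↭ x∈xs with ys , zs , refl ← ∈-∃++ x∈xs = ys ++ zs , shift _ ys zs

  -- Each element of `xs` is extracted from `ys` in turn; uniqueness guarantees that the later ones
  -- are still present in what remains. The comparisons of lengths of duplicate-free lists below
  -- rest on this.
  unique-⊆⇒↭++ : Unique xs → (∀ {x} → x ∈ xs → x ∈ ys) → ∃ λ zs → ys ↭ xs ++ zs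
  unique-⊆⇒↭++ {ys = ys} [] sub = ys , ↭-refl
  unique-⊆⇒↭++ {xs = x ∷ xs} {ys = ys} (x∉xs ∷ u) sub with ∈⇒↭ (sub (here refl))
  ... | ys′ , ys↭ with unique-⊆⇒↭++ {ys = ys′} u sub′
    where
    sub′ : ∀ {y} → y ∈ xs → y ∈ ys′
    sub′ y∈xs with ∈-resp-↭ ys↭ (sub (there y∈xs))
    ... | here refl = contradiction refl (All.lookup x∉xs y∈xs)
    ... | there y∈ = y∈
  ... | zs , ys′↭ = zs , ↭-trans ys↭ (prep x ys′↭)

  unique-⊆⇒length≤ : Unique xs → (∀ {x} → x ∈ xs → x ∈ ys) → length xs ≤ length ys
  unique-⊆⇒length≤ {xs = xs} u sub with zs , ys↭ ← unique-⊆⇒↭++ u sub =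
    ≤-trans (m≤m+n _ (length zs)) (≤-reflexive (sym (trans (↭-length ys↭) (length-++ xs))))

  unique-⊆⊇⇒length≡ : Unique xs → Unique ys → (∀ {x} → x ∈ xs → x ∈ ys) → (∀ {x} → x ∈ ys → x ∈ xs) →
    length xs ≡ length ys
  unique-⊆⊇⇒length≡ u v sub sup = ≤-antisym (unique-⊆⇒length≤ u sub) (unique-⊆⇒length≤ v sup)

  unique-⊆⊇⇒↭ : Unique xs → Unique ys → (∀ {x} → x ∈ xs → x ∈ ys) → (∀ {x} → x ∈ ys → x ∈ xs) → ys ↭ xs
  unique-⊆⊇⇒↭ {xs = xs} u v sub sup with unique-⊆⇒↭++ u sub
  ... | [] , p = ↭-trans p (↭-reflexive (++-identityʳ xs))
  ... | z ∷ zs , p = contradiction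
    (≤-trans (≤-reflexive (trans (sym (+-suc (length xs) (length zs))) (trans (sym (length-++ xs)) (sym (↭-length p)))))
             (unique-⊆⇒length≤ v sup))
    (<⇒≱ (s≤s (m≤m+n (length xs) (length zs))))

  -- Pigeonhole: an element of `ys` outside `xs` could be put in front of `xs`, giving a
  -- duplicate-free list inside `ys` that is longer than `ys`.
  unique-⊆-long⇒⊇ : DecidableEquality A → {xs ys : List A} → Unique xs → (∀ {x} → x ∈ xs → x ∈ ys) →
    length ys ≤ length xs → ∀ {y} → y ∈ ys → y ∈ xs
  unique-⊆-long⇒⊇ _≟_ {xs} {ys} u sub long {y} y∈ys with any? (y ≟_) xs
  ... | yes y∈xs = y∈xs
  ... | no  y∉xs = contradiction long (<⇒≱ (unique-⊆⇒length≤ (¬Any⇒All¬ xs y∉xs ∷ u)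
                     λ { (here refl) → y∈ys ; (there z∈) → sub z∈ }))

  unique-map : ∀ {B : Set} (f : A → B) {xs} → (∀ {x y} → x ∈ xs → y ∈ xs → f x ≡ f y → x ≡ y) →
    Unique xs → Unique (map f xs)
  unique-map f {[]} inj [] = []
  unique-map f {x ∷ xs} inj (x∉ ∷ u) =
    map⁺ (All.tabulate (λ y∈ e → All.lookup x∉ y∈ (inj (here refl) (there y∈) e)))
    ∷ unique-map f (λ x∈ y∈ → inj (there x∈) (there y∈)) u

-- Integer sums with decidable side conditions

module Sums where
  open import Data.Nat.Divisibility using (_∣_; ∣m+n∣m⇒∣n; m∣m*n; ∣⇒≤)
  open import Data.Integer using (ℤ; 0ℤ; _+_; _*_)
  open import Data.Integer.Properties
  open import Algebra.Properties.CommutativeSemigroup +-commutativeSemigroup using (interchange)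
  open import Data.List using (foldr; upTo; applyUpTo)
  open import Data.List.Properties using (map-upTo)
  open import Function using (_∘_)
  open import Relation.Binary.PropositionalEquality
  open ≡-Reasoning

  -- Guards replace summation over divisors: every sum keeps an initial interval as its range, so
  -- that orders of summation can be exchanged without reindexing.
  when : ∀ {P : Set} → Dec P → ℤ → ℤ
  when (yes _) x = x
  when (no  _) x = 0ℤ

  module _ {P Q : Set} where
    when-cong : (P? : Dec P) (Q? : Dec Q) → (P → Q) → (Q → P) → ∀ {x y} → (P → Q → x ≡ y) →
      when P? x ≡ when Q? y
    when-cong (yes p) (yes q) f g e = e p q
    when-cong (yes p) (no ¬q) f g e = contradiction (f p) ¬q
    when-cong (no ¬p) (yes q) f g e = contradiction (g q) ¬p
    when-cong (no ¬p) (no ¬q) f g e = refl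

  module _ {P : Set} where
    when-yes : (P? : Dec P) → P → ∀ {x} → when P? x ≡ x
    when-yes (yes _) _ = refl
    when-yes (no ¬p) p = contradiction p ¬p

    when-no : (P? : Dec P) → ¬ P → ∀ {x} → when P? x ≡ 0ℤ
    when-no (yes p) ¬p = contradiction p ¬p
    when-no (no _)  _  = refl

    when-0 : (P? : Dec P) → when P? 0ℤ ≡ 0ℤ
    when-0 (yes _) = refl
    when-0 (no _)  = refl

    when-*ˡ : (P? : Dec P) → ∀ c x → c * when P? x ≡ when P? (c * x)
    when-*ˡ (yes _) c x = refl
    when-*ˡ (no _)  c x = *-zeroʳ c

  -- ∑ n g = g 1 + ⋯ + g n
  ∑ : ℕ → (ℕ → ℤ) → ℤ
  ∑ zero    g = 0ℤ
  ∑ (suc n) g = ∑ n g + g (suc n)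

  ∑-cong : ∀ n {g h} → (∀ k → 1 ≤ k → k ≤ n → g k ≡ h k) → ∑ n g ≡ ∑ n h
  ∑-cong zero    e = refl
  ∑-cong (suc n) e = cong₂ _+_ (∑-cong n (λ k 1≤k k≤n → e k 1≤k (ℕ.m≤n⇒m≤1+n k≤n))) (e (suc n) (s≤s z≤n) ℕ.≤-refl)

  ∑-0 : ∀ n → ∑ n (λ _ → 0ℤ) ≡ 0ℤ
  ∑-0 zero    = refl
  ∑-0 (suc n) = cong (_+ 0ℤ) (∑-0 n)

  ∑-+ : ∀ n g h → ∑ n (λ k → g k + h k) ≡ ∑ n g + ∑ n h
  ∑-+ zero    g h = refl
  ∑-+ (suc n) g h = trans (cong (_+ (g (suc n) + h (suc n))) (∑-+ n g h))
    (interchange (∑ n g) (∑ n h) (g (suc n)) (h (suc n)))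

  ∑-*ˡ : ∀ n c g → c * ∑ n g ≡ ∑ n (λ k → c * g k)
  ∑-*ˡ zero    c g = *-zeroʳ c
  ∑-*ˡ (suc n) c g = trans (*-distribˡ-+ c (∑ n g) (g (suc n))) (cong (_+ c * g (suc n)) (∑-*ˡ n c g))

  ∑-swap : ∀ m n (g : ℕ → ℕ → ℤ) → ∑ m (λ i → ∑ n (g i)) ≡ ∑ n (λ j → ∑ m (λ i → g i j))
  ∑-swap zero    n g = sym (∑-0 n)
  ∑-swap (suc m) n g = trans (cong (_+ ∑ n (g (suc m))) (∑-swap m n g)) (sym (∑-+ n _ (g (suc m))))

  ∑-split : ∀ m n g → ∑ (m ℕ.+ n) g ≡ ∑ m g + ∑ n (λ k → g (m ℕ.+ k))
  ∑-split m zero g = trans (cong (λ z → ∑ z g) (ℕ.+-identityʳ m)) (sym (+-identityʳ _))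
  ∑-split m (suc n) g = begin
    ∑ (m ℕ.+ suc n) g  ≡⟨ cong (λ z → ∑ z g) (ℕ.+-suc m n) ⟩
    ∑ (m ℕ.+ n) g + g (suc (m ℕ.+ n))  ≡⟨ cong₂ _+_ (∑-split m n g) (cong g (sym (ℕ.+-suc m n))) ⟩
    ∑ m g + ∑ n (λ k → g (m ℕ.+ k)) + g (m ℕ.+ suc n)  ≡⟨ +-assoc (∑ m g) _ _ ⟩
    ∑ m g + (∑ n (λ k → g (m ℕ.+ k)) + g (m ℕ.+ suc n))  ∎

  ∑-truncate : ∀ {m n} g → m ≤ n → (∀ k → m < k → g k ≡ 0ℤ) → ∑ n g ≡ ∑ m g
  ∑-truncate {m} {n} g m≤n z = begin
    ∑ n g  ≡⟨ cong (λ z → ∑ z g) (sym (ℕ.m+[n∸m]≡n m≤n)) ⟩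
    ∑ (m ℕ.+ d) g  ≡⟨ ∑-split m d g ⟩
    ∑ m g + ∑ d (λ k → g (m ℕ.+ k))  ≡⟨ cong (∑ m g +_) (trans (∑-cong d (λ k 1≤k _ → z _ (ℕ.m<m+n m 1≤k))) (∑-0 d)) ⟩
    ∑ m g + 0ℤ  ≡⟨ +-identityʳ _ ⟩
    ∑ m g  ∎
    where
    d : ℕ
    d = n ℕ.∸ m

  ∑-last : ∀ n g → (∀ k → 1 ≤ k → k < suc n → g k ≡ 0ℤ) → ∑ (suc n) g ≡ g (suc n)
  ∑-last n g z = trans (cong (_+ g (suc n)) (trans (∑-cong n (λ k 1≤k k≤n → z k 1≤k (s≤s k≤n))) (∑-0 n))) (+-identityˡ _)

  -- The range splits into n blocks of length d, each of which ends in its only multiple of d.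
  ∑-multiples : ∀ d .{{_ : NonZero d}} n g → (∀ k → ¬ d ∣ k → g k ≡ 0ℤ) → ∑ (d ℕ.* n) g ≡ ∑ n (λ k → g (d ℕ.* k))
  ∑-multiples d zero g z = cong (λ z → ∑ z g) (ℕ.*-zeroʳ d)
  ∑-multiples d@(suc d′) (suc n) g z = begin
    ∑ (d ℕ.* suc n) g  ≡⟨ cong (λ z → ∑ z g) (trans (ℕ.*-suc d n) (ℕ.+-comm d _)) ⟩
    ∑ (d ℕ.* n ℕ.+ d) g  ≡⟨ ∑-split (d ℕ.* n) d g ⟩
    ∑ (d ℕ.* n) g + ∑ d (λ k → g (d ℕ.* n ℕ.+ k))  ≡⟨ cong₂ _+_ (∑-multiples d n g z) block ⟩
    ∑ n (λ k → g (d ℕ.* k)) + g (d ℕ.* suc n)  ∎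
    where
    block : ∑ d (λ k → g (d ℕ.* n ℕ.+ k)) ≡ g (d ℕ.* suc n)
    block = trans
      (∑-last d′ _ (λ k 1≤k k<d → z _ (λ d∣ → ℕ.<⇒≱ k<d
        (∣⇒≤ {{ℕ.>-nonZero 1≤k}} (∣m+n∣m⇒∣n d∣ (m∣m*n n))))))
      (cong g (trans (ℕ.+-comm _ d) (sym (ℕ.*-suc d n))))

  ∑-head : ∀ n g → ∑ (suc n) g ≡ g 1 + ∑ n (g ∘ suc)
  ∑-head n g = trans (∑-split 1 n g) (cong (_+ ∑ n (g ∘ suc)) (+-identityˡ (g 1)))

  foldr-upTo : ∀ n (h : ℕ → ℤ) g → (∀ k → h k ≡ g (suc k)) → foldr _+_ 0ℤ (map h (upTo n)) ≡ ∑ n g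
  foldr-upTo n h g e = trans (cong (foldr _+_ 0ℤ) (map-upTo h n)) (go n h g e)
    where
    go : ∀ n (h : ℕ → ℤ) g → (∀ k → h k ≡ g (suc k)) → foldr _+_ 0ℤ (applyUpTo h n) ≡ ∑ n g
    go zero    h g e = refl
    go (suc n) h g e = trans (cong₂ _+_ (e 0) (go n (h ∘ suc) (g ∘ suc) (e ∘ suc))) (sym (∑-head n g))

  module _ {A : Set} where
    ∑ᴸ : List A → (A → ℤ) → ℤ
    ∑ᴸ []       g = 0ℤ
    ∑ᴸ (x ∷ xs) g = g x + ∑ᴸ xs g

    ∑-∑ᴸ-swap : ∀ n xs (g : ℕ → A → ℤ) → ∑ n (λ k → ∑ᴸ xs (g k)) ≡ ∑ᴸ xs (λ x → ∑ n (λ k → g k x))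
    ∑-∑ᴸ-swap n []       g = ∑-0 n
    ∑-∑ᴸ-swap n (x ∷ xs) g = trans (∑-+ n (λ k → g k x) _) (cong (∑ n (λ k → g k x) +_) (∑-∑ᴸ-swap n xs g))

-- The Möbius function and Möbius inversion over divisors prime to p

module Moebius where
  open Lists
  open Sums
  open import Data.Nat using (_^_; _/_; ≢-nonZero; >-nonZero)
  open import Data.Nat.Divisibility
  open import Data.Nat.DivMod using (m*n/n≡m; m*n/m*o≡n/o; n/1≡n)
  open import Data.Nat.GCD using (gcd; gcd-greatest)
  open import Data.Nat.Coprimality using (Coprime; coprime-divisor; coprime⇒gcd≡1)
  open import Data.Nat.Primality using (prime?; prime⇒irreducible; prime⇒nonZero; prime⇒nonTrivial; euclidsLemma; ¬prime[1])
  open import Data.Nat.ListAction using (product)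
  open import Data.Nat.Primality.Factorisation using (factorise; PrimeFactorisation)
  open import Data.Integer using (ℤ; 0ℤ; +_; -_; _+_; _*_; -1ℤ)
  import Data.Integer as ℤ
  open import Data.Integer.Properties
  open import Data.List using (foldr; upTo; filter)
  open import Data.List.Membership.Propositional.Properties
  open import Data.List.Relation.Unary.All as All using (All; []; _∷_)
  open import Data.List.Relation.Unary.Any using (here; there)
  open import Data.List.Relation.Unary.AllPairs using ([]; _∷_)
  import Data.List.Relation.Unary.Unique.Propositional.Properties as Unique
  open import Data.Sum using ([_,_]′)
  open import Function using (_∘_)
  open import Relation.Binary.PropositionalEquality
  open import Relation.Nullary.Decidable using (_×-dec_; ¬?)
  open ≡-Reasoning

  ∃-primeDivisor : ∀ n → 2 ≤ n → ∃ λ p → Prime p × p ∣ n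
  ∃-primeDivisor n 2≤n = go (factors F) (factorsPrime F) (isFactorisation F)
    where
    open PrimeFactorisation
    F : PrimeFactorisation n
    F = factorise n {{>-nonZero (ℕ.<-trans (s≤s z≤n) 2≤n)}}
    go : ∀ ps → All Prime ps → n ≡ product ps → ∃ λ p → Prime p × p ∣ n
    go []       _          e = contradiction 2≤n (ℕ.<⇒≱ (s≤s (ℕ.≤-reflexive e)))
    go (p ∷ ps) (pp ∷ _) e = p , pp , subst (p ∣_) (sym e) (m∣m*n (product ps))

  prime∤⇒coprime : ∀ {p n} → Prime p → ¬ p ∣ n → Coprime n p
  prime∤⇒coprime pp p∤n (i∣n , i∣p) with prime⇒irreducible pp i∣p
  ... | inj₁ i≡1  = i≡1
  ... | inj₂ refl = contradiction i∣n p∤n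

  prime∤1 : ∀ {p} → Prime p → ¬ p ∣ 1
  prime∤1 pp p∣1 = ¬prime[1] (subst Prime (∣1⇒≡1 p∣1) pp)

  ∈-candidates : ∀ {k n} → 1 ≤ k → k ≤ n → k ∈ candidates n
  ∈-candidates {suc k} _ k<n = ∈-map⁺ suc (∈-upTo⁺ k<n)

  candidates-unique : ∀ n → Unique (candidates n)
  candidates-unique n = Unique.map⁺ ℕ.suc-injective (Unique.upTo⁺ n)

  SquareFree : ℕ → Set
  SquareFree n = ∀ k → 2 ≤ k → ¬ k ℕ.* k ∣ n

  squareFree⇒μ : ∀ n → SquareFree n → μ n ≡ -1ℤ ℤ.^ ω n
  squareFree⇒μ n sf with squareDivisors n in eq
  ... | []     = refl
  ... | k ∷ ks with _ , 2≤k , k²∣n ← ∈-filter⁻ (λ k → (2 ℕ.≤? k) ×-dec (k ℕ.* k ∣? n)) {xs = candidates n} (subst (k ∈_) (sym eq) (here refl))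
               = contradiction k²∣n (sf k 2≤k)

  square∣⇒μ≡0 : ∀ n .{{_ : NonZero n}} k → 2 ≤ k → k ℕ.* k ∣ n → μ n ≡ 0ℤ
  square∣⇒μ≡0 n k 2≤k k²∣n with squareDivisors n in eq
  ... | _ ∷ _ = refl
  ... | []    = contradiction (subst (k ∈_) eq
                  (∈-filter⁺ (λ k → (2 ℕ.≤? k) ×-dec (k ℕ.* k ∣? n)) (∈-candidates (ℕ.<⇒≤ 2≤k) (∣⇒≤ (∣-trans (m∣m*n k) k²∣n))) (2≤k , k²∣n)))
                λ ()

  squareFree⊎square∣ : ∀ n .{{_ : NonZero n}} → SquareFree n ⊎ (∃ λ k → 2 ≤ k × k ℕ.* k ∣ n)
  squareFree⊎square∣ n with squareDivisors n in eq
  ... | []     = inj₁ λ k 2≤k k²∣n → contradiction (subst (k ∈_) eq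
                  (∈-filter⁺ (λ k → (2 ℕ.≤? k) ×-dec (k ℕ.* k ∣? n)) (∈-candidates (ℕ.<⇒≤ 2≤k) (∣⇒≤ (∣-trans (m∣m*n k) k²∣n))) (2≤k , k²∣n)))
                λ ()
  ... | k ∷ ks with _ , h ← ∈-filter⁻ (λ k → (2 ℕ.≤? k) ×-dec (k ℕ.* k ∣? n)) {xs = candidates n} (subst (k ∈_) (sym eq) (here refl))
               = inj₂ (k , h)

  module _ {ℓ : ℕ} (ℓ-prime : Prime ℓ) {e : ℕ} {{_ : NonZero e}} (ℓ∤e : ¬ ℓ ∣ e) where
    private
      instance
        ℓ≢0 : NonZero ℓ
        ℓ≢0 = prime⇒nonZero ℓ-prime
        ℓe≢0 : NonZero (ℓ ℕ.* e)
        ℓe≢0 = ℕ.m*n≢0 ℓ e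

      divisor? : ∀ n k → Dec (Prime k × k ∣ n)
      divisor? n k = prime? k ×-dec (k ∣? n)

      primeDivisor⇒∈ : ∀ n .{{_ : NonZero n}} {k} → Prime k → k ∣ n → k ∈ filter (divisor? n) (candidates n)
      primeDivisor⇒∈ n {k} pk k∣n =
        ∈-filter⁺ (divisor? n) (∈-candidates (ℕ.>-nonZero⁻¹ k {{prime⇒nonZero pk}}) (∣⇒≤ k∣n)) (pk , k∣n)

      ∈⇒primeDivisor : ∀ n {k} → k ∈ filter (divisor? n) (candidates n) → Prime k × k ∣ n
      ∈⇒primeDivisor n k∈ = proj₂ (∈-filter⁻ (divisor? n) {xs = candidates n} k∈)

    -- A prime divisor of ℓ e divides ℓ, hence is ℓ, or divides e; as ℓ ∤ e, the two kinds do not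
    -- overlap.
    ω-prime* : ω (ℓ ℕ.* e) ≡ suc (ω e)
    ω-prime* = unique-⊆⊇⇒length≡
      (Unique.filter⁺ (divisor? (ℓ ℕ.* e)) (candidates-unique (ℓ ℕ.* e)))
      (All.tabulate (λ k∈ ℓ≡k → ℓ∤e (subst (_∣ e) (sym ℓ≡k) (proj₂ (∈⇒primeDivisor e k∈))))
        ∷ Unique.filter⁺ (divisor? e) (candidates-unique e))
      to from
      where
      to : ∀ {k} → k ∈ filter (divisor? (ℓ ℕ.* e)) (candidates (ℓ ℕ.* e)) → k ∈ ℓ ∷ filter (divisor? e) (candidates e)
      to k∈ with pk , k∣ ← ∈⇒primeDivisor (ℓ ℕ.* e) k∈ with euclidsLemma ℓ e pk k∣
      ... | inj₂ k∣e = there (primeDivisor⇒∈ e pk k∣e)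
      ... | inj₁ k∣ℓ with prime⇒irreducible ℓ-prime k∣ℓ
      ...   | inj₁ refl = contradiction pk ¬prime[1]
      ...   | inj₂ k≡ℓ  = here k≡ℓ
      from : ∀ {k} → k ∈ ℓ ∷ filter (divisor? e) (candidates e) → k ∈ filter (divisor? (ℓ ℕ.* e)) (candidates (ℓ ℕ.* e))
      from (here refl) = primeDivisor⇒∈ (ℓ ℕ.* e) ℓ-prime (m∣m*n e)
      from (there k∈) with pk , k∣ ← ∈⇒primeDivisor e k∈ = primeDivisor⇒∈ (ℓ ℕ.* e) pk (∣n⇒∣m*n ℓ k∣)

    -- If ℓ ∣ k, then ℓ² ∣ ℓ e would give ℓ ∣ e; otherwise k² is coprime to ℓ and already divides e.
    squareFree-prime* : SquareFree e → SquareFree (ℓ ℕ.* e)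
    squareFree-prime* sf k 2≤k k²∣ℓe with ℓ ∣? k
    ... | yes ℓ∣k = ℓ∤e (*-cancelˡ-∣ ℓ (∣-trans (*-pres-∣ ℓ∣k ℓ∣k) k²∣ℓe))
    ... | no  ℓ∤k = sf k 2≤k (coprime-divisor (prime∤⇒coprime ℓ-prime
                      ([ ℓ∤k , ℓ∤k ]′ ∘ euclidsLemma k k ℓ-prime)) k²∣ℓe)

    μ-prime* : μ (ℓ ℕ.* e) ≡ - μ e
    μ-prime* with squareFree⊎square∣ e
    ... | inj₁ sf = begin
      μ (ℓ ℕ.* e)  ≡⟨ squareFree⇒μ (ℓ ℕ.* e) (squareFree-prime* sf) ⟩
      -1ℤ ℤ.^ ω (ℓ ℕ.* e)  ≡⟨ cong (-1ℤ ℤ.^_) ω-prime* ⟩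
      -1ℤ * -1ℤ ℤ.^ ω e  ≡⟨ -1*i≡-i _ ⟩
      - (-1ℤ ℤ.^ ω e)  ≡⟨ cong -_ (squareFree⇒μ e sf) ⟨
      - μ e  ∎
    ... | inj₂ (k , 2≤k , k²∣e) = trans (square∣⇒μ≡0 (ℓ ℕ.* e) k 2≤k (∣n⇒∣m*n ℓ k²∣e))
                                    (cong -_ (sym (square∣⇒μ≡0 e k 2≤k k²∣e)))

  μ-prime*-∣ : ∀ {ℓ} → Prime ℓ → ∀ e .{{_ : NonZero e}} → ℓ ∣ e → μ (ℓ ℕ.* e) ≡ 0ℤ
  μ-prime*-∣ {ℓ} pℓ e ℓ∣e = square∣⇒μ≡0 (ℓ ℕ.* e) {{ℕ.m*n≢0 ℓ e}} ℓ
    (ℕ.nonTrivial⇒n>1 ℓ {{prime⇒nonTrivial pℓ}}) (*-monoʳ-∣ ℓ ℓ∣e)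
    where
    instance
      ℓ≢0 : NonZero ℓ
      ℓ≢0 = prime⇒nonZero pℓ

  ∑μ : ℕ → ℤ
  ∑μ n = ∑ n (λ e → when (e ∣? n) (μ e))

  -- Pairing e with ℓ e, for a prime ℓ ∣ n and ℓ ∤ e, cancels the sum.
  ∑μ≡0 : ∀ n → 2 ≤ n → ∑μ n ≡ 0ℤ
  ∑μ≡0 n 2≤n with ∃-primeDivisor n 2≤n
  ... | ℓ , pℓ , divides n′ n≡n′ℓ with trans n≡n′ℓ (ℕ.*-comm n′ ℓ)
  ... | refl = begin
    ∑ n (λ e → when (e ∣? n) (μ e))  ≡⟨ ∑-cong n (λ e _ _ → split e) ⟩
    ∑ n (λ e → coprimePart e + multiplePart e)  ≡⟨ ∑-+ n coprimePart multiplePart ⟩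
    ∑ n coprimePart + ∑ n multiplePart  ≡⟨ cong₂ _+_ coprime-sum multiple-sum ⟩
    S + - S  ≡⟨ +-inverseʳ S ⟩
    0ℤ  ∎
    where
    instance
      ℓ≢0 : NonZero ℓ
      ℓ≢0 = prime⇒nonZero pℓ
      n′≢0 : NonZero n′
      n′≢0 = ℕ.m*n≢0⇒n≢0 ℓ {n′} {{>-nonZero (ℕ.<-trans (s≤s z≤n) 2≤n)}}
    coprimePart multiplePart : ℕ → ℤ
    coprimePart  e = when (¬? (ℓ ∣? e)) (when (e ∣? n) (μ e))
    multiplePart e = when (ℓ ∣? e) (when (e ∣? n) (μ e))
    T : ℕ → ℤ
    T e = when (¬? (ℓ ∣? e)) (when (e ∣? n′) (μ e))
    S : ℤ
    S = ∑ n′ T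
    split : ∀ e → when (e ∣? n) (μ e) ≡ coprimePart e + multiplePart e
    split e with ℓ ∣? e
    ... | yes _ = sym (+-identityˡ _)
    ... | no  _ = sym (+-identityʳ _)
    coprimePart≡T : ∀ e → coprimePart e ≡ T e
    coprimePart≡T e = when-cong (¬? (ℓ ∣? e)) (¬? (ℓ ∣? e)) (λ z → z) (λ z → z) λ ℓ∤e _ →
      when-cong (e ∣? n) (e ∣? n′) (coprime-divisor (prime∤⇒coprime pℓ ℓ∤e)) (∣n⇒∣m*n ℓ) (λ _ _ → refl)
    -- For e prime to ℓ, dividing ℓ n′ and dividing n′ are the same, so nothing beyond n′
    -- contributes.
    coprime-sum : ∑ n coprimePart ≡ S
    coprime-sum = trans (∑-cong n (λ e _ _ → coprimePart≡T e))
      (∑-truncate T (ℕ.m≤n*m n′ ℓ) λ k n′<k →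
        trans (cong (when (¬? (ℓ ∣? k))) (when-no (k ∣? n′) (λ k∣n′ → ℕ.<⇒≱ n′<k (∣⇒≤ k∣n′)))) (when-0 (¬? (ℓ ∣? k))))
    multiple-sum : ∑ n multiplePart ≡ - S
    multiple-sum = begin
      ∑ n multiplePart  ≡⟨ ∑-multiples ℓ n′ multiplePart (λ k ℓ∤k → when-no (ℓ ∣? k) ℓ∤k) ⟩
      ∑ n′ (λ k → multiplePart (ℓ ℕ.* k))  ≡⟨ ∑-cong n′ (λ k 1≤k _ → negate k {{>-nonZero 1≤k}}) ⟩
      ∑ n′ (λ k → -1ℤ * T k)  ≡⟨ ∑-*ˡ n′ -1ℤ T ⟨
      -1ℤ * S  ≡⟨ -1*i≡-i S ⟩
      - S  ∎
      where
      negate : ∀ k .{{_ : NonZero k}} → multiplePart (ℓ ℕ.* k) ≡ -1ℤ * T k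
      negate k = trans (when-yes (ℓ ∣? ℓ ℕ.* k) (m∣m*n k)) (trans
        (when-cong (ℓ ℕ.* k ∣? n) (k ∣? n′) (*-cancelˡ-∣ ℓ) (*-monoʳ-∣ ℓ) (λ _ _ → refl)) (helper (ℓ ∣? k)))
        where
        -- If ℓ ∣ k, then ℓ² ∣ ℓ k and both sides vanish; if ℓ ∤ k, the additional prime only
        -- changes the sign.
        helper : (d : Dec (ℓ ∣ k)) → when (k ∣? n′) (μ (ℓ ℕ.* k)) ≡ -1ℤ * when (¬? d) (when (k ∣? n′) (μ k))
        helper (yes ℓ∣k) = trans (cong (when (k ∣? n′)) (μ-prime*-∣ pℓ k ℓ∣k)) (when-0 (k ∣? n′))
        helper (no ℓ∤k) = begin
          when (k ∣? n′) (μ (ℓ ℕ.* k))  ≡⟨ cong (when (k ∣? n′)) (trans (μ-prime* pℓ {k} {{ℕ.≢-nonZero (ℕ.≢-nonZero⁻¹ k)}} ℓ∤k) (sym (-1*i≡-i _))) ⟩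
          when (k ∣? n′) (-1ℤ * μ k)  ≡⟨ when-*ˡ (k ∣? n′) -1ℤ (μ k) ⟨
          -1ℤ * when (k ∣? n′) (μ k)  ∎

  -- Division with junk value 0 for the divisor 0, so that it is a total function.
  infixl 7 _/′_
  _/′_ : ℕ → ℕ → ℕ
  m /′ zero  = 0
  m /′ suc d = m / suc d

  *-/′ : ∀ d .{{_ : NonZero d}} n → (d ℕ.* n) /′ d ≡ n
  *-/′ d@(suc _) n = trans (cong (_/ d) (ℕ.*-comm d n)) (m*n/n≡m n d)

  /′-cancel : ∀ e .{{_ : NonZero e}} t k .{{_ : NonZero k}} → (e ℕ.* t) /′ (e ℕ.* k) ≡ t /′ k
  /′-cancel e@(suc _) t k@(suc _) = m*n/m*o≡n/o e t k

  module _ (p : ℕ) (p-prime : Prime p) where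

    coprimeDivisor? : ∀ m e → Dec (e ∣ m × ¬ p ∣ e)
    coprimeDivisor? m e = (e ∣? m) ×-dec ¬? (p ∣? e)

    private
      -- The summand is local to `divisorSum` and cannot be named; unification against `refl`
      -- recovers it as the witness, and `term≡` then treats it pointwise.
      divisorSumTerm : ∀ q m → ∃ λ h → divisorSum q p m ≡ foldr _+_ 0ℤ (map h (upTo m))
      divisorSumTerm q m = _ , refl

      term≡ : ∀ q m k → proj₁ (divisorSumTerm q m) k ≡ when (coprimeDivisor? m (suc k)) (+ (q ^ (m /′ suc k)) * μ (suc k))
      term≡ q m k with suc k ∣? m | gcd (suc k) p ℕ.≟ 1 | p ∣? suc k
      ... | no _  | no _  | no _  = refl
      ... | no _  | no _  | yes _ = refl
      ... | no _  | yes _ | no _  = refl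
      ... | no _  | yes _ | yes _ = refl
      ... | yes _ | yes e | yes p∣k = contradiction (∣-reflexive e) λ g∣1 → prime∤1 p-prime
            (∣-trans (gcd-greatest p∣k ∣-refl) g∣1)
      ... | yes _ | yes _ | no _  = refl
      ... | yes _ | no _  | yes _ = refl
      ... | yes _ | no g≢1 | no p∤k = contradiction (coprime⇒gcd≡1 (prime∤⇒coprime p-prime p∤k)) g≢1

    divisorSum≡∑ : ∀ q m → divisorSum q p m ≡ ∑ m (λ e → when (coprimeDivisor? m e) (+ (q ^ (m /′ e)) * μ e))
    divisorSum≡∑ q m = foldr-upTo m _ _ (term≡ q m)

    module _ (a Q : ℕ → ℤ) (sumOfDivisors : ∀ m → 1 ≤ m → ∑ m (λ e → when (coprimeDivisor? m e) (a (m /′ e))) ≡ Q m) where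

      -- Inserting the hypothesis for Q (m / e) and writing s = e k turns the right side into a
      -- double sum over e ∣ s ∣ m with p ∤ s. The inner sum of μ over the divisors of s leaves only
      -- s = 1.
      moebiusInversion : ∀ m → 1 ≤ m → a m ≡ ∑ m (λ e → when (coprimeDivisor? m e) (Q (m /′ e) * μ e))
      moebiusInversion m 1≤m = sym (begin
        ∑ m (λ e → when (D e) (Q (m /′ e) * μ e))  ≡⟨ ∑-cong m expand ⟩
        ∑ m (λ e → ∑ m (λ s → when (D s) (when (e ∣? s) (a (m /′ s) * μ e))))  ≡⟨ ∑-swap m m _ ⟩
        ∑ m (λ s → ∑ m (λ e → when (D s) (when (e ∣? s) (a (m /′ s) * μ e))))  ≡⟨ ∑-cong m (λ s 1≤s s≤m → collect s 1≤s s≤m) ⟩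
        ∑ m (λ s → when (s ℕ.≟ 1) (a m))  ≡⟨ ∑-truncate _ 1≤m (λ k 1<k → when-no (k ℕ.≟ 1) (ℕ.>⇒≢ 1<k)) ⟩
        0ℤ + a m  ≡⟨ +-identityˡ _ ⟩
        a m  ∎)
        where
        instance
          m≢0 : NonZero m
          m≢0 = >-nonZero 1≤m
        D : ∀ e → Dec (e ∣ m × ¬ p ∣ e)
        D = coprimeDivisor? m

        -- As p is prime, p ∤ e k means p ∤ e and p ∤ k, so the guard for k over m / e matches the
        -- guard for s = e k over m.
        expand : ∀ e → 1 ≤ e → e ≤ m → when (D e) (Q (m /′ e) * μ e) ≡ ∑ m (λ s → when (D s) (when (e ∣? s) (a (m /′ s) * μ e)))
        expand e 1≤e e≤m with D e
        ... | no ¬d = sym (trans (∑-cong m (λ s _ _ → vanish s)) (∑-0 m))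
          where
          vanish : ∀ s → when (D s) (when (e ∣? s) (a (m /′ s) * μ e)) ≡ 0ℤ
          vanish s with D s
          ... | no _ = refl
          ... | yes (s∣m , p∤s) = when-no (e ∣? s) (λ e∣s → ¬d (∣-trans e∣s s∣m , λ p∣e → p∤s (∣-trans p∣e e∣s)))
        ... | yes (divides t m≡te , p∤e) with trans m≡te (ℕ.*-comm t e)
        ...   | refl = begin
          Q (m /′ e) * μ e  ≡⟨ cong (λ z → Q z * μ e) (*-/′ e t) ⟩
          Q t * μ e  ≡⟨ cong (_* μ e) (sumOfDivisors t 1≤t) ⟨
          ∑ t (λ k → when (coprimeDivisor? t k) (a (t /′ k))) * μ e  ≡⟨ *-comm _ (μ e) ⟩
          μ e * ∑ t (λ k → when (coprimeDivisor? t k) (a (t /′ k)))  ≡⟨ ∑-*ˡ t (μ e) _ ⟩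
          ∑ t (λ k → μ e * when (coprimeDivisor? t k) (a (t /′ k)))  ≡⟨ ∑-cong t (λ k 1≤k _ → rescale k {{>-nonZero 1≤k}}) ⟩
          ∑ t (λ k → U (e ℕ.* k))  ≡⟨ ∑-multiples e t U (λ k e∤k →
                                                                                               trans (cong (when (D k)) (when-no (e ∣? k) e∤k)) (when-0 (D k))) ⟨
          ∑ (e ℕ.* t) U  ∎
          where
          instance
            e≢0 : NonZero e
            e≢0 = >-nonZero 1≤e
          1≤t : 1 ≤ t
          1≤t = ℕ.>-nonZero⁻¹ t {{ℕ.m*n≢0⇒n≢0 e}}
          U : ℕ → ℤ
          U s = when (D s) (when (e ∣? s) (a (m /′ s) * μ e))
          rescale : ∀ k .{{_ : NonZero k}} → μ e * when (coprimeDivisor? t k) (a (t /′ k)) ≡ U (e ℕ.* k)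
          rescale k = trans (when-*ˡ (coprimeDivisor? t k) (μ e) _)
            (when-cong (coprimeDivisor? t k) (D (e ℕ.* k))
              (λ (k∣t , p∤k) → *-monoʳ-∣ e k∣t , [ p∤e , p∤k ]′ ∘ euclidsLemma e k p-prime)
              (λ (ek∣et , p∤ek) → *-cancelˡ-∣ e ek∣et , λ p∣k → p∤ek (∣n⇒∣m*n e p∣k))
              λ _ _ → trans (*-comm (μ e) _) (trans (cong (λ z → a z * μ e) (sym (/′-cancel e t k)))
                (sym (when-yes (e ∣? e ℕ.* k) (m∣m*n k)))))

        -- Under `D s` the only condition left on e is e ∣ s, so a (m / s) can be taken out of a
        -- full divisor sum of μ.
        collect : ∀ s → 1 ≤ s → s ≤ m → ∑ m (λ e → when (D s) (when (e ∣? s) (a (m /′ s) * μ e))) ≡ when (s ℕ.≟ 1) (a m)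
        collect s 1≤s s≤m with D s
        ... | no ¬d = trans (∑-0 m) (sym (when-no (s ℕ.≟ 1) (λ { refl → ¬d (1∣ m , prime∤1 p-prime) })))
        ... | yes (s∣m , p∤s) = begin
          ∑ m (λ e → when (e ∣? s) (a (m /′ s) * μ e))  ≡⟨ ∑-cong m (λ e _ _ → sym (when-*ˡ (e ∣? s) (a (m /′ s)) (μ e))) ⟩
          ∑ m (λ e → a (m /′ s) * when (e ∣? s) (μ e))  ≡⟨ ∑-*ˡ m (a (m /′ s)) _ ⟨
          a (m /′ s) * ∑ m (λ e → when (e ∣? s) (μ e))  ≡⟨ cong (a (m /′ s) *_) (∑-truncate _ s≤m (λ k s<k →
                                                                    when-no (k ∣? s) (λ k∣s → ℕ.<⇒≱ s<k (∣⇒≤ {{>-nonZero 1≤s}} k∣s)))) ⟩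
          a (m /′ s) * ∑μ s  ≡⟨ finish s 1≤s ⟩
          when (s ℕ.≟ 1) (a m)  ∎
          where
          finish : ∀ s → 1 ≤ s → a (m /′ s) * ∑μ s ≡ when (s ℕ.≟ 1) (a m)
          finish 1 _ = trans (*-identityʳ _) (cong a (n/1≡n m))
          finish s@(suc (suc _)) _ = trans (cong (a (m /′ s) *_) (∑μ≡0 s (s≤s (s≤s z≤n)))) (*-zeroʳ (a (m /′ s)))

-- Actions of groups of prime power order

module Orbits where
  open Lists
  open Moebius using (prime∤⇒coprime; prime∤1)
  open import Data.Nat using (_+_; _*_; _^_)
  open import Data.Nat.Properties using (+-suc; +-comm; ≤-trans; ≤-pred; ≤-reflexive; ≤-antisym; +-monoˡ-≤)
  open import Data.Nat.Divisibility
  open import Data.Nat.Coprimality using (coprime-divisor)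
  open import Data.List using (filter; deduplicate)
  open import Data.List.Properties using (length-map)
  open import Data.List.Membership.Propositional using (_∉_; find; lose)
  open import Data.List.Membership.Propositional.Properties
  open import Data.List.Membership.DecPropositional using (_∈?_)
  open import Data.List.Relation.Unary.All as All using (All; []; _∷_)
  open import Data.List.Relation.Unary.AllPairs using ([]; _∷_)
  open import Data.List.Relation.Unary.Any using (here; there; any?)
  import Data.List.Relation.Unary.Unique.Propositional.Properties as Unique
  open import Data.List.Relation.Unary.Unique.DecPropositional.Properties using (deduplicate-!)
  open import Relation.Binary.Definitions using (DecidableEquality)
  open import Relation.Binary.PropositionalEquality
  open import Relation.Nullary.Decidable using (¬?; _×-dec_)

  ∣prime^⇒≡1⊎∣ : ∀ {p} → Prime p → ∀ r {d} → d ∣ p ^ r → d ≡ 1 ⊎ p ∣ d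
  ∣prime^⇒≡1⊎∣ pp zero d∣ = inj₁ (∣1⇒≡1 d∣)
  ∣prime^⇒≡1⊎∣ {p} pp (suc r) {d} d∣ with p ∣? d
  ... | yes p∣d = inj₂ p∣d
  ... | no  p∤d = ∣prime^⇒≡1⊎∣ pp r (coprime-divisor (prime∤⇒coprime pp p∤d) d∣)

  length-filter-¬ : ∀ {A : Set} {P : A → Set} (P? : ∀ x → Dec (P x)) xs →
    length xs ≡ length (filter P? xs) + length (filter (λ x → ¬? (P? x)) xs)
  length-filter-¬ P? [] = refl
  length-filter-¬ P? (x ∷ xs) with P? x
  ... | yes _ = cong suc (length-filter-¬ P? xs)
  ... | no  _ = trans (cong suc (length-filter-¬ P? xs)) (sym (+-suc _ _))

  module _ {A B : Set} (_≟_ : DecidableEquality B) (h : A → B) where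

    fibre : B → List A → List A
    fibre y = filter (λ a → h a ≟ y)

    equalFibres⇒length≡* : ∀ s ys {l} → Unique l → Unique ys → (∀ {a} → a ∈ l → h a ∈ ys) →
      (∀ {y} → y ∈ ys → length (fibre y l) ≡ s) → length l ≡ length ys * s
    equalFibres⇒length≡* s [] {[]} _ _ _ _ = refl
    equalFibres⇒length≡* s [] {a ∷ l} _ _ into _ with () ← into (here refl)
    equalFibres⇒length≡* s (y ∷ ys) {l} ul (y∉ys ∷ uys) into size = trans
      (length-filter-¬ (λ a → h a ≟ y) l)
      (cong₂ _+_ (size (here refl)) (equalFibres⇒length≡* s ys (Unique.filter⁺ rest? ul) uys into′ size′))
      where
      rest? : ∀ a → Dec (¬ h a ≡ y)
      rest? a = ¬? (h a ≟ y)
      into′ : ∀ {a} → a ∈ filter rest? l → h a ∈ ys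
      into′ a∈ with a∈l , ha≢y ← ∈-filter⁻ rest? {xs = l} a∈ with into a∈l
      ... | here ha≡y = contradiction ha≡y ha≢y
      ... | there ha∈ = ha∈
      size′ : ∀ {z} → z ∈ ys → length (fibre z (filter rest? l)) ≡ s
      size′ {z} z∈ = trans (unique-⊆⊇⇒length≡ (Unique.filter⁺ (λ a → h a ≟ z) (Unique.filter⁺ rest? ul)) (Unique.filter⁺ (λ a → h a ≟ z) ul)
        (λ a∈ → let a∈′ , e = ∈-filter⁻ (λ a → h a ≟ z) {xs = filter rest? l} a∈
                in ∈-filter⁺ (λ a → h a ≟ z) (proj₁ (∈-filter⁻ rest? {xs = l} a∈′)) e)
        (λ a∈ → let a∈l , e = ∈-filter⁻ (λ a → h a ≟ z) {xs = l} a∈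
                in ∈-filter⁺ (λ a → h a ≟ z) (∈-filter⁺ rest? a∈l (λ e′ → All.lookup y∉ys z∈ (trans (sym e′) e))) e))
        (size (there z∈))

  -- The group is the list `l` inside an ambient type: closure, inverses and cancellation are
  -- demanded only of its members, so that all of `Mat2` can serve as `G`.
  module _ {G X : Set} (_≟_ : DecidableEquality X)
    (_·_ : G → G → G) (ε : G) (l : List G) (l! : Unique l) (ε∈ : ε ∈ l)
    (closed : ∀ {a b} → a ∈ l → b ∈ l → (a · b) ∈ l)
    (inverse : ∀ {a} → a ∈ l → ∃ λ b → b ∈ l × a · b ≡ ε × b · a ≡ ε)
    (cancel : ∀ {a b c} → a ∈ l → a · b ≡ a · c → b ≡ c)
    (_▹_ : G → X → X) (▹-· : ∀ a b x → (a · b) ▹ x ≡ a ▹ (b ▹ x)) (▹-ε : ∀ x → ε ▹ x ≡ x)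
    {p : ℕ} (p-prime : Prime p) (r : ℕ) (|l| : length l ≡ p ^ r)
    where

    Fixed : X → Set
    Fixed x = All (λ a → a ▹ x ≡ x) l

    fixed? : ∀ x → Dec (Fixed x)
    fixed? x = All.all? (λ a → (a ▹ x) ≟ x) l

    private
      orbit : X → List X
      orbit x = deduplicate _≟_ (map (_▹ x) l)

      ∈-orbit⁺ : ∀ {x a} → a ∈ l → a ▹ x ∈ orbit x
      ∈-orbit⁺ {x} a∈ = ∈-deduplicate⁺ _≟_ (∈-map⁺ (_▹ x) a∈)

      ∈-orbit⁻ : ∀ {x y} → y ∈ orbit x → ∃ λ a → a ∈ l × y ≡ a ▹ x
      ∈-orbit⁻ {x} y∈ = ∈-map⁻ (_▹ x) (∈-deduplicate⁻ _≟_ (map (_▹ x) l) y∈)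

      -- Left multiplication by b is injective and carries solutions of a ▹ x = y to solutions of a
      -- ▹ x = z. Used in both directions, it shows that all fibres over an orbit have equal length.
      translate-fibre : ∀ {x y z b} → b ∈ l → b ▹ y ≡ z → length (fibre _≟_ (_▹ x) y l) ≤ length (fibre _≟_ (_▹ x) z l)
      translate-fibre {x} {y} {z} {b} b∈ by≡z = ≤-trans
        (≤-reflexive (sym (length-map (b ·_) F)))
        (unique-⊆⇒length≤ (Unique.map⁺ (cancel b∈) (Unique.filter⁺ (λ a → (a ▹ x) ≟ y) l!)) sub)
        where
        F : List G
        F = fibre _≟_ (_▹ x) y l
        sub : ∀ {c} → c ∈ map (b ·_) F → c ∈ fibre _≟_ (_▹ x) z l
        sub c∈ with a , a∈F , refl ← ∈-map⁻ (b ·_) c∈ with a∈ , e ← ∈-filter⁻ (λ a → (a ▹ x) ≟ y) {xs = l} a∈F =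
          ∈-filter⁺ (λ a → (a ▹ x) ≟ z) (closed b∈ a∈) (trans (▹-· b a x) (trans (cong (b ▹_) e) by≡z))

      -- Orbit-stabiliser: a ↦ a ▹ x maps `l` onto the orbit with fibres of equal length.
      orbit-size : ∀ x → length (orbit x) ∣ p ^ r
      orbit-size x = subst (length (orbit x) ∣_) (trans (sym eq) |l|) (m∣m*n (length (fibre _≟_ (_▹ x) x l)))
        where
        fibre-size : ∀ {y} → y ∈ orbit x → length (fibre _≟_ (_▹ x) y l) ≡ length (fibre _≟_ (_▹ x) x l)
        fibre-size y∈ with a , a∈ , refl ← ∈-orbit⁻ y∈ with b , b∈ , _ , ba≡ε ← inverse a∈ =
          ≤-antisym
            (translate-fibre b∈ (trans (sym (▹-· b a x)) (trans (cong (_▹ x) ba≡ε) (▹-ε x))))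
            (translate-fibre a∈ refl)
        eq : length l ≡ length (orbit x) * length (fibre _≟_ (_▹ x) x l)
        eq = equalFibres⇒length≡* _≟_ (_▹ x) _ (orbit x) l! (deduplicate-! _≟_ (map (_▹ x) l)) ∈-orbit⁺ fibre-size

      ∈-orbit-self : ∀ x → x ∈ orbit x
      ∈-orbit-self x = subst (_∈ orbit x) (▹-ε x) (∈-orbit⁺ ε∈)

      -- An orbit of length 1 consists of x alone and would make x fixed; every other divisor of p^r
      -- is a multiple of p.
      ∣orbit : ∀ x → ¬ Fixed x → p ∣ length (orbit x)
      ∣orbit x ¬fix with ∣prime^⇒≡1⊎∣ p-prime r (orbit-size x)
      ... | inj₂ p∣ = p∣
      ... | inj₁ one = contradiction (All.tabulate (λ a∈ → single (∈-orbit⁺ a∈) (∈-orbit-self x) one)) ¬fix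
        where
        single : ∀ {ys : List X} {y z} → y ∈ ys → z ∈ ys → length ys ≡ 1 → y ≡ z
        single {_ ∷ []} (here refl) (here refl) _ = refl

      orbit-stable : ∀ {x y a} → a ∈ l → y ∈ orbit x → a ▹ y ∈ orbit x
      orbit-stable {x} a∈ y∈ with b , b∈ , refl ← ∈-orbit⁻ y∈ = subst (_∈ orbit x) (▹-· _ b x) (∈-orbit⁺ (closed a∈ b∈))

    -- Removing the orbit of the head leaves a stable list, because the group also permutes the
    -- complement of an orbit; each removed orbit has length divisible by p. The recursion is on a
    -- bound for the length.
    fixedPointFree⇒∣length : ∀ zs → Unique zs → (∀ {a z} → a ∈ l → z ∈ zs → a ▹ z ∈ zs) →
      (∀ {z} → z ∈ zs → ¬ Fixed z) → p ∣ length zs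
    fixedPointFree⇒∣length zs = go (length zs) zs (≤-reflexive refl)
      where
      go : ∀ n zs → length zs ≤ n → Unique zs → (∀ {a z} → a ∈ l → z ∈ zs → a ▹ z ∈ zs) →
        (∀ {z} → z ∈ zs → ¬ Fixed z) → p ∣ length zs
      go n [] _ _ _ _ = p ∣0
      go (suc n) zs@(x ∷ _) len zs! stable free =
        subst (p ∣_) (sym (trans (length-filter-¬ in? zs) (cong (_+ length rest) (inside-size))))
          (∣m∣n⇒∣m+n (∣orbit x (free (here refl)))
            (go n rest rest≤n (Unique.filter⁺ out? zs!) rest-stable
              (λ z∈ → free (proj₁ (∈-filter⁻ out? {xs = zs} z∈)))))
        where
        in? : ∀ z → Dec (z ∈ orbit x)
        in? z = _∈?_ _≟_ z (orbit x)
        out? : ∀ z → Dec (z ∉ orbit x)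
        out? z = ¬? (in? z)
        rest : List X
        rest = filter out? zs
        inside-size : length (filter in? zs) ≡ length (orbit x)
        inside-size = unique-⊆⊇⇒length≡ (Unique.filter⁺ in? zs!) (deduplicate-! _≟_ (map (_▹ x) l))
          (λ z∈ → proj₂ (∈-filter⁻ in? {xs = zs} z∈))
          (λ {z} z∈ → ∈-filter⁺ in? (let a , a∈ , e = ∈-orbit⁻ z∈ in subst (_∈ zs) (sym e) (stable a∈ (here refl))) z∈)
        rest-stable : ∀ {a z} → a ∈ l → z ∈ rest → a ▹ z ∈ rest
        rest-stable {a} {z} a∈ z∈ with z∈zs , z∉ ← ∈-filter⁻ out? {xs = zs} z∈ with b , b∈ , _ , ba≡ε ← inverse a∈ =
          ∈-filter⁺ out? (stable a∈ z∈zs) λ az∈ → z∉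
            (subst (_∈ orbit x) (trans (sym (▹-· b a z)) (trans (cong (_▹ z) ba≡ε) (▹-ε z))) (orbit-stable b∈ az∈))
        rest≤n : length rest ≤ n
        rest≤n = ≤-pred (≤-trans (+-monoˡ-≤ (length rest) (1≤ (∈-orbit-self x)))
          (≤-trans (≤-reflexive (sym (trans (length-filter-¬ in? zs) (cong (_+ length rest) inside-size)))) len))
          where
          1≤ : ∀ {ys : List X} {y} → y ∈ ys → 1 ≤ length ys
          1≤ (here _)  = s≤s z≤n
          1≤ (there _) = s≤s z≤n

    -- Were x₀ the only fixed point, the other points would form a stable set without fixed points,
    -- and p would divide both the total and the total minus 1.
    ∃-anotherFixedPoint : ∀ xs → Unique xs → (∀ x → x ∈ xs) → p ∣ length xs →
      ∀ x₀ → Fixed x₀ → ∃ λ x → x ≢ x₀ × Fixed x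
    ∃-anotherFixedPoint xs xs! complete p∣xs x₀ fix₀ with any? (λ x → ¬? (x ≟ x₀) ×-dec fixed? x) xs
    ... | yes some with x , _ , h ← find some = x , h
    ... | no none = contradiction (∣m+n∣m⇒∣n (subst (p ∣_) (trans size (+-comm 1 _)) p∣xs) p∣zs) (prime∤1 p-prime)
      where
      zs : List X
      zs = filter (λ x → ¬? (x ≟ x₀)) xs
      size : length xs ≡ 1 + length zs
      size = trans (length-filter-¬ (_≟ x₀) xs) (cong (_+ length zs)
        (unique-⊆⊇⇒length≡ {ys = x₀ ∷ []} (Unique.filter⁺ (_≟ x₀) xs!) ([] ∷ [])
          (λ x∈ → here (proj₂ (∈-filter⁻ (_≟ x₀) {xs = xs} x∈)))
          (λ { (here refl) → ∈-filter⁺ (_≟ x₀) (complete x₀) refl })))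
      p∣zs : p ∣ length zs
      p∣zs = fixedPointFree⇒∣length zs (Unique.filter⁺ (λ x → ¬? (x ≟ x₀)) xs!)
        (λ {a} {z} a∈ z∈ → ∈-filter⁺ (λ x → ¬? (x ≟ x₀)) (complete (a ▹ z)) λ az≡x₀ →
          proj₂ (∈-filter⁻ (λ x → ¬? (x ≟ x₀)) {xs = xs} z∈) (moves-back a∈ az≡x₀))
        (λ {z} z∈ fix → none (lose (complete z) (proj₂ (∈-filter⁻ (λ x → ¬? (x ≟ x₀)) {xs = xs} z∈) , fix)))
        where
        moves-back : ∀ {a z} → a ∈ l → a ▹ z ≡ x₀ → z ≡ x₀
        moves-back {a} {z} a∈ az≡ with b , b∈ , _ , ba≡ε ← inverse a∈ = trans
          (sym (trans (sym (▹-· b a z)) (trans (cong (_▹ z) ba≡ε) (▹-ε z))))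
          (trans (cong (b ▹_) az≡) (All.lookup fix₀ b∈))

-- Commutative rings: solver, roots of polynomials, quotients

module Ring where
  open import Algebra.Bundles using (RawRing)
  open import Algebra.Solver.Ring.AlmostCommutativeRing using (fromCommutativeRing; _-Raw-AlmostCommutative⟶_)
  open import Data.Nat using (pred)
  import Data.Nat.Properties as ℕₚ
  open import Data.Maybe using (Maybe; just; nothing)
  open import Data.List.Relation.Unary.All as All using (All; []; _∷_)
  open import Data.List.Relation.Unary.AllPairs using (AllPairs; []; _∷_)
  open import Relation.Binary.PropositionalEquality as ≡ using (_≡_)
  open import Relation.Binary.Structures using (IsEquivalence)

  NoZeroDivisors : CommutativeRing 0ℓ 0ℓ → Set
  NoZeroDivisors R = ∀ x y → x * y ≈ 0# → x ≈ 0# ⊎ y ≈ 0#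
    where open CommutativeRing R

  -- Integer coefficients, represented as formal differences of naturals, make the
  -- ring solver cancel opposite terms in a ring without decidable equality.
  module RingSolver (R : CommutativeRing 0ℓ 0ℓ) where
    open CommutativeRing R
    open import Algebra.Properties.Ring ring using (-‿distribˡ-*; -‿distribʳ-*; -0#≈0#)
    open import Algebra.Properties.AbelianGroup +-abelianGroup using (⁻¹-∙-comm; ⁻¹-involutive)
    open import Algebra.Properties.CommutativeSemigroup +-commutativeSemigroup using (interchange)
    open import Algebra.Properties.Semiring.Mult semiring using (×-homo-+; idem-×-homo-*; ×-congˡ) renaming (_×_ to _⋆_)
    open import Relation.Binary.Reasoning.Setoid setoid

    private
      Difference : RawRing 0ℓ 0ℓ
      Difference = record
        { Carrier = ℕ × ℕ
        ; _≈_ = _≡_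
        ; _+_ = λ (a , b) (c , d) → a ℕ.+ c , b ℕ.+ d
        ; _*_ = λ (a , b) (c , d) → a ℕ.* c ℕ.+ b ℕ.* d , a ℕ.* d ℕ.+ b ℕ.* c
        ; -_ = λ (a , b) → b , a
        ; 0# = 0 , 0
        ; 1# = 1 , 0
        }

      infixl 6 _⊖_
      _⊖_ : Carrier → Carrier → Carrier
      x ⊖ y = x + - y

      difference : ℕ × ℕ → Carrier
      difference (a , b) = (a ⋆ 1#) ⊖ (b ⋆ 1#)

      -- The separate clauses for 0 and 1 make these constants reduce to `0#` and `1#` themselves,
      -- so that a solved equation has exactly the form of the goal.
      ⟦_⟧ᵈ : ℕ × ℕ → Carrier
      ⟦ 0 , 0 ⟧ᵈ = 0#
      ⟦ 1 , 0 ⟧ᵈ = 1#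
      ⟦ x ⟧ᵈ     = difference x

      ⟦⟧ᵈ≈difference : ∀ x → ⟦ x ⟧ᵈ ≈ difference x
      ⟦⟧ᵈ≈difference (0 , 0)           = sym (-‿inverseʳ 0#)
      ⟦⟧ᵈ≈difference (1 , 0)           = sym (trans (+-cong (+-identityʳ 1#) -0#≈0#) (+-identityʳ 1#))
      ⟦⟧ᵈ≈difference (suc (suc _) , 0) = refl
      ⟦⟧ᵈ≈difference (0 , suc _)       = refl
      ⟦⟧ᵈ≈difference (1 , suc _)       = refl
      ⟦⟧ᵈ≈difference (suc (suc _) , suc _) = refl

      ⊖-cong : ∀ {x x′ y y′} → x ≈ x′ → y ≈ y′ → x ⊖ y ≈ x′ ⊖ y′
      ⊖-cong p r = +-cong p (-‿cong r)

      ⊖-+ : ∀ a b c d → (a + c) ⊖ (b + d) ≈ (a ⊖ b) + (c ⊖ d)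
      ⊖-+ a b c d = trans (+-congˡ (sym (⁻¹-∙-comm b d))) (interchange a c (- b) (- d))

      ×-* : ∀ a b → (a ℕ.* b) ⋆ 1# ≈ (a ⋆ 1#) * (b ⋆ 1#)
      ×-* a b = sym (idem-×-homo-* a b (*-identityˡ 1#))

      ⊖-* : ∀ a b c d → (a * c + b * d) ⊖ (a * d + b * c) ≈ (a ⊖ b) * (c ⊖ d)
      ⊖-* a b c d = sym (begin
        (a + - b) * (c + - d)  ≈⟨ distribʳ _ _ _ ⟩
        a * (c + - d) + - b * (c + - d)  ≈⟨ +-cong (distribˡ _ _ _) (distribˡ _ _ _) ⟩
        (a * c + a * - d) + (- b * c + - b * - d)  ≈⟨ +-congˡ (+-comm _ _) ⟩
        (a * c + a * - d) + (- b * - d + - b * c)  ≈⟨ interchange _ _ _ _ ⟩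
        (a * c + - b * - d) + (a * - d + - b * c)  ≈⟨ +-cong (+-congˡ neg²) (+-cong (sym (-‿distribʳ-* a d)) (sym (-‿distribˡ-* b c))) ⟩
        (a * c + b * d) + (- (a * d) + - (b * c))  ≈⟨ +-congˡ (⁻¹-∙-comm _ _) ⟩
        (a * c + b * d) + - (a * d + b * c)  ∎)
        where
        neg² : - b * - d ≈ b * d
        neg² = trans (sym (-‿distribˡ-* b (- d))) (trans (-‿cong (sym (-‿distribʳ-* b d))) (⁻¹-involutive _))

      morphism : Difference -Raw-AlmostCommutative⟶ fromCommutativeRing R
      morphism = record
        { ⟦_⟧ = ⟦_⟧ᵈ
        ; +-homo = λ { x@(a , b) y@(c , d) → trans (⟦⟧ᵈ≈difference (a ℕ.+ c , b ℕ.+ d)) (trans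
            (trans (⊖-cong (×-homo-+ 1# a c) (×-homo-+ 1# b d)) (⊖-+ _ _ _ _))
            (sym (+-cong (⟦⟧ᵈ≈difference x) (⟦⟧ᵈ≈difference y)))) }
        ; *-homo = λ { x@(a , b) y@(c , d) → trans (⟦⟧ᵈ≈difference (a ℕ.* c ℕ.+ b ℕ.* d , a ℕ.* d ℕ.+ b ℕ.* c)) (trans
            (trans
              (⊖-cong (trans (×-homo-+ 1# (a ℕ.* c) (b ℕ.* d)) (+-cong (×-* a c) (×-* b d)))
                      (trans (×-homo-+ 1# (a ℕ.* d) (b ℕ.* c)) (+-cong (×-* a d) (×-* b c))))
              (⊖-* _ _ _ _))
            (sym (*-cong (⟦⟧ᵈ≈difference x) (⟦⟧ᵈ≈difference y)))) }
        ; -‿homo = λ { x@(a , b) → trans (⟦⟧ᵈ≈difference (b , a)) (trans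
            (trans (trans (+-comm _ _) (+-congˡ (sym (⁻¹-involutive _)))) (⁻¹-∙-comm _ _))
            (-‿cong (sym (⟦⟧ᵈ≈difference x)))) }
        ; 0-homo = refl
        ; 1-homo = refl
        }

      ⊖-≈ : ∀ a b c d → a + d ≈ c + b → a ⊖ b ≈ c ⊖ d
      ⊖-≈ a b c d e = begin
        a + - b  ≈⟨ +-identityʳ _ ⟨
        (a + - b) + 0#  ≈⟨ +-congˡ (-‿inverseʳ d) ⟨
        (a + - b) + (d + - d)  ≈⟨ interchange _ _ _ _ ⟩
        (a + d) + (- b + - d)  ≈⟨ +-congʳ e ⟩
        (c + b) + (- b + - d)  ≈⟨ +-congˡ (+-comm _ _) ⟩
        (c + b) + (- d + - b)  ≈⟨ interchange _ _ _ _ ⟩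
        (c + - d) + (b + - b)  ≈⟨ +-congˡ (-‿inverseʳ b) ⟩
        (c + - d) + 0#  ≈⟨ +-identityʳ _ ⟩
        c + - d  ∎

      _≟ᵈ_ : ∀ x y → Maybe (⟦ x ⟧ᵈ ≈ ⟦ y ⟧ᵈ)
      x@(a , b) ≟ᵈ y@(c , d) with a ℕ.+ d ℕ.≟ c ℕ.+ b
      ... | yes e = just (trans (⟦⟧ᵈ≈difference x) (trans
                      (⊖-≈ _ _ _ _ (trans (sym (×-homo-+ 1# a d)) (trans (×-congˡ e) (×-homo-+ 1# c b))))
                      (sym (⟦⟧ᵈ≈difference y))))
      ... | no  _ = nothing

    open import Algebra.Solver.Ring Difference (fromCommutativeRing R) morphism _≟ᵈ_ public
      using (Polynomial; solve; _:=_; _:+_; _:*_; :-_; con)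

    :0 :1 : ∀ {n} → Polynomial n
    :0 = con (0 , 0)
    :1 = con (1 , 0)

  module Evaluation (R : CommutativeRing 0ℓ 0ℓ) where
    open CommutativeRing R
    open RingSolver R
    open import Relation.Binary.Reasoning.Setoid setoid

    eval : List Carrier → Carrier → Carrier
    eval []      x = 0#
    eval (a ∷ g) x = a + x * eval g x

    eval-cong : ∀ g {x y} → x ≈ y → eval g x ≈ eval g y
    eval-cong []      e = refl
    eval-cong (a ∷ g) e = +-congˡ (*-cong e (eval-cong g e))

    -- Synthetic division by x - r: the coefficients are the Horner values at r of the nonempty
    -- proper tails of the list.
    quot : Carrier → List Carrier → List Carrier
    quot r []          = []
    quot r (a ∷ [])    = []
    quot r (a ∷ b ∷ g) = eval (b ∷ g) r ∷ quot r (b ∷ g)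

    eval-quot : ∀ r g x → eval g x ≈ eval g r + (x + - r) * eval (quot r g) x
    eval-quot r [] x = solve 2 (λ x r → :0 := :0 :+ (x :+ :- r) :* :0) refl x r
    eval-quot r (a ∷ []) x =
      solve 3 (λ a x r → a :+ x :* :0 := a :+ r :* :0 :+ (x :+ :- r) :* :0) refl a x r
    eval-quot r (a ∷ g@(_ ∷ _)) x = trans (+-congˡ (*-congˡ (eval-quot r g x)))
      (solve 5 (λ a x r e k → a :+ x :* (e :+ (x :+ :- r) :* k)
                           := a :+ r :* e :+ (x :+ :- r) :* (e :+ x :* k))
         refl a x r (eval g r) (eval (quot r g) x))

    length-quot : ∀ r g → length (quot r g) ≡ pred (length g)
    length-quot r []          = ≡.refl
    length-quot r (a ∷ [])    = ≡.refl
    length-quot r (a ∷ b ∷ g) = ≡.cong suc (length-quot r (b ∷ g))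

    quot-zero : ∀ r g → eval g r ≈ 0# → All (_≈ 0#) (quot r g) → All (_≈ 0#) g
    quot-zero r [] e z = []
    quot-zero r (a ∷ []) e z =
      trans (solve 2 (λ a r → a := a :+ r :* :0) refl a r) e ∷ []
    quot-zero r (a ∷ g@(_ ∷ _)) e (e′ ∷ z) =
      trans (trans (solve 2 (λ a r → a := a :+ r :* :0) refl a r) (+-congˡ (*-congˡ (sym e′)))) e
      ∷ quot-zero r g e′ z

    x-y≈0⇒x≈y : ∀ {x y} → x + - y ≈ 0# → x ≈ y
    x-y≈0⇒x≈y {x} {y} e = trans (solve 2 (λ x y → x := (x :+ :- y) :+ y) refl x y)
      (trans (+-congʳ e) (+-identityˡ y))

    x≈y⇒x-y≈0 : ∀ {x y} → x ≈ y → x + - y ≈ 0#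
    x≈y⇒x-y≈0 {x} {y} e = trans (+-congʳ e) (-‿inverseʳ y)

    -- Splitting off x - r shortens the list by one and keeps every other root s, because s - r is
    -- nonzero and there are no zero divisors. The conclusion concerns the coefficients, not merely
    -- the values.
    tooManyRoots⇒zero : NoZeroDivisors R → ∀ g rs → AllPairs _≉_ rs →
      All (λ r → eval g r ≈ 0#) rs → length g ≤ length rs → All (_≈ 0#) g
    tooManyRoots⇒zero dom [] [] _ _ _ = []
    tooManyRoots⇒zero dom g (r ∷ rs) (r≉rs ∷ distinct) (gr ∷ grs) len =
      quot-zero r g gr (tooManyRoots⇒zero dom (quot r g) rs distinct
        (All.zipWith (λ (r≉s , gs) → root r≉s gs) (r≉rs , grs))
        (≡.subst (_≤ length rs) (≡.sym (length-quot r g)) (ℕₚ.pred-mono-≤ len)))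
      where
      root : ∀ {s} → r ≉ s → eval g s ≈ 0# → eval (quot r g) s ≈ 0#
      root {s} r≉s gs with dom (s + - r) (eval (quot r g) s)
        (begin
          (s + - r) * eval (quot r g) s  ≈⟨ +-identityˡ _ ⟨
          0# + (s + - r) * eval (quot r g) s  ≈⟨ +-congʳ gr ⟨
          eval g r + (s + - r) * eval (quot r g) s  ≈⟨ eval-quot r g s ⟨
          eval g s  ≈⟨ gs ⟩
          0#  ∎)
      ... | inj₁ e = contradiction (sym (x-y≈0⇒x≈y e)) r≉s
      ... | inj₂ e = e

  module Quotient (R : CommutativeRing 0ℓ 0ℓ) (f : CommutativeRing.Carrier R) where
    open CommutativeRing R
    open RingSolver R

    infix 4 _≈/_
    -- The quotient ring keeps the elements of R and only coarsens their equality, so no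
    -- representatives are chosen. The quotient is stored because it becomes the cofactor in
    -- statements of divisibility.
    record _≈/_ (x y : Carrier) : Set where
      constructor _,_
      field
        quotient : Carrier
        equation : x ≈ y + f * quotient

    ≈⇒≈/ : ∀ {x y} → x ≈ y → x ≈/ y
    ≈⇒≈/ {x} {y} e = 0# , trans e (solve 2 (λ y f → y := y :+ f :* :0) refl y f)

    private
      ≈/-isEquivalence : IsEquivalence _≈/_
      ≈/-isEquivalence = record
        { refl = ≈⇒≈/ refl
        ; sym = λ {x} {y} (k , e) → - k ,
            trans (solve 3 (λ y f k → y := (y :+ f :* k) :+ f :* (:- k)) refl y f k) (+-congʳ (sym e))
        ; trans = λ {x} {y} {z} (k , e) (l , e′) → l + k ,
            trans e (trans (+-congʳ e′)
              (solve 4 (λ z f l k → z :+ f :* l :+ f :* k := z :+ f :* (l :+ k)) refl z f l k))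
        }

      +-cong/ : ∀ {x y u v} → x ≈/ y → u ≈/ v → x + u ≈/ y + v
      +-cong/ {y = y} {v = v} (k , e) (l , e′) = k + l ,
        trans (+-cong e e′)
          (solve 5 (λ y v f k l → (y :+ f :* k) :+ (v :+ f :* l) := y :+ v :+ f :* (k :+ l)) refl y v f k l)

      *-cong/ : ∀ {x y u v} → x ≈/ y → u ≈/ v → x * u ≈/ y * v
      *-cong/ {y = y} {v = v} (k , e) (l , e′) = k * v + y * l + f * k * l ,
        trans (*-cong e e′)
          (solve 5 (λ y v f k l → (y :+ f :* k) :* (v :+ f :* l)
             := y :* v :+ f :* (k :* v :+ y :* l :+ f :* k :* l)) refl y v f k l)

      -‿cong/ : ∀ {x y} → x ≈/ y → - x ≈/ - y
      -‿cong/ {y = y} (k , e) = - k , trans (-‿cong e)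
        (solve 3 (λ y f k → :- (y :+ f :* k) := :- y :+ f :* (:- k)) refl y f k)

    R/f : CommutativeRing 0ℓ 0ℓ
    R/f = record
      { Carrier = Carrier
      ; _≈_ = _≈/_
      ; _+_ = _+_
      ; _*_ = _*_
      ; -_ = -_
      ; 0# = 0#
      ; 1# = 1#
      ; isCommutativeRing = record
        { isRing = record
          { +-isAbelianGroup = record
            { isGroup = record
              { isMonoid = record
                { isSemigroup = record
                  { isMagma = record { isEquivalence = ≈/-isEquivalence ; ∙-cong = +-cong/ }
                  ; assoc = λ x y z → ≈⇒≈/ (+-assoc x y z)
                  }
                ; identity = (λ x → ≈⇒≈/ (+-identityˡ x)) , (λ x → ≈⇒≈/ (+-identityʳ x))
                }
              ; inverse = (λ x → ≈⇒≈/ (-‿inverseˡ x)) , (λ x → ≈⇒≈/ (-‿inverseʳ x))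
              ; ⁻¹-cong = -‿cong/
              }
            ; comm = λ x y → ≈⇒≈/ (+-comm x y)
            }
          ; *-cong = *-cong/
          ; *-assoc = λ x y z → ≈⇒≈/ (*-assoc x y z)
          ; *-identity = (λ x → ≈⇒≈/ (*-identityˡ x)) , (λ x → ≈⇒≈/ (*-identityʳ x))
          ; distrib = (λ x y z → ≈⇒≈/ (distribˡ x y z)) , (λ x y z → ≈⇒≈/ (distribʳ x y z))
          }
        ; *-comm = λ x y → ≈⇒≈/ (*-comm x y)
        }
      }

-- The polynomial ring over K

module Polynomial (K : FiniteField) where
  open Ring
  open import Data.List using (allFin)
  open import Data.List.Properties using (length-map; length-tabulate)
  open import Data.List.Membership.Propositional.Properties using (∈-map⁺; ∈-allFin)
  import Data.List.Relation.Unary.Unique.Propositional.Properties as Unique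
  import Data.Fin.Properties as Fin
  open import Function.Bundles using (Inverse)
  open import Function.Properties.Inverse using (Inverse⇒Injection)
  open import Relation.Binary.Definitions using (DecidableEquality)
  open import Relation.Binary.PropositionalEquality
  open import Relation.Nullary.Decidable using (via-injection)

  open FiniteField K public
  open Over K public

  𝕂 : CommutativeRing 0ℓ 0ℓ
  𝕂 = record { isCommutativeRing = isCommutativeRing }

  module 𝕂 = CommutativeRing 𝕂
  open RingSolver 𝕂 public using () renaming
    (solve to solve𝕂; _:=_ to _⊜_; _:+_ to _⊞_; _:*_ to _⊡_; :-_ to ⊟_; :0 to 𝟘; :1 to 𝟙)

  _≟_ : DecidableEquality Carrier
  _≟_ = via-injection (Inverse⇒Injection enumeration) Fin._≟_

  elements : List Carrier
  elements = map (Inverse.from enumeration) (allFin q)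

  elements-unique : Unique elements
  elements-unique = Unique.map⁺ (λ {x} {y} e → trans (sym (Inverse.strictlyInverseˡ enumeration x))
    (trans (cong (Inverse.to enumeration) e) (Inverse.strictlyInverseˡ enumeration y))) (Unique.allFin⁺ q)

  ∈-elements : ∀ x → x ∈ elements
  ∈-elements x = subst (_∈ elements) (Inverse.strictlyInverseʳ enumeration x)
    (∈-map⁺ (Inverse.from enumeration) (∈-allFin (Inverse.to enumeration x)))

  length-elements : length elements ≡ q
  length-elements = trans (length-map _ (allFin q)) (length-tabulate (λ i → i))

  -- The junk value at 0 is 0.
  infix 9 _⁻¹
  _⁻¹ : Carrier → Carrier
  x ⁻¹ with x ≟ 0#
  ... | yes _ = 0#
  ... | no x≢0 = proj₁ (inverse x x≢0)

  *-inverseʳ : ∀ {x} → x ≢ 0# → x * x ⁻¹ ≡ 1#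
  *-inverseʳ {x} x≢0 with x ≟ 0#
  ... | yes x≡0 = contradiction x≡0 x≢0
  ... | no x≢0′ = proj₂ (inverse x x≢0′)

  *-inverseˡ : ∀ {x} → x ≢ 0# → x ⁻¹ * x ≡ 1#
  *-inverseˡ x≢0 = trans (𝕂.*-comm _ _) (*-inverseʳ x≢0)

  𝕂-noZeroDivisors : NoZeroDivisors 𝕂
  𝕂-noZeroDivisors x y xy≡0 with x ≟ 0#
  ... | yes x≡0 = inj₁ x≡0
  ... | no  x≢0 = inj₂ (begin
    y  ≡⟨ 𝕂.*-identityˡ y ⟨
    1# * y  ≡⟨ cong (_* y) (*-inverseˡ x≢0) ⟨
    x ⁻¹ * x * y  ≡⟨ 𝕂.*-assoc _ _ _ ⟩
    x ⁻¹ * (x * y)  ≡⟨ cong (x ⁻¹ *_) xy≡0 ⟩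
    x ⁻¹ * 0#  ≡⟨ 𝕂.zeroʳ _ ⟩
    0#  ∎)
    where open ≡-Reasoning

  *-≢0 : ∀ {x y} → x ≢ 0# → y ≢ 0# → x * y ≢ 0#
  *-≢0 x≢0 y≢0 e with 𝕂-noZeroDivisors _ _ e
  ... | inj₁ x≡0 = x≢0 x≡0
  ... | inj₂ y≡0 = y≢0 y≡0

  ⁻¹-≢0 : ∀ {x} → x ≢ 0# → x ⁻¹ ≢ 0#
  ⁻¹-≢0 x≢0 e = 0≢1 (trans (sym (𝕂.zeroʳ _)) (trans (cong (_ *_) (sym e)) (*-inverseʳ x≢0)))

  -- A record, so that the polynomials can be inferred from an equation between them.
  infix 4 _≋_
  record _≋_ (f g : Poly) : Set where
    constructor mk≋
    field coeffs : f ≈ₚ g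
  open _≋_ public

  ≋-refl : ∀ {f} → f ≋ f
  ≋-refl .coeffs i = refl

  ≋-sym : ∀ {f g} → f ≋ g → g ≋ f
  ≋-sym e .coeffs i = sym (coeffs e i)

  ≋-trans : ∀ {f g h} → f ≋ g → g ≋ h → f ≋ h
  ≋-trans e e′ .coeffs i = trans (coeffs e i) (coeffs e′ i)

  ≋-reflexive : ∀ {f g} → f ≡ g → f ≋ g
  ≋-reflexive refl = ≋-refl

  ∷-cong : ∀ {a b f g} → a ≡ b → f ≋ g → a ∷ f ≋ b ∷ g
  ∷-cong a≡b e .coeffs zero    = a≡b
  ∷-cong a≡b e .coeffs (suc i) = coeffs e i

  coeff-+ₚ : ∀ f g i → coeff (f +ₚ g) i ≡ coeff f i + coeff g i
  coeff-+ₚ []      g       i       = sym (𝕂.+-identityˡ _)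
  coeff-+ₚ (a ∷ f) []      i       = sym (𝕂.+-identityʳ _)
  coeff-+ₚ (a ∷ f) (b ∷ g) zero    = refl
  coeff-+ₚ (a ∷ f) (b ∷ g) (suc i) = coeff-+ₚ f g i

  coeff-scale : ∀ c f i → coeff (scale c f) i ≡ c * coeff f i
  coeff-scale c []      i       = sym (𝕂.zeroʳ c)
  coeff-scale c (a ∷ f) zero    = refl
  coeff-scale c (a ∷ f) (suc i) = coeff-scale c f i

  negate : Poly → Poly
  negate = map -_

  private
    coeff-negate : ∀ f i → coeff (negate f) i ≡ - coeff f i
    coeff-negate []      i       = solve𝕂 0 (𝟘 ⊜ ⊟ 𝟘) refl
    coeff-negate (a ∷ f) zero    = refl
    coeff-negate (a ∷ f) (suc i) = coeff-negate f i

    coeff-*ₚ-∷-zero : ∀ a f g → coeff ((a ∷ f) *ₚ g) 0 ≡ a * coeff g 0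
    coeff-*ₚ-∷-zero a f g = trans (coeff-+ₚ (scale a g) (0# ∷ f *ₚ g) 0)
      (trans (𝕂.+-identityʳ _) (coeff-scale a g 0))

    coeff-*ₚ-∷-suc : ∀ a f g i → coeff ((a ∷ f) *ₚ g) (suc i) ≡ a * coeff g (suc i) + coeff (f *ₚ g) i
    coeff-*ₚ-∷-suc a f g i = trans (coeff-+ₚ (scale a g) (0# ∷ f *ₚ g) (suc i))
      (cong (_+ coeff (f *ₚ g) i) (coeff-scale a g (suc i)))

    *ₚ-congʳ : ∀ f {g h} → g ≋ h → f *ₚ g ≋ f *ₚ h
    *ₚ-congʳ [] e = ≋-refl
    *ₚ-congʳ (a ∷ f) {g} {h} e .coeffs zero =
      trans (coeff-*ₚ-∷-zero a f g) (trans (cong (a *_) (coeffs e 0)) (sym (coeff-*ₚ-∷-zero a f h)))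
    *ₚ-congʳ (a ∷ f) {g} {h} e .coeffs (suc i) = trans (coeff-*ₚ-∷-suc a f g i)
      (trans (cong₂ _+_ (cong (a *_) (coeffs e (suc i))) (coeffs (*ₚ-congʳ f e) i)) (sym (coeff-*ₚ-∷-suc a f h i)))

    *ₚ-zeroʳ : ∀ f → f *ₚ [] ≋ []
    *ₚ-zeroʳ [] = ≋-refl
    *ₚ-zeroʳ (a ∷ f) .coeffs zero    = refl
    *ₚ-zeroʳ (a ∷ f) .coeffs (suc i) = coeffs (*ₚ-zeroʳ f) i

    *ₚ-∷ʳ : ∀ f b g → f *ₚ (b ∷ g) ≋ scale b f +ₚ (0# ∷ f *ₚ g)
    *ₚ-∷ʳ [] b g .coeffs zero = refl
    *ₚ-∷ʳ [] b g .coeffs (suc i) = refl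
    *ₚ-∷ʳ (a ∷ f) b g .coeffs zero =
      solve𝕂 2 (λ a b → a ⊡ b ⊞ 𝟘 ⊜ b ⊡ a ⊞ 𝟘) refl a b
    *ₚ-∷ʳ (a ∷ f) b g .coeffs (suc i) = begin
      coeff (scale a g +ₚ f *ₚ (b ∷ g)) i  ≡⟨ coeff-+ₚ (scale a g) _ i ⟩
      coeff (scale a g) i + coeff (f *ₚ (b ∷ g)) i  ≡⟨ cong (coeff (scale a g) i +_)
                                                                              (trans (coeffs (*ₚ-∷ʳ f b g) i) (coeff-+ₚ (scale b f) _ i)) ⟩
      coeff (scale a g) i + (coeff (scale b f) i + coeff (0# ∷ f *ₚ g) i) ≡⟨ solve𝕂 3 (λ x y z → x ⊞ (y ⊞ z) ⊜ y ⊞ (x ⊞ z)) refl _ _ _ ⟩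
      coeff (scale b f) i + (coeff (scale a g) i + coeff (0# ∷ f *ₚ g) i) ≡⟨ cong (coeff (scale b f) i +_) (coeff-+ₚ (scale a g) _ i) ⟨
      coeff (scale b f) i + coeff ((a ∷ f) *ₚ g) i  ≡⟨ coeff-+ₚ (scale b f) _ i ⟨
      coeff (scale b f +ₚ (a ∷ f) *ₚ g) i  ∎
      where open ≡-Reasoning

    +ₚ-cong : ∀ {f f′ g g′} → f ≋ f′ → g ≋ g′ → f +ₚ g ≋ f′ +ₚ g′
    +ₚ-cong {f} {f′} {g} {g′} e e′ .coeffs i =
      trans (coeff-+ₚ f g i) (trans (cong₂ _+_ (coeffs e i) (coeffs e′ i)) (sym (coeff-+ₚ f′ g′ i)))

    *ₚ-comm : ∀ f g → f *ₚ g ≋ g *ₚ f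
    *ₚ-comm []      g = ≋-sym (*ₚ-zeroʳ g)
    *ₚ-comm (a ∷ f) g = ≋-trans (+ₚ-cong {scale a g} ≋-refl (∷-cong refl (*ₚ-comm f g))) (≋-sym (*ₚ-∷ʳ g a f))

    *ₚ-cong : ∀ {f f′ g g′} → f ≋ f′ → g ≋ g′ → f *ₚ g ≋ f′ *ₚ g′
    *ₚ-cong {f} {f′} {g} {g′} e e′ = ≋-trans (*ₚ-congʳ f e′)
      (≋-trans (*ₚ-comm f g′) (≋-trans (*ₚ-congʳ g′ e) (*ₚ-comm g′ f′)))

    *ₚ-distribʳ : ∀ h f g → (f +ₚ g) *ₚ h ≋ f *ₚ h +ₚ g *ₚ h
    *ₚ-distribʳ h []      g       = ≋-refl
    *ₚ-distribʳ h (a ∷ f) []      .coeffs i = trans (sym (𝕂.+-identityʳ _)) (sym (coeff-+ₚ ((a ∷ f) *ₚ h) [] i))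
    *ₚ-distribʳ h (a ∷ f) (b ∷ g) .coeffs zero =
      trans (coeff-*ₚ-∷-zero (a + b) (f +ₚ g) h) (trans (𝕂.distribʳ _ a b) (trans
        (cong₂ _+_ (sym (coeff-*ₚ-∷-zero a f h)) (sym (coeff-*ₚ-∷-zero b g h)))
        (sym (coeff-+ₚ ((a ∷ f) *ₚ h) ((b ∷ g) *ₚ h) 0))))
    *ₚ-distribʳ h (a ∷ f) (b ∷ g) .coeffs (suc i) = trans
      (trans (coeff-*ₚ-∷-suc (a + b) (f +ₚ g) h i)
        (cong ((a + b) * coeff h (suc i) +_) (trans (coeffs (*ₚ-distribʳ h f g) i) (coeff-+ₚ (f *ₚ h) (g *ₚ h) i))))
      (trans (solve𝕂 5 (λ a b h x y → (a ⊞ b) ⊡ h ⊞ (x ⊞ y) ⊜ (a ⊡ h ⊞ x) ⊞ (b ⊡ h ⊞ y)) refl a b _ _ _)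
        (trans (cong₂ _+_ (sym (coeff-*ₚ-∷-suc a f h i)) (sym (coeff-*ₚ-∷-suc b g h i)))
          (sym (coeff-+ₚ ((a ∷ f) *ₚ h) ((b ∷ g) *ₚ h) (suc i)))))

    scale-*ₚ : ∀ c f g → scale c f *ₚ g ≋ scale c (f *ₚ g)
    scale-*ₚ c [] g = ≋-refl
    scale-*ₚ c (a ∷ f) g .coeffs zero = trans (coeff-*ₚ-∷-zero (c * a) (scale c f) g) (trans (𝕂.*-assoc c a _)
      (trans (cong (c *_) (sym (coeff-*ₚ-∷-zero a f g))) (sym (coeff-scale c ((a ∷ f) *ₚ g) 0))))
    scale-*ₚ c (a ∷ f) g .coeffs (suc i) = trans (coeff-*ₚ-∷-suc (c * a) (scale c f) g i)
      (trans (cong (c * a * coeff g (suc i) +_) (trans (coeffs (scale-*ₚ c f g) i) (coeff-scale c (f *ₚ g) i)))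
      (trans (solve𝕂 4 (λ c a x y → c ⊡ a ⊡ x ⊞ c ⊡ y ⊜ c ⊡ (a ⊡ x ⊞ y)) refl c a _ _)
      (trans (cong (c *_) (sym (coeff-*ₚ-∷-suc a f g i))) (sym (coeff-scale c ((a ∷ f) *ₚ g) (suc i))))))

    0∷-*ₚ : ∀ f g → (0# ∷ f) *ₚ g ≋ 0# ∷ f *ₚ g
    0∷-*ₚ f g .coeffs zero    = trans (coeff-*ₚ-∷-zero 0# f g) (𝕂.zeroˡ _)
    0∷-*ₚ f g .coeffs (suc i) = trans (coeff-*ₚ-∷-suc 0# f g i)
      (trans (cong (_+ coeff (f *ₚ g) i) (𝕂.zeroˡ _)) (𝕂.+-identityˡ _))

    *ₚ-assoc : ∀ f g h → (f *ₚ g) *ₚ h ≋ f *ₚ (g *ₚ h)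
    *ₚ-assoc []      g h = ≋-refl
    *ₚ-assoc (a ∷ f) g h = ≋-trans (*ₚ-distribʳ h (scale a g) (0# ∷ f *ₚ g))
      (+ₚ-cong (scale-*ₚ a g h) (≋-trans (0∷-*ₚ (f *ₚ g) h) (∷-cong refl (*ₚ-assoc f g h))))

    *ₚ-identityˡ : ∀ g → (1# ∷ []) *ₚ g ≋ g
    *ₚ-identityˡ g .coeffs zero    = trans (coeff-*ₚ-∷-zero 1# [] g) (𝕂.*-identityˡ _)
    *ₚ-identityˡ g .coeffs (suc i) = trans (coeff-*ₚ-∷-suc 1# [] g i) (trans (𝕂.+-identityʳ _) (𝕂.*-identityˡ _))

  -- The operations are opaque for the sake of unification.
  opaque
    infixl 6 _⊕_
    infixl 7 _⊗_
    infix 8 ⊝_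
    _⊕_ _⊗_ : Poly → Poly → Poly
    _⊕_ = _+ₚ_
    _⊗_ = _*ₚ_

    ⊝_ : Poly → Poly
    ⊝_ = negate

    ⊕≡+ₚ : ∀ f g → f ⊕ g ≡ f +ₚ g
    ⊕≡+ₚ f g = refl

    ⊗≡*ₚ : ∀ f g → f ⊗ g ≡ f *ₚ g
    ⊗≡*ₚ f g = refl

    coeff-⊕ : ∀ f g i → coeff (f ⊕ g) i ≡ coeff f i + coeff g i
    coeff-⊕ = coeff-+ₚ

    coeff-⊝ : ∀ f i → coeff (⊝ f) i ≡ - coeff f i
    coeff-⊝ = coeff-negate

    coeff-∷-⊗-zero : ∀ a f g → coeff ((a ∷ f) ⊗ g) 0 ≡ a * coeff g 0
    coeff-∷-⊗-zero = coeff-*ₚ-∷-zero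

    coeff-∷-⊗-suc : ∀ a f g i → coeff ((a ∷ f) ⊗ g) (suc i) ≡ a * coeff g (suc i) + coeff (f ⊗ g) i
    coeff-∷-⊗-suc = coeff-*ₚ-∷-suc

    []-⊗ : ∀ g → [] ⊗ g ≡ []
    []-⊗ g = refl

    ⊗-cong : ∀ {f f′ g g′} → f ≋ f′ → g ≋ g′ → f ⊗ g ≋ f′ ⊗ g′
    ⊗-cong = *ₚ-cong

    ⊗-comm : ∀ f g → f ⊗ g ≋ g ⊗ f
    ⊗-comm = *ₚ-comm

    ⊗-assoc : ∀ f g h → (f ⊗ g) ⊗ h ≋ f ⊗ (g ⊗ h)
    ⊗-assoc = *ₚ-assoc

    ⊗-identityˡ : ∀ g → (1# ∷ []) ⊗ g ≋ g
    ⊗-identityˡ = *ₚ-identityˡ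

    ⊗-distribʳ : ∀ h f g → (f ⊕ g) ⊗ h ≋ f ⊗ h ⊕ g ⊗ h
    ⊗-distribʳ = *ₚ-distribʳ

  private
    pointwise⊕ : ∀ {f g h k} → (∀ i → coeff f i + coeff g i ≡ coeff h i + coeff k i) → f ⊕ g ≋ h ⊕ k
    pointwise⊕ {f} {g} {h} {k} e .coeffs i = trans (coeff-⊕ f g i) (trans (e i) (sym (coeff-⊕ h k i)))

  𝕂[X] : CommutativeRing 0ℓ 0ℓ
  𝕂[X] = record
    { Carrier = Poly
    ; _≈_ = _≋_
    ; _+_ = _⊕_
    ; _*_ = _⊗_
    ; -_ = ⊝_
    ; 0# = []
    ; 1# = 1# ∷ []
    ; isCommutativeRing = record
      { isRing = record
        { +-isAbelianGroup = record
          { isGroup = record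
            { isMonoid = record
              { isSemigroup = record
                { isMagma = record
                  { isEquivalence = record { refl = ≋-refl ; sym = ≋-sym ; trans = ≋-trans }
                  ; ∙-cong = λ e e′ → pointwise⊕ (λ i → cong₂ _+_ (coeffs e i) (coeffs e′ i))
                  }
                ; assoc = λ f g h → pointwise⊕ (λ i → trans (cong (_+ coeff h i) (coeff-⊕ f g i))
                    (trans (𝕂.+-assoc _ _ _) (cong (coeff f i +_) (sym (coeff-⊕ g h i)))))
                }
              ; identity = (λ f → mk≋ (λ i → trans (coeff-⊕ [] f i) (𝕂.+-identityˡ _)))
                         , (λ f → mk≋ (λ i → trans (coeff-⊕ f [] i) (𝕂.+-identityʳ _)))
              }
            ; inverse = (λ f → mk≋ (λ i → trans (coeff-⊕ (⊝ f) f i) (trans (cong (_+ coeff f i) (coeff-⊝ f i)) (𝕂.-‿inverseˡ _))))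
                      , (λ f → mk≋ (λ i → trans (coeff-⊕ f (⊝ f) i) (trans (cong (coeff f i +_) (coeff-⊝ f i)) (𝕂.-‿inverseʳ _))))
            ; ⁻¹-cong = λ {f} {g} e → mk≋ (λ i → trans (coeff-⊝ f i) (trans (cong -_ (coeffs e i)) (sym (coeff-⊝ g i))))
            }
          ; comm = λ f g → pointwise⊕ (λ i → 𝕂.+-comm (coeff f i) (coeff g i))
          }
        ; *-cong = ⊗-cong
        ; *-assoc = ⊗-assoc
        ; *-identity = ⊗-identityˡ , λ f → ≋-trans (⊗-comm f _) (⊗-identityˡ f)
        ; distrib = (λ f g h → ≋-trans (⊗-comm f (g ⊕ h)) (≋-trans (⊗-distribʳ f g h)
                       (pointwise⊕ (λ i → cong₂ _+_ (coeffs (⊗-comm g f) i) (coeffs (⊗-comm h f) i)))))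
                  , ⊗-distribʳ
        }
      ; *-comm = ⊗-comm
      }
    }

  module 𝕂[X] = CommutativeRing 𝕂[X]

-- Degrees, monic polynomials and division with remainder

module Degree (K : FiniteField) where
  open Ring
  open Polynomial K
  open import Data.Fin using (toℕ)
  open import Data.Vec using (Vec; []; _∷_; tabulate)
  open import Data.Vec.Properties using (tabulate-cong)
  open import Function using (_∘_)
  open import Relation.Binary.Definitions using (tri<; tri≈; tri>)
  open import Relation.Binary.PropositionalEquality
  open RingSolver 𝕂[X]

  κ : Carrier → Poly
  κ a = a ∷ []

  X : Poly
  X = 0# ∷ 1# ∷ []

  coeff-κ⊗ : ∀ c f i → coeff (κ c ⊗ f) i ≡ c * coeff f i
  coeff-κ⊗ c f zero    = coeff-∷-⊗-zero c [] f
  coeff-κ⊗ c f (suc i) = trans (coeff-∷-⊗-suc c [] f i)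
    (trans (cong (λ z → c * coeff f (suc i) + coeff z i) ([]-⊗ f)) (𝕂.+-identityʳ _))

  scale≋κ⊗ : ∀ c f → scale c f ≋ κ c ⊗ f
  scale≋κ⊗ c f .coeffs i = trans (coeff-scale c f i) (sym (coeff-κ⊗ c f i))

  0∷≋X⊗ : ∀ f → 0# ∷ f ≋ X ⊗ f
  0∷≋X⊗ f .coeffs zero    = sym (trans (coeff-∷-⊗-zero 0# (1# ∷ []) f) (𝕂.zeroˡ _))
  0∷≋X⊗ f .coeffs (suc i) = sym (trans (coeff-∷-⊗-suc 0# (1# ∷ []) f i) (trans (cong₂ _+_ (𝕂.zeroˡ _) (coeff-κ⊗ 1# f i))
    (trans (𝕂.+-identityˡ _) (𝕂.*-identityˡ _))))

  ∷≋ : ∀ a f → a ∷ f ≋ κ a ⊕ X ⊗ f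
  ∷≋ a f = ≋-trans split (𝕂[X].+-congˡ (0∷≋X⊗ f))
    where
    split : a ∷ f ≋ κ a ⊕ (0# ∷ f)
    split .coeffs zero    = sym (trans (coeff-⊕ (κ a) (0# ∷ f) 0) (𝕂.+-identityʳ a))
    split .coeffs (suc i) = sym (trans (coeff-⊕ (κ a) (0# ∷ f) (suc i)) (𝕂.+-identityˡ _))

  κ-cong : ∀ {a b} → a ≡ b → κ a ≋ κ b
  κ-cong refl = ≋-refl

  κ-0 : κ 0# ≋ []
  κ-0 .coeffs zero    = refl
  κ-0 .coeffs (suc i) = refl

  κ-+ : ∀ a b → κ (a + b) ≋ κ a ⊕ κ b
  κ-+ a b .coeffs zero    = sym (coeff-⊕ (κ a) (κ b) 0)
  κ-+ a b .coeffs (suc i) = sym (trans (coeff-⊕ (κ a) (κ b) (suc i)) (𝕂.+-identityˡ 0#))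

  κ-* : ∀ a b → κ (a * b) ≋ κ a ⊗ κ b
  κ-* a b .coeffs zero    = sym (coeff-κ⊗ a (κ b) 0)
  κ-* a b .coeffs (suc i) = sym (trans (coeff-κ⊗ a (κ b) (suc i)) (𝕂.zeroʳ a))

  -- The strict bound deg f < n, with the zero polynomial included for every n; it is insensitive to
  -- trailing zeros of the list.
  record Below (f : Poly) (n : ℕ) : Set where
    constructor mkBelow
    field vanish : ∀ i → n ≤ i → coeff f i ≡ 0#
  open Below public

  below-resp : ∀ {f g n} → f ≋ g → Below f n → Below g n
  below-resp e b .vanish i n≤i = trans (sym (coeffs e i)) (vanish b i n≤i)

  below-mono : ∀ {f m n} → m ≤ n → Below f m → Below f n
  below-mono m≤n b .vanish i n≤i = vanish b i (ℕ.≤-trans m≤n n≤i)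

  below-1⇒≋κ : ∀ {f} → Below f 1 → f ≋ κ (coeff f 0)
  below-1⇒≋κ b .coeffs zero    = refl
  below-1⇒≋κ b .coeffs (suc i) = vanish b (suc i) (s≤s z≤n)

  below-κ : ∀ {a n} → Below (κ a) (suc n)
  below-κ .vanish (suc i) _ = refl

  below-⊕ : ∀ {f g n} → Below f n → Below g n → Below (f ⊕ g) n
  below-⊕ {f} {g} b c .vanish i n≤i = trans (coeff-⊕ f g i) (trans (cong₂ _+_ (vanish b i n≤i) (vanish c i n≤i)) (𝕂.+-identityˡ 0#))

  below-⊝ : ∀ {f n} → Below f n → Below (⊝ f) n
  below-⊝ {f} b .vanish i n≤i = trans (coeff-⊝ f i) (trans (cong -_ (vanish b i n≤i)) (solve𝕂 0 (⊟ 𝟘 ⊜ 𝟘) refl))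

  below-tail : ∀ {a f n} → Below (a ∷ f) (suc n) → Below f n
  below-tail b .vanish i n≤i = vanish b (suc i) (s≤s n≤i)

  -- With deg f ≤ m and the strict bound deg g < n the degrees add without a predecessor, and the
  -- case n = 0 of a zero factor is included.
  below-⊗ : ∀ f g m n → Below f (suc m) → Below g n → Below (f ⊗ g) (m ℕ.+ n)
  below-⊗ [] g m n _ _ .vanish i _ = cong (λ z → coeff z i) ([]-⊗ g)
  below-⊗ (a ∷ f) g zero n bf bg .vanish i n≤i = trans (coeffs (⊗-cong (below-1⇒≋κ bf) ≋-refl) i)
    (trans (coeff-κ⊗ a g i) (trans (cong (a *_) (vanish bg i n≤i)) (𝕂.zeroʳ a)))
  below-⊗ (a ∷ f) g (suc m) n bf bg .vanish (suc i) (s≤s m+n≤i) = trans (coeff-∷-⊗-suc a f g i)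
    (trans (cong₂ _+_ (trans (cong (a *_) (vanish bg (suc i) (ℕ.m≤n⇒m≤1+n (ℕ.≤-trans (ℕ.m≤n+m n m) m+n≤i)))) (𝕂.zeroʳ a))
      (vanish (below-⊗ f g m n (below-tail bf) bg) i m+n≤i)) (𝕂.+-identityˡ 0#))

  coeff-⊗-top : ∀ f g m n → Below f (suc m) → Below g (suc n) → coeff (f ⊗ g) (m ℕ.+ n) ≡ coeff f m * coeff g n
  coeff-⊗-top [] g m n _ _ = trans (cong (λ z → coeff z (m ℕ.+ n)) ([]-⊗ g)) (sym (𝕂.zeroˡ _))
  coeff-⊗-top (a ∷ f) g zero n bf bg = trans (coeffs (⊗-cong (below-1⇒≋κ bf) ≋-refl) n) (coeff-κ⊗ a g n)
  coeff-⊗-top (a ∷ f) g (suc m) n bf bg = trans (coeff-∷-⊗-suc a f g (m ℕ.+ n))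
    (trans (cong₂ _+_ (trans (cong (a *_) (vanish bg (suc (m ℕ.+ n)) (s≤s (ℕ.m≤n+m n m)))) (𝕂.zeroʳ a))
      (coeff-⊗-top f g m n (below-tail bf) bg)) (𝕂.+-identityˡ _))

  zero⊎degree : ∀ f → f ≋ [] ⊎ ∃ λ n → coeff f n ≢ 0# × Below f (suc n)
  zero⊎degree [] = inj₁ ≋-refl
  zero⊎degree (a ∷ f) with zero⊎degree f
  ... | inj₂ (n , lead , b) = inj₂ (suc n , lead , mkBelow λ { (suc i) (s≤s n<i) → vanish b i n<i })
  ... | inj₁ f≋[] with a ≟ 0#
  ...   | yes a≡0 = inj₁ (mk≋ λ { zero → a≡0 ; (suc i) → coeffs f≋[] i })
  ...   | no a≢0  = inj₂ (0 , a≢0 , mkBelow λ { (suc i) _ → coeffs f≋[] i })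

  record Monic (n : ℕ) (f : Poly) : Set where
    constructor _,_
    field
      lead  : coeff f n ≡ 1#
      below : Below f (suc n)
  open Monic public

  monic-resp : ∀ {n f g} → f ≋ g → Monic n f → Monic n g
  monic-resp {n} e (l , b) = trans (sym (coeffs e n)) l , below-resp e b

  monic-⊗ : ∀ {m n f g} → Monic m f → Monic n g → Monic (m ℕ.+ n) (f ⊗ g)
  monic-⊗ {m} {n} {f} {g} (lf , bf) (lg , bg) =
    trans (coeff-⊗-top f g m n bf bg) (trans (cong₂ _*_ lf lg) (𝕂.*-identityˡ 1#)) ,
    subst (Below (f ⊗ g)) (ℕ.+-suc m n) (below-⊗ f g m (suc n) bf bg)

  monic≢[] : ∀ {n f} → Monic n f → ¬ f ≋ []
  monic≢[] {n} (l , _) e = 0≢1 (trans (sym (coeffs e n)) l)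

  monic-0 : ∀ {f} → Monic 0 f → f ≋ κ 1#
  monic-0 (l , b) = ≋-trans (below-1⇒≋κ b) (κ-cong l)

  normalise : ∀ {f n} → coeff f n ≢ 0# → Below f (suc n) → Monic n (κ (coeff f n ⁻¹) ⊗ f)
  normalise {f} {n} l b = trans (coeff-κ⊗ _ f n) (*-inverseˡ l) , mkBelow λ i n<i →
    trans (coeff-κ⊗ _ f i) (trans (cong (_ *_) (vanish b i n<i)) (𝕂.zeroʳ _))

  -- If k had degree e, its leading coefficient would reappear in the product at n + e, where the
  -- product has to vanish.
  below-cancel : ∀ {n f k} → Monic n f → Below (f ⊗ k) n → k ≋ []
  below-cancel {n} {f} {k} (l , b) small with zero⊎degree k
  ... | inj₁ k≋[] = k≋[]
  ... | inj₂ (e , lk , bk) = contradiction (begin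
    coeff k e  ≡⟨ 𝕂.*-identityˡ _ ⟨
    1# * coeff k e  ≡⟨ cong (_* coeff k e) l ⟨
    coeff f n * coeff k e  ≡⟨ coeff-⊗-top f k n e b bk ⟨
    coeff (f ⊗ k) (n ℕ.+ e)  ≡⟨ vanish small (n ℕ.+ e) (ℕ.m≤m+n n e) ⟩
    0#  ∎) lk
    where open ≡-Reasoning

  monic-cofactor : ∀ {m n f g k} → Monic m f → Monic n g → g ≋ f ⊗ k → ∃ λ e → n ≡ m ℕ.+ e × Monic e k
  monic-cofactor {m} {n} {f} {g} {k} mf@(lf , bf) mg g≋ with zero⊎degree k
  ... | inj₁ k≋[] = contradiction (≋-trans g≋ (≋-trans (⊗-cong ≋-refl k≋[]) (𝕂[X].zeroʳ f))) (monic≢[] mg)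
  ... | inj₂ (e , lk , bk) = e , n≡ , k-lead , bk
    where
    top : coeff g (m ℕ.+ e) ≡ coeff k e
    top = trans (coeffs g≋ _) (trans (coeff-⊗-top f k m e bf bk) (trans (cong (_* _) lf) (𝕂.*-identityˡ _)))
    above : Below g (suc (m ℕ.+ e))
    above = below-resp (≋-sym g≋) (subst (Below (f ⊗ k)) (ℕ.+-suc m e) (below-⊗ f k m (suc e) bf bk))
    n≡ : n ≡ m ℕ.+ e
    n≡ with ℕ.<-cmp n (m ℕ.+ e)
    ... | tri< n< _ _ = contradiction (trans (sym top) (vanish (below mg) _ n<)) lk
    ... | tri≈ _ e _ = e
    ... | tri> _ _ >n = contradiction (trans (sym (vanish above n >n)) (lead mg)) 0≢1
    k-lead : coeff k e ≡ 1#
    k-lead = trans (sym top) (trans (cong (coeff g) (sym n≡)) (lead mg))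

  -- Division is built from the head of the list: g = f k + r gives a + X g = f (X k + c) + (a + X r
  -- - c f). Here c is the coefficient of degree n of a + X r, which the subtraction removes since f
  -- is monic.
  divide : ∀ {n f} → Monic n f → ∀ g → ∃₂ λ k r → g ≋ f ⊗ k ⊕ r × Below r n
  divide {f = f} m [] = [] , [] , solve 1 (λ f → :0 := f :* :0 :+ :0) ≋-refl f , mkBelow λ _ _ → refl
  divide {n} {f} m@(l , b) (a ∷ g) with divide m g
  ... | k , r , g≋ , br = X ⊗ k ⊕ κ c , (a ∷ r) ⊕ ⊝ (κ c ⊗ f) , eq , small
    where
    c : Carrier
    c = coeff (a ∷ r) n
    eq : a ∷ g ≋ f ⊗ (X ⊗ k ⊕ κ c) ⊕ ((a ∷ r) ⊕ ⊝ (κ c ⊗ f))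
    eq = ≋-trans (∷≋ a g) (≋-trans (𝕂[X].+-congˡ (⊗-cong ≋-refl g≋)) (≋-trans
      (solve 6 (λ a x f k r c → a :+ x :* (f :* k :+ r) := f :* (x :* k :+ c) :+ ((a :+ x :* r) :+ :- (c :* f)))
        ≋-refl (κ a) X f k r (κ c))
      (𝕂[X].+-congˡ (𝕂[X].+-congʳ (≋-sym (∷≋ a r))))))
    coeff-c : ∀ i → coeff ((a ∷ r) ⊕ ⊝ (κ c ⊗ f)) i ≡ coeff (a ∷ r) i + - (c * coeff f i)
    coeff-c i = trans (coeff-⊕ (a ∷ r) _ i) (cong (coeff (a ∷ r) i +_)
      (trans (coeff-⊝ (κ c ⊗ f) i) (cong -_ (coeff-κ⊗ c f i))))
    small : Below ((a ∷ r) ⊕ ⊝ (κ c ⊗ f)) n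
    small .vanish i n≤i with ℕ.m≤n⇒m<n∨m≡n n≤i
    ... | inj₂ refl = trans (coeff-c n) (trans (cong (λ z → c + - (c * z)) l)
            (solve𝕂 1 (λ c → c ⊞ ⊟ (c ⊡ 𝟙) ⊜ 𝟘) refl c))
    ... | inj₁ n<i@(s≤s {n = j} n≤j) = trans (coeff-c i) (trans (cong₂ (λ x y → x + - (c * y)) (vanish br j n≤j) (vanish b i n<i))
            (solve𝕂 1 (λ c → 𝟘 ⊞ ⊟ (c ⊡ 𝟘) ⊜ 𝟘) refl c))

  infix 4 _∣ₚ_
  record _∣ₚ_ (f g : Poly) : Set where
    constructor _,_
    field
      cofactor : Poly
      equation : g ≋ f ⊗ cofactor

  remainder-zero : ∀ {n f g k r} → Monic n f → g ≋ f ⊗ k ⊕ r → Below r n → f ∣ₚ g → r ≋ []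
  remainder-zero {n} {f} {g} {k} {r} m g≋ br (l , g≋fl) = ≋-trans r≋ (≋-trans (⊗-cong ≋-refl l-k≋[]) (𝕂[X].zeroʳ f))
    where
    r≋ : r ≋ f ⊗ (l ⊕ ⊝ k)
    r≋ = ≋-trans (solve 3 (λ f k r → r := (f :* k :+ r) :+ :- (f :* k)) ≋-refl f k r)
      (≋-trans (𝕂[X].+-congʳ (≋-trans (≋-sym g≋) g≋fl))
        (solve 3 (λ f k l → f :* l :+ :- (f :* k) := f :* (l :+ :- k)) ≋-refl f k l))
    l-k≋[] : l ⊕ ⊝ k ≋ []
    l-k≋[] = below-cancel m (below-resp r≋ br)

  ≋[]? : ∀ f → Dec (f ≋ [])
  ≋[]? f with zero⊎degree f
  ... | inj₁ e = yes e
  ... | inj₂ (n , l , _) = no λ e → l (coeffs e n)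

  divides? : ∀ {n f} → Monic n f → ∀ g → Dec (f ∣ₚ g)
  divides? m g with divide m g
  ... | k , r , g≋ , br with ≋[]? r
  ...   | yes r≋[] = yes (k , ≋-trans g≋ (≋-trans (𝕂[X].+-congˡ r≋[]) (𝕂[X].+-identityʳ _)))
  ...   | no  r≢[] = no λ f∣g → r≢[] (remainder-zero m g≋ br f∣g)

  ∣ₚ-trans : ∀ {f g h} → f ∣ₚ g → g ∣ₚ h → f ∣ₚ h
  ∣ₚ-trans {f} (k , e) (l , e′) = k ⊗ l , ≋-trans e′ (≋-trans (⊗-cong e ≋-refl) (⊗-assoc f k l))

  ∣ₚ-refl : ∀ {f} → f ∣ₚ f
  ∣ₚ-refl {f} = κ 1# , ≋-sym (𝕂[X].*-identityʳ f)

  monic-∣-monic : ∀ {n f g} → Monic n f → Monic n g → f ∣ₚ g → f ≋ g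
  monic-∣-monic {n} {f} mf mg (k , g≋) with monic-cofactor mf mg g≋
  ... | e , n≡n+e , mk with ℕ.+-cancelˡ-≡ n e 0 (trans (sym n≡n+e) (sym (ℕ.+-identityʳ n)))
  ...   | refl = ≋-sym (≋-trans g≋ (≋-trans (⊗-cong ≋-refl (monic-0 mk)) (𝕂[X].*-identityʳ f)))

  monic-monic : ∀ {n} (v : Vec Carrier n) → Monic n (monic v)
  monic-monic []      = refl , mkBelow λ { (suc i) _ → refl }
  monic-monic (a ∷ v) with l , b ← monic-monic v = l , mkBelow λ { (suc i) (s≤s n<i) → vanish b i n<i }

  -- Inverse to `monic` on monic polynomials of degree n; for a polynomial of degree below n it is
  -- the full coefficient vector.
  low : ∀ n → Poly → Vec Carrier n
  low n f = tabulate (coeff f ∘ toℕ)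

  low-monic : ∀ {n} (v : Vec Carrier n) → low n (monic v) ≡ v
  low-monic []      = refl
  low-monic (a ∷ v) = cong (a ∷_) (low-monic v)

  low-cong : ∀ n {f g} → f ≋ g → low n f ≡ low n g
  low-cong n e = tabulate-cong (λ i → coeffs e (toℕ i))

  monic-low : ∀ {n f} → Monic n f → monic (low n f) ≋ f
  monic-low m .coeffs = go m
    where
    go : ∀ {n f} → Monic n f → monic (low n f) ≈ₚ f
    go {zero}  m       i       = sym (coeffs (monic-0 m) i)
    go {suc n} {[]} (l , b)    = contradiction l 0≢1
    go {suc n} {a ∷ f} (l , b) zero    = refl
    go {suc n} {a ∷ f} (l , b) (suc i) = go {n} {f} (l , below-tail b) i

  monic-injective : ∀ {n} {v w : Vec Carrier n} → monic v ≋ monic w → v ≡ w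
  monic-injective {n} {v} {w} e = trans (sym (low-monic v)) (trans (low-cong n e) (low-monic w))

-- Algebras over K, homogeneous forms and Frobenius

module Algebras (K : FiniteField) where
  open Ring
  open Lists
  open Polynomial K
  open Degree K
  import Algebra.Properties.CommutativeSemiring.Exp as Exp
  open import Data.List using (filter; foldr)
  open import Data.List.Membership.Propositional.Properties using (∈-map⁻; ∈-map⁺; ∈-filter⁺; ∈-filter⁻)
  open import Data.List.Relation.Binary.Permutation.Propositional as Perm using (_↭_; prep; swap)
  open import Data.List.Relation.Unary.All as All using (All; []; _∷_)
  open import Data.List.Relation.Unary.AllPairs using ([]; _∷_)
  open import Data.List.Relation.Unary.Any using (here; there)
  import Data.List.Relation.Unary.Unique.Propositional.Properties as Unique
  open import Data.Vec using ([]; _∷_; toList)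
  open import Data.Vec.Properties using (length-toList)
  open import Relation.Binary.PropositionalEquality as ≡ using (_≡_; _≢_)
  open import Relation.Nullary.Decidable using (¬?)

  -- One interface for K, K[X] and K[X]/(f), so that evaluation, homogeneous forms and Frobenius are
  -- developed once.
  record KAlgebra : Set₁ where
    field
      R : CommutativeRing 0ℓ 0ℓ
    open CommutativeRing R using (_≈_) renaming (Carrier to A; _+_ to _+′_; _*_ to _*′_; 0# to 0′; 1# to 1′)
    field
      const   : Carrier → A
      const-0 : const 0# ≈ 0′
      const-1 : const 1# ≈ 1′
      const-+ : ∀ a b → const (a + b) ≈ const a +′ const b
      const-* : ∀ a b → const (a * b) ≈ const a *′ const b

  shift : Poly → Poly
  shift []      = []
  shift (a ∷ f) = f

  coeff-shift : ∀ f i → coeff (shift f) i ≡ coeff f (suc i)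
  coeff-shift []      i = ≡.refl
  coeff-shift (a ∷ f) i = ≡.refl

  shift-cong : ∀ {f g} → f ≋ g → shift f ≋ shift g
  shift-cong {f} {g} e .coeffs i = ≡.trans (coeff-shift f i) (≡.trans (coeffs e (suc i)) (≡.sym (coeff-shift g i)))

  shift-⊕ : ∀ f g → shift (f ⊕ g) ≋ shift f ⊕ shift g
  shift-⊕ f g .coeffs i = ≡.trans (coeff-shift (f ⊕ g) i) (≡.trans (coeff-⊕ f g (suc i))
    (≡.sym (≡.trans (coeff-⊕ (shift f) (shift g) i) (≡.cong₂ _+_ (coeff-shift f i) (coeff-shift g i)))))

  shift-κ⊗ : ∀ c f → shift (κ c ⊗ f) ≋ κ c ⊗ shift f
  shift-κ⊗ c f .coeffs i = ≡.trans (coeff-shift (κ c ⊗ f) i) (≡.trans (coeff-κ⊗ c f (suc i))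
    (≡.sym (≡.trans (coeff-κ⊗ c (shift f) i) (≡.cong (c *_) (coeff-shift f i)))))

  shift-X⊗ : ∀ f → shift (X ⊗ f) ≋ f
  shift-X⊗ f = ≋-sym (shift-cong (0∷≋X⊗ f))

  coeff₀∷shift : ∀ f → f ≋ κ (coeff f 0) ⊕ X ⊗ shift f
  coeff₀∷shift f = ≋-trans eq (∷≋ (coeff f 0) (shift f))
    where
    eq : f ≋ coeff f 0 ∷ shift f
    eq .coeffs zero    = ≡.refl
    eq .coeffs (suc i) = ≡.sym (coeff-shift f i)

  below-shift : ∀ {f n} → Below f (suc n) → Below (shift f) n
  below-shift {f} b .vanish i n≤i = ≡.trans (coeff-shift f i) (vanish b (suc i) (s≤s n≤i))

  module 𝕂[X]^ = Exp 𝕂[X].commutativeSemiring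
  open 𝕂[X]^ using () renaming (_^_ to _⊗^_) public

  below-X⊕κ : ∀ c → Below (X ⊕ κ c) 2
  below-X⊕κ c = below-⊕ (mkBelow λ { (suc (suc i)) _ → ≡.refl ; (suc zero) (s≤s ()) }) below-κ

  below-⊗^ : ∀ {f} n → Below f 2 → Below (f ⊗^ n) (suc n)
  below-⊗^ zero b = below-κ
  below-⊗^ {f} (suc n) b = below-⊗ f (f ⊗^ n) 1 (suc n) b (below-⊗^ n b)

  monic-⊗^ : ∀ {f} n → Monic 1 f → Monic n (f ⊗^ n)
  monic-⊗^ zero m = ≡.refl , below-κ
  monic-⊗^ (suc n) m = monic-⊗ m (monic-⊗^ n m)

  monic-X : Monic 1 X
  monic-X = ≡.refl , mkBelow λ { (suc (suc i)) _ → ≡.refl ; (suc zero) (s≤s ()) }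

  monic-⊕ : ∀ {n f g} → Monic n f → Below g n → Monic n (f ⊕ g)
  monic-⊕ {n} {f} {g} (l , b) s = ≡.trans (coeff-⊕ f g n) (≡.trans (≡.cong₂ _+_ l (vanish s n ℕ.≤-refl)) (𝕂.+-identityʳ 1#)) ,
    below-⊕ b (below-mono (ℕ.n≤1+n n) s)

  monic-X⊕κ : ∀ c → Monic 1 (X ⊕ κ c)
  monic-X⊕κ c = monic-⊕ monic-X below-κ

  module Evaluate (𝔸 : KAlgebra) where
    open KAlgebra 𝔸
    open CommutativeRing R renaming (Carrier to A; _+_ to infixl 6 _+′_; _*_ to infixl 7 _*′_; -_ to infix 8 -′_; 0# to 0′; 1# to 1′)
    open Exp commutativeSemiring
    open RingSolver R
    open Evaluation R using (eval; eval-cong)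
    open import Relation.Binary.Reasoning.Setoid setoid

    const-cong : ∀ {a b} → a ≡ b → const a ≈ const b
    const-cong ≡.refl = refl

    ev : Poly → A → A
    ev f = eval (map const f)

    ev-congʳ : ∀ f {x y} → x ≈ y → ev f x ≈ ev f y
    ev-congʳ f = eval-cong (map const f)

    private
      ev-[] : ∀ {f} x → f ≋ [] → ev f x ≈ 0′
      ev-[] {[]} x e = refl
      ev-[] {a ∷ f} x e = begin
        const a +′ x *′ ev f x  ≈⟨ +-cong (trans (const-cong (coeffs e 0)) const-0) (*-congˡ (ev-[] {f} x (mk≋ (λ i → coeffs e (suc i))))) ⟩
        0′ +′ x *′ 0′  ≈⟨ solve 1 (λ x → :0 :+ x :* :0 := :0) refl x ⟩
        0′  ∎

    ev-congˡ : ∀ {f g} x → f ≋ g → ev f x ≈ ev g x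
    ev-congˡ {[]}    {g}     x e = sym (ev-[] x (≋-sym e))
    ev-congˡ {a ∷ f} {[]}    x e = ev-[] x e
    ev-congˡ {a ∷ f} {b ∷ g} x e = +-cong (const-cong (coeffs e 0)) (*-congˡ (ev-congˡ {f} {g} x (mk≋ (λ i → coeffs e (suc i)))))

    ev-κ : ∀ a x → ev (κ a) x ≈ const a
    ev-κ a x = solve 2 (λ a x → a :+ x :* :0 := a) refl (const a) x

    ev-X : ∀ x → ev X x ≈ x
    ev-X x = trans (+-cong const-0 (*-congˡ (trans (ev-κ 1# x) const-1))) (solve 1 (λ x → :0 :+ x :* :1 := x) refl x)

    ev-⊕ : ∀ f g x → ev (f ⊕ g) x ≈ ev f x +′ ev g x
    ev-⊕ [] g x = trans (ev-congˡ x (𝕂[X].+-identityˡ g)) (sym (+-identityˡ _))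
    ev-⊕ (a ∷ f) [] x = trans (ev-congˡ x (𝕂[X].+-identityʳ (a ∷ f))) (sym (+-identityʳ _))
    ev-⊕ (a ∷ f) (b ∷ g) x = begin
      ev ((a ∷ f) ⊕ (b ∷ g)) x  ≈⟨ ev-congˡ x (≋-trans (≋-reflexive (⊕≡+ₚ (a ∷ f) (b ∷ g))) (∷-cong ≡.refl (≋-reflexive (≡.sym (⊕≡+ₚ f g))))) ⟩
      const (a + b) +′ x *′ ev (f ⊕ g) x  ≈⟨ +-cong (const-+ a b) (*-congˡ (ev-⊕ f g x)) ⟩
      const a +′ const b +′ x *′ (ev f x +′ ev g x)  ≈⟨ solve 5 (λ a b x f g → a :+ b :+ x :* (f :+ g) := (a :+ x :* f) :+ (b :+ x :* g)) refl _ _ _ _ _ ⟩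
      (const a +′ x *′ ev f x) +′ (const b +′ x *′ ev g x) ∎

    private
      ev-κ⊗ : ∀ c f x → ev (κ c ⊗ f) x ≈ const c *′ ev f x
      ev-κ⊗ c f x = trans (ev-congˡ x (≋-sym (scale≋κ⊗ c f))) (go f)
        where
        go : ∀ f → ev (scale c f) x ≈ const c *′ ev f x
        go []      = sym (zeroʳ _)
        go (a ∷ f) = trans (+-cong (const-* c a) (*-congˡ (go f)))
          (solve 4 (λ c a x f → c :* a :+ x :* (c :* f) := c :* (a :+ x :* f)) refl _ _ _ _)

      ev-X⊗ : ∀ f x → ev (X ⊗ f) x ≈ x *′ ev f x
      ev-X⊗ f x = trans (ev-congˡ x (≋-sym (0∷≋X⊗ f))) (trans (+-congʳ const-0) (+-identityˡ _))

    ev-⊗ : ∀ f g x → ev (f ⊗ g) x ≈ ev f x *′ ev g x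
    ev-⊗ [] g x = trans (reflexive (≡.cong (λ z → ev z x) ([]-⊗ g))) (sym (zeroˡ _))
    ev-⊗ (a ∷ f) g x = begin
      ev ((a ∷ f) ⊗ g) x  ≈⟨ ev-congˡ x (≋-trans (⊗-cong (∷≋ a f) ≋-refl)
                                                              (RingSolver.solve 𝕂[X] 4 (λ a x f g → (a :+′ x :*′ f) :*′ g :=′ a :*′ g :+′ x :*′ (f :*′ g)) ≋-refl (κ a) X f g)) ⟩
      ev (κ a ⊗ g ⊕ X ⊗ (f ⊗ g)) x  ≈⟨ trans (ev-⊕ (κ a ⊗ g) (X ⊗ (f ⊗ g)) x) (+-cong (ev-κ⊗ a g x) (trans (ev-X⊗ (f ⊗ g) x) (*-congˡ (ev-⊗ f g x)))) ⟩
      const a *′ ev g x +′ x *′ (ev f x *′ ev g x)  ≈⟨ solve 4 (λ a x f g → a :* g :+ x :* (f :* g) := (a :+ x :* f) :* g) refl _ _ _ _ ⟩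
      (const a +′ x *′ ev f x) *′ ev g x  ∎
      where open RingSolver 𝕂[X] using () renaming (_:=_ to _:=′_; _:+_ to _:+′_; _:*_ to _:*′_)

    ev-⊗^ : ∀ f n x → ev (f ⊗^ n) x ≈ ev f x ^ n
    ev-⊗^ f zero    x = trans (ev-κ 1# x) const-1
    ev-⊗^ f (suc n) x = trans (ev-⊗ f (f ⊗^ n) x) (*-congˡ (ev-⊗^ f n x))

    ev-⊝ : ∀ f x → ev (⊝ f) x ≈ -′ ev f x
    ev-⊝ f x = begin
      ev (⊝ f) x  ≈⟨ solve 2 (λ a b → a := :- b :+ (b :+ a)) refl _ (ev f x) ⟩
      -′ ev f x +′ (ev f x +′ ev (⊝ f) x)  ≈⟨ +-congˡ (trans (sym (ev-⊕ f (⊝ f) x)) (ev-congˡ x (𝕂[X].-‿inverseʳ f))) ⟩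
      -′ ev f x +′ 0′  ≈⟨ +-identityʳ _ ⟩
      -′ ev f x  ∎

    -- The homogeneous form of degree n of f at (u , v), that is Σᵢ fᵢ uⁱ vⁿ⁻ⁱ.
    hom : A → A → ℕ → Poly → A
    hom u v zero    f = const (coeff f 0)
    hom u v (suc n) f = const (coeff f 0) *′ v ^ suc n +′ u *′ hom u v n (shift f)

    hom-cong : ∀ {u u′ v v′} n {f g} → u ≈ u′ → v ≈ v′ → f ≋ g → hom u v n f ≈ hom u′ v′ n g
    hom-cong zero e e′ f≋g = const-cong (coeffs f≋g 0)
    hom-cong (suc n) e e′ f≋g = +-cong (*-cong (const-cong (coeffs f≋g 0)) (^-congˡ (suc n) e′))
      (*-cong e (hom-cong n e e′ (shift-cong f≋g)))

    module _ (u v : A) where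
      hom-congʳ : ∀ n {f g} → f ≋ g → hom u v n f ≈ hom u v n g
      hom-congʳ n = hom-cong n refl refl

      hom-⊕ : ∀ n f g → hom u v n (f ⊕ g) ≈ hom u v n f +′ hom u v n g
      hom-⊕ zero f g = trans (const-cong (coeff-⊕ f g 0)) (const-+ _ _)
      hom-⊕ (suc n) f g = begin
        const (coeff (f ⊕ g) 0) *′ v ^ suc n +′ u *′ hom u v n (shift (f ⊕ g))
          ≈⟨ +-cong (*-congʳ (trans (const-cong (coeff-⊕ f g 0)) (const-+ _ _)))
                    (*-congˡ (trans (hom-congʳ n (shift-⊕ f g)) (hom-⊕ n (shift f) (shift g)))) ⟩
        (const (coeff f 0) +′ const (coeff g 0)) *′ v ^ suc n +′ u *′ (hom u v n (shift f) +′ hom u v n (shift g))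
          ≈⟨ solve 6 (λ a b w u x y → (a :+ b) :* w :+ u :* (x :+ y) := (a :* w :+ u :* x) :+ (b :* w :+ u :* y)) refl _ _ (v ^ suc n) _ _ _ ⟩
        hom u v (suc n) f +′ hom u v (suc n) g ∎

      hom-κ⊗ : ∀ n c f → hom u v n (κ c ⊗ f) ≈ const c *′ hom u v n f
      hom-κ⊗ zero c f = trans (const-cong (coeff-κ⊗ c f 0)) (const-* _ _)
      hom-κ⊗ (suc n) c f = trans
        (+-cong (*-congʳ (trans (const-cong (coeff-κ⊗ c f 0)) (const-* _ _)))
                (*-congˡ (trans (hom-congʳ n (shift-κ⊗ c f)) (hom-κ⊗ n c (shift f)))))
        (solve 5 (λ c a w u x → (c :* a) :* w :+ u :* (c :* x) := c :* (a :* w :+ u :* x)) refl _ _ (v ^ suc n) _ _)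

      hom-X⊗ : ∀ n f → hom u v (suc n) (X ⊗ f) ≈ u *′ hom u v n f
      hom-X⊗ n f = trans
        (+-cong (trans (*-congʳ (trans (const-cong (≡.sym (coeffs (0∷≋X⊗ f) 0))) const-0)) (zeroˡ _))
                (*-congˡ (hom-congʳ n (shift-X⊗ f))))
        (+-identityˡ _)

      -- A polynomial of degree at most n has no term in u^(n + 1), so each term of its form of
      -- degree n + 1 retains a factor v.
      hom-pad : ∀ n f → Below f (suc n) → hom u v (suc n) f ≈ v *′ hom u v n f
      hom-pad zero f b = begin
        const (coeff f 0) *′ (v *′ 1′) +′ u *′ const (coeff (shift f) 0)
          ≈⟨ +-congˡ (*-congˡ (trans (const-cong (≡.trans (coeff-shift f 0) (vanish b 1 (s≤s z≤n)))) const-0)) ⟩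
        const (coeff f 0) *′ (v *′ 1′) +′ u *′ 0′
          ≈⟨ solve 3 (λ a v u → a :* (v :* :1) :+ u :* :0 := v :* a) refl _ v u ⟩
        v *′ const (coeff f 0) ∎
      hom-pad (suc n) f b = trans (+-congˡ (*-congˡ (hom-pad n (shift f) (below-shift b))))
        (solve 5 (λ a v w u x → a :* (v :* w) :+ u :* (v :* x) := v :* (a :* w :+ u :* x)) refl _ v (v ^ suc n) u _)

      hom-pads : ∀ k n f → Below f (suc n) → hom u v (k ℕ.+ n) f ≈ v ^ k *′ hom u v n f
      hom-pads zero    n f b = sym (*-identityˡ _)
      hom-pads (suc k) n f b = trans (hom-pad (k ℕ.+ n) f (below-mono (s≤s (ℕ.m≤n+m n k)) b))
        (trans (*-congˡ (hom-pads k n f b)) (sym (*-assoc _ _ _)))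

      -- `hom` reads only the coefficients up to its degree; the bounds ensure that nothing is cut
      -- off, so homogenisation is multiplicative. The induction splits the constant term off f and
      -- pads g to the larger degree.
      hom-⊗ : ∀ m n f g → Below f (suc m) → Below g (suc n) → hom u v (m ℕ.+ n) (f ⊗ g) ≈ hom u v m f *′ hom u v n g
      hom-⊗ zero n f g bf bg = trans (hom-congʳ n (⊗-cong (below-1⇒≋κ bf) ≋-refl)) (hom-κ⊗ n (coeff f 0) g)
      hom-⊗ (suc m) n f g bf bg = begin
        hom u v (suc m ℕ.+ n) (f ⊗ g)
          ≈⟨ hom-congʳ (suc m ℕ.+ n) (≋-trans (⊗-cong (coeff₀∷shift f) ≋-refl)
               (RingSolver.solve 𝕂[X] 4 (λ a x f g → (a :+′ x :*′ f) :*′ g :=′ a :*′ g :+′ x :*′ (f :*′ g)) ≋-refl (κ (coeff f 0)) X (shift f) g)) ⟩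
        hom u v (suc m ℕ.+ n) (κ (coeff f 0) ⊗ g ⊕ X ⊗ (shift f ⊗ g))
          ≈⟨ hom-⊕ (suc m ℕ.+ n) _ _ ⟩
        hom u v (suc m ℕ.+ n) (κ (coeff f 0) ⊗ g) +′ hom u v (suc m ℕ.+ n) (X ⊗ (shift f ⊗ g))
          ≈⟨ +-cong (trans (hom-κ⊗ (suc m ℕ.+ n) (coeff f 0) g) (*-congˡ (hom-pads (suc m) n g bg)))
                    (trans (hom-X⊗ (m ℕ.+ n) (shift f ⊗ g)) (*-congˡ (hom-⊗ m n (shift f) g (below-shift bf) bg))) ⟩
        const (coeff f 0) *′ (v ^ suc m *′ hom u v n g) +′ u *′ (hom u v m (shift f) *′ hom u v n g)
          ≈⟨ solve 5 (λ a w g u h → a :* (w :* g) :+ u :* (h :* g) := (a :* w :+ u :* h) :* g) refl _ (v ^ suc m) _ _ _ ⟩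
        hom u v (suc m) f *′ hom u v n g ∎
        where open RingSolver 𝕂[X] using () renaming (_:=_ to _:=′_; _:+_ to _:+′_; _:*_ to _:*′_)

      hom-⊗^ : ∀ n f → Below f 2 → hom u v n (f ⊗^ n) ≈ hom u v 1 f ^ n
      hom-⊗^ zero    f b = const-1
      hom-⊗^ (suc n) f b = trans (hom-⊗ 1 n f (f ⊗^ n) b (below-⊗^ n b)) (*-congˡ (hom-⊗^ n f b))

      hom-linear : ∀ a b → hom u v 1 (b ∷ a ∷ []) ≈ const a *′ u +′ const b *′ v
      hom-linear a b = solve 4 (λ a b u v → b :* (v :* :1) :+ u :* a := a :* u :+ b :* v) refl _ _ _ _

    hom-1 : ∀ u n f → Below f (suc n) → hom u 1′ n f ≈ ev f u
    hom-1 u zero f b = trans (sym (ev-κ (coeff f 0) u)) (ev-congˡ u (≋-sym (below-1⇒≋κ b)))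
    hom-1 u (suc n) f b = begin
      const (coeff f 0) *′ 1′ ^ suc n +′ u *′ hom u 1′ n (shift f)
        ≈⟨ +-cong (trans (*-congˡ (1^ (suc n))) (*-identityʳ _)) (*-congˡ (hom-1 u n (shift f) (below-shift b))) ⟩
      const (coeff f 0) +′ u *′ ev (shift f) u
        ≈⟨ +-cong (ev-κ _ u) (ev-X⊗ (shift f) u) ⟨
      ev (κ (coeff f 0)) u +′ ev (X ⊗ shift f) u
        ≈⟨ ev-⊕ _ _ u ⟨
      ev (κ (coeff f 0) ⊕ X ⊗ shift f) u
        ≈⟨ ev-congˡ u (coeff₀∷shift f) ⟨
      ev f u ∎
      where
      1^ : ∀ n → 1′ ^ n ≈ 1′
      1^ zero    = refl
      1^ (suc n) = trans (*-identityˡ _) (1^ n)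

  𝕂-algebra : KAlgebra
  𝕂-algebra = record { R = 𝕂 ; const = λ a → a ; const-0 = ≡.refl ; const-1 = ≡.refl
    ; const-+ = λ _ _ → ≡.refl ; const-* = λ _ _ → ≡.refl }

  𝕂[X]-algebra : KAlgebra
  𝕂[X]-algebra = record { R = 𝕂[X] ; const = κ ; const-0 = κ-0 ; const-1 = ≋-refl
    ; const-+ = κ-+ ; const-* = κ-* }

  module 𝕂[X]-ev = Evaluate 𝕂[X]-algebra

  ev-X≋ : ∀ f → 𝕂[X]-ev.ev f X ≋ f
  ev-X≋ []      = ≋-refl
  ev-X≋ (a ∷ f) = ≋-trans (𝕂[X].+-congˡ (𝕂[X].*-congˡ (ev-X≋ f))) (≋-sym (∷≋ a f))

  module 𝕂^ = Exp 𝕂.commutativeSemiring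
  open 𝕂^ using () renaming (_^_ to _^ᴷ_) public

  private
    prod : List Carrier → Carrier
    prod = foldr _*_ 1#

    prod-↭ : ∀ {xs ys} → xs ↭ ys → prod xs ≡ prod ys
    prod-↭ Perm.refl         = ≡.refl
    prod-↭ (prep x p)   = ≡.cong (x *_) (prod-↭ p)
    prod-↭ (swap x y p) = ≡.trans (≡.cong (λ z → x * (y * z)) (prod-↭ p))
      (solve𝕂 3 (λ x y z → x ⊡ (y ⊡ z) ⊜ y ⊡ (x ⊡ z)) ≡.refl x y _)
    prod-↭ (Perm.trans p p′) = ≡.trans (prod-↭ p) (prod-↭ p′)

    prod-map-* : ∀ x ys → prod (map (x *_) ys) ≡ (x ^ᴷ length ys) * prod ys
    prod-map-* x []       = ≡.sym (𝕂.*-identityˡ 1#)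
    prod-map-* x (y ∷ ys) = ≡.trans (≡.cong (x * y *_) (prod-map-* x ys))
      (solve𝕂 4 (λ x y w z → (x ⊡ y) ⊡ (w ⊡ z) ⊜ (x ⊡ w) ⊡ (y ⊡ z)) ≡.refl x y (x ^ᴷ length ys) _)

    prod≢0 : ∀ xs → All (_≢ 0#) xs → prod xs ≢ 0#
    prod≢0 []       []         e = 0≢1 (≡.sym e)
    prod≢0 (x ∷ xs) (x≢0 ∷ ne) e = *-≢0 x≢0 (prod≢0 xs ne) e

    nonzero : List Carrier
    nonzero = filter (λ x → ¬? (x ≟ 0#)) elements

    length-nonzero : q ≡ suc (length nonzero)
    length-nonzero = ≡.trans (≡.sym length-elements) (unique-⊆⊇⇒length≡ {xs = elements} {ys = 0# ∷ nonzero}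
      elements-unique
      (All.tabulate (λ x∈ 0≡x → proj₂ (∈-filter⁻ (λ x → ¬? (x ≟ 0#)) {xs = elements} x∈) (≡.sym 0≡x)) ∷ Unique.filter⁺ (λ x → ¬? (x ≟ 0#)) elements-unique)
      split (λ {x} _ → ∈-elements x))
      where
      split : ∀ {x} → x ∈ elements → x ∈ 0# ∷ nonzero
      split {x} x∈ with x ≟ 0#
      ... | yes e = here e
      ... | no ne = there (∈-filter⁺ (λ x → ¬? (x ≟ 0#)) x∈ ne)

    *-cancelˡ : ∀ {x y z} → x ≢ 0# → x * y ≡ x * z → y ≡ z
    *-cancelˡ {x} {y} {z} x≢0 e with 𝕂-noZeroDivisors x (y + - z)
      (≡.trans (solve𝕂 3 (λ x y z → x ⊡ (y ⊞ ⊟ z) ⊜ x ⊡ y ⊞ ⊟ (x ⊡ z)) ≡.refl x y z) (Evaluation.x≈y⇒x-y≈0 𝕂 e))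
    ... | inj₁ x≡0 = contradiction x≡0 x≢0
    ... | inj₂ y-z = Evaluation.x-y≈0⇒x≈y 𝕂 y-z

  -- Multiplication by x ≠ 0 permutes the nonzero elements; comparing their products gives x^(q - 1)
  -- = 1.
  fermat : ∀ x → x ^ᴷ q ≡ x
  fermat x with x ≟ 0#
  ... | yes ≡.refl = ≡.trans (≡.cong (0# ^ᴷ_) length-nonzero) (𝕂.zeroˡ _)
  ... | no x≢0 = ≡.trans (≡.cong (x ^ᴷ_) length-nonzero) (≡.trans (≡.cong (x *_) order) (𝕂.*-identityʳ x))
    where
    ≢0 : ∀ {y} → y ∈ nonzero → y ≢ 0#
    ≢0 y∈ = proj₂ (∈-filter⁻ (λ x → ¬? (x ≟ 0#)) {xs = elements} y∈)
    x*nonzero↭ : map (x *_) nonzero ↭ nonzero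
    x*nonzero↭ = unique-⊆⊇⇒↭ (Unique.filter⁺ (λ x → ¬? (x ≟ 0#)) elements-unique)
      (Unique.map⁺ (*-cancelˡ x≢0) (Unique.filter⁺ (λ x → ¬? (x ≟ 0#)) elements-unique))
      (λ {y} y∈ → ≡.subst (_∈ map (x *_) nonzero)
        (≡.trans (≡.sym (𝕂.*-assoc x (x ⁻¹) y)) (≡.trans (≡.cong (_* y) (*-inverseʳ x≢0)) (𝕂.*-identityˡ y)))
        (∈-map⁺ (x *_) (∈-filter⁺ (λ x → ¬? (x ≟ 0#)) (∈-elements (x ⁻¹ * y)) (*-≢0 (⁻¹-≢0 x≢0) (≢0 y∈)))))
      (λ xy∈ → let y , y∈ , e = ∈-map⁻ (x *_) xy∈
               in ∈-filter⁺ (λ x → ¬? (x ≟ 0#)) (∈-elements _) (≡.subst (_≢ 0#) (≡.sym e) (*-≢0 x≢0 (≢0 y∈))))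
    order : x ^ᴷ length nonzero ≡ 1#
    order = *-cancelˡ (prod≢0 nonzero (All.tabulate ≢0))
      (≡.trans (𝕂.*-comm _ _) (≡.trans (≡.sym (prod-map-* x nonzero)) (≡.trans (prod-↭ x*nonzero↭) (≡.sym (𝕂.*-identityʳ _)))))

  2≤q : 2 ≤ q
  2≤q = ≡.subst (2 ≤_) length-elements
    (unique-⊆⇒length≤ {xs = 0# ∷ 1# ∷ []} ((0≢1 ∷ []) ∷ [] ∷ []) (λ {x} _ → ∈-elements x))

  toList-low : ∀ {n f} → Below f n → toList (low n f) ≋ f
  toList-low b .coeffs = go _ _ b
    where
    go : ∀ n f → Below f n → toList (low n f) ≈ₚ f
    go zero    f       b i       = ≡.sym (vanish b i z≤n)
    go (suc n) []      b zero    = ≡.refl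
    go (suc n) []      b (suc i) = go n [] (mkBelow λ _ _ → ≡.refl) i
    go (suc n) (a ∷ f) b zero    = ≡.refl
    go (suc n) (a ∷ f) b (suc i) = go n f (below-tail b) i

  -- Both sides are monic of degree q and agree on the q elements of the field.
  [X+1]^q : (X ⊕ κ 1#) ⊗^ q ≋ X ⊗^ q ⊕ κ 1#
  [X+1]^q = 𝕂[X]-x-y≈0⇒x≈y (≋-trans (≋-sym (toList-low small)) all-zero)
    where
    open Evaluate 𝕂-algebra
    𝕂[X]-x-y≈0⇒x≈y : ∀ {f g} → f ⊕ ⊝ g ≋ [] → f ≋ g
    𝕂[X]-x-y≈0⇒x≈y = Evaluation.x-y≈0⇒x≈y 𝕂[X]
    D : Poly
    D = (X ⊕ κ 1#) ⊗^ q ⊕ ⊝ (X ⊗^ q ⊕ κ 1#)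
    m₁ : Monic q ((X ⊕ κ 1#) ⊗^ q)
    m₁ = monic-⊗^ q (monic-X⊕κ 1#)
    m₂ : Monic q (X ⊗^ q ⊕ κ 1#)
    m₂ = monic-⊕ (monic-⊗^ q monic-X) (below-mono (ℕ.≤-trans (s≤s z≤n) 2≤q) (below-κ {n = 0}))
    small : Below D q
    small .vanish i q≤i with ℕ.m≤n⇒m<n∨m≡n q≤i
    ... | inj₁ q<i = vanish (below-⊕ (below m₁) (below-⊝ (below m₂))) i q<i
    ... | inj₂ ≡.refl = ≡.trans (coeff-⊕ _ _ q) (≡.trans (≡.cong₂ _+_ (lead m₁) (≡.trans (coeff-⊝ _ q) (≡.cong -_ (lead m₂)))) (𝕂.-‿inverseʳ 1#))
    root : ∀ a → ev D a ≡ 0#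
    root a = ≡.trans (ev-⊕ _ _ a) (≡.trans (≡.cong (ev ((X ⊕ κ 1#) ⊗^ q) a +_) (ev-⊝ _ a)) (Evaluation.x≈y⇒x-y≈0 𝕂 (begin
      ev ((X ⊕ κ 1#) ⊗^ q) a  ≡⟨ ev-⊗^ (X ⊕ κ 1#) q a ⟩
      ev (X ⊕ κ 1#) a ^ᴷ q  ≡⟨ fermat _ ⟩
      ev (X ⊕ κ 1#) a  ≡⟨ ev-⊕ X (κ 1#) a ⟩
      ev X a + ev (κ 1#) a  ≡⟨ ≡.cong (_+ ev (κ 1#) a) (≡.trans (≡.sym (fermat _)) (≡.sym (ev-⊗^ X q a))) ⟩
      ev (X ⊗^ q) a + ev (κ 1#) a  ≡⟨ ev-⊕ (X ⊗^ q) (κ 1#) a ⟨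
      ev (X ⊗^ q ⊕ κ 1#) a  ∎)))
      where open ≡.≡-Reasoning
    all-zero : toList (low q D) ≋ []
    all-zero .coeffs i = go (toList (low q D)) (Evaluation.tooManyRoots⇒zero 𝕂 𝕂-noZeroDivisors _ elements elements-unique
        (All.tabulate (λ {a} _ → ≡.trans (≡.trans (≡.cong (λ z → Evaluation.eval 𝕂 z a) (≡.sym (map-id (toList (low q D))))) (ev-congˡ a (toList-low small))) (root a)))
        (ℕ.≤-reflexive (≡.trans (length-toList (low q D)) (≡.sym length-elements)))) i
      where
      open import Data.List.Properties using (map-id)
      go : ∀ f → All (_≡ 0#) f → f ≈ₚ []
      go []      _        i       = ≡.refl
      go (a ∷ f) (e ∷ es) zero    = e
      go (a ∷ f) (e ∷ es) (suc i) = go f es i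

  module Frobenius (𝔸 : KAlgebra) where
    open KAlgebra 𝔸
    open Evaluate 𝔸
    open CommutativeRing R renaming (Carrier to A; _+_ to infixl 6 _+′_; _*_ to infixl 7 _*′_; -_ to infix 8 -′_; 0# to 0′; 1# to 1′)
    open Exp commutativeSemiring
    open RingSolver R
    open import Relation.Binary.Reasoning.Setoid setoid

    const-^ : ∀ a n → const (a ^ᴷ n) ≈ const a ^ n
    const-^ a zero    = const-1
    const-^ a (suc n) = trans (const-* a (a ^ᴷ n)) (*-congˡ (const-^ a n))

    -- The identity (X + 1)^q = X^q + 1 in K[X], read as an identity of forms of degree q at (u ,
    -- v), carries additivity to algebras that are larger than K and may have zero divisors.
    frobenius-+ : ∀ u v → (u +′ v) ^ q ≈ u ^ q +′ v ^ q
    frobenius-+ u v = begin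
      (u +′ v) ^ q  ≈⟨ ^-congˡ q X+1 ⟨
      hom u v 1 (X ⊕ κ 1#) ^ q  ≈⟨ hom-⊗^ u v q (X ⊕ κ 1#) (below-X⊕κ 1#) ⟨
      hom u v q ((X ⊕ κ 1#) ⊗^ q)  ≈⟨ hom-congʳ u v q [X+1]^q ⟩
      hom u v q (X ⊗^ q ⊕ κ 1#)  ≈⟨ hom-⊕ u v q (X ⊗^ q) (κ 1#) ⟩
      hom u v q (X ⊗^ q) +′ hom u v q (κ 1#)  ≈⟨ +-cong (trans (hom-⊗^ u v q X (below monic-X)) (^-congˡ q homX)) homκ ⟩
      u ^ q +′ v ^ q  ∎
      where
      homX : hom u v 1 X ≈ u
      homX = trans (hom-linear u v 1# 0#) (trans (+-cong (*-congʳ const-1) (*-congʳ const-0))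
        (solve 2 (λ u v → :1 :* u :+ :0 :* v := u) refl u v))
      X+1 : hom u v 1 (X ⊕ κ 1#) ≈ u +′ v
      X+1 = trans (hom-⊕ u v 1 X (κ 1#)) (+-cong homX (trans (hom-pad u v 0 (κ 1#) below-κ) (trans (*-congˡ const-1) (*-identityʳ v))))
      homκ : hom u v q (κ 1#) ≈ v ^ q
      homκ = trans (reflexive (≡.cong (λ z → hom u v z (κ 1#)) (≡.sym (ℕ.+-identityʳ q))))
        (trans (hom-pads u v q 0 (κ 1#) below-κ) (trans (*-congˡ const-1) (*-identityʳ _)))

    -- The i-th iterate of x ↦ x^q, written as a single power so that composition is addition of
    -- indices.
    φ : ℕ → A → A
    φ i x = x ^ (q ℕ.^ i)

    φ-cong : ∀ i {x y} → x ≈ y → φ i x ≈ φ i y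
    φ-cong i = ^-congˡ (q ℕ.^ i)

    φ-suc : ∀ i x → φ (suc i) x ≈ φ i (x ^ q)
    φ-suc i x = sym (^-assocʳ x q (q ℕ.^ i))

    φ-zero : ∀ x → φ 0 x ≈ x
    φ-zero x = *-identityʳ x

    φ-φ : ∀ i j x → φ i (φ j x) ≈ φ (i ℕ.+ j) x
    φ-φ i j x = trans (^-assocʳ x (q ℕ.^ j) (q ℕ.^ i))
      (reflexive (≡.cong (x ^_) (≡.trans (ℕ.*-comm (q ℕ.^ j) (q ℕ.^ i)) (≡.sym (ℕ.^-distribˡ-+-* q i j)))))

    φ-+ : ∀ i x y → φ i (x +′ y) ≈ φ i x +′ φ i y
    φ-+ zero x y = trans (φ-zero _) (sym (+-cong (φ-zero x) (φ-zero y)))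
    φ-+ (suc i) x y = trans (φ-suc i _) (trans (φ-cong i (frobenius-+ x y)) (trans (φ-+ i _ _) (sym (+-cong (φ-suc i x) (φ-suc i y)))))

    φ-* : ∀ i x y → φ i (x *′ y) ≈ φ i x *′ φ i y
    φ-* i x y = ^-distrib-* x y (q ℕ.^ i)

    φ-const : ∀ i a → φ i (const a) ≈ const a
    φ-const zero a = φ-zero _
    φ-const (suc i) a = trans (φ-suc i _) (trans (φ-cong i (trans (sym (const-^ a q)) (const-cong (fermat a)))) (φ-const i a))

    φ-0 : ∀ i → φ i 0′ ≈ 0′
    φ-0 i = trans (φ-cong i (sym const-0)) (trans (φ-const i 0#) const-0)

    -- Frobenius respects sums and products and fixes the constants, so it commutes with polynomials
    -- over K; in particular it carries roots to roots.
    ev-φ : ∀ i f x → ev f (φ i x) ≈ φ i (ev f x)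
    ev-φ i []      x = sym (φ-0 i)
    ev-φ i (a ∷ f) x = trans (+-cong (sym (φ-const i a)) (*-congˡ (ev-φ i f x)))
      (trans (+-congˡ (sym (φ-* i x (ev f x)))) (sym (φ-+ i _ _)))

-- Irreducible polynomials and their residue fields

module Irreducibility (K : FiniteField) where
  open Ring
  open Polynomial K
  open Degree K
  open Algebras K
  open import Data.Nat.Induction using (<-rec)
  open import Data.List using (cartesianProductWith; upTo)
  open import Data.List.Properties using (length-map; length-++)
  open import Data.List.Membership.Propositional using (find; lose)
  open import Data.List.Membership.Propositional.Properties using (∈-cartesianProductWith⁺; ∈-upTo⁺)
  open import Data.List.Relation.Unary.All using ([])
  open import Data.List.Relation.Unary.AllPairs using ([]; _∷_)
  open import Data.List.Relation.Unary.Any using (Any; here; any?)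
  import Data.List.Relation.Unary.Unique.Propositional.Properties as Unique
  open import Data.Vec using (Vec; []; _∷_)
  open import Data.Vec.Properties using (∷-injective)
  import Data.Sum as Sum
  open import Relation.Binary.PropositionalEquality
  open import Relation.Nullary.Decidable using (map′; _×-dec_)
  open RingSolver 𝕂[X]

  irreducible-split : ∀ {f g h} → Irreducible f → f ≋ g ⊗ h → Below g 1 ⊎ Below h 1
  irreducible-split {f} {g} {h} (_ , split) e =
    Sum.map mkBelow mkBelow (split g h (coeffs (≋-trans e (≋-reflexive (⊗≡*ₚ g h)))))

  mkIrreducible : ∀ {f} → ¬ Below f 1 → (∀ g h → f ≋ g ⊗ h → Below g 1 ⊎ Below h 1) → Irreducible f
  mkIrreducible nc split = (λ c → nc (mkBelow c)) , λ g h e →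
    Sum.map vanish vanish (split g h (≋-trans (mk≋ e) (≋-reflexive (sym (⊗≡*ₚ g h)))))

  irreducible-resp : ∀ {f g} → f ≋ g → Irreducible f → Irreducible g
  irreducible-resp e irr = mkIrreducible
    (λ b → proj₁ irr (vanish (below-resp (≋-sym e) b)))
    (λ g h e′ → irreducible-split irr (≋-trans e e′))

  monic-nonconstant : ∀ {n f} → Monic n f → 1 ≤ n → ¬ Below f 1
  monic-nonconstant {n} (l , _) 1≤n b = 0≢1 (trans (sym (vanish b n 1≤n)) l)

  irreducible-degree : ∀ {n f} → Monic n f → Irreducible f → 1 ≤ n
  irreducible-degree {zero}  m irr = contradiction (vanish (below m)) (proj₁ irr)
  irreducible-degree {suc n} m irr = s≤s z≤n

  module Modulo (f : Poly) where
    open Quotient 𝕂[X] f public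
    module R/f = CommutativeRing R/f

    algebra : KAlgebra
    algebra = record { R = R/f ; const = κ ; const-0 = ≈⇒≈/ κ-0 ; const-1 = R/f.refl
      ; const-+ = λ a b → ≈⇒≈/ (κ-+ a b) ; const-* = λ a b → ≈⇒≈/ (κ-* a b) }

    ≈/[]⇒∣ₚ : ∀ {g} → g ≈/ [] → f ∣ₚ g
    ≈/[]⇒∣ₚ (k , e) = k , ≋-trans e (𝕂[X].+-identityˡ _)

    ∣ₚ⇒≈/[] : ∀ {g} → f ∣ₚ g → g ≈/ []
    ∣ₚ⇒≈/[] (k , e) = k , ≋-trans e (≋-sym (𝕂[X].+-identityˡ _))

  module Field {n : ℕ} {f : Poly} (f-monic : Monic n f) (f-irr : Irreducible f) where
    open Modulo f public

    -- Euclidean descent on deg g: dividing f by the normalised g leaves a remainder r of smaller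
    -- degree, nonzero because f is irreducible. As r is a multiple of g modulo f, an inverse of r
    -- yields one of g.
    invertible : ∀ e g → coeff g e ≢ 0# → Below g (suc e) → e < n → ∃ λ h → g ⊗ h ≈/ κ 1#
    invertible = <-rec _ go
      where
      go : ∀ e → (∀ {e′} → e′ < e → ∀ g → coeff g e′ ≢ 0# → Below g (suc e′) → e′ < n → ∃ λ h → g ⊗ h ≈/ κ 1#) →
        ∀ g → coeff g e ≢ 0# → Below g (suc e) → e < n → ∃ λ h → g ⊗ h ≈/ κ 1#
      go zero rec g l b _ = κ (coeff g 0 ⁻¹) , ≈⇒≈/ (≋-trans (⊗-cong (below-1⇒≋κ b) ≋-refl)
        (≋-trans (≋-sym (κ-* _ _)) (κ-cong (*-inverseʳ l))))
      go e@(suc _) rec g l b e<n with divide (normalise l b) f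
      ... | k , r , f≋ , br with zero⊎degree r
      ...   | inj₁ r≋[] with irreducible-split f-irr (≋-trans f≋ (≋-trans (𝕂[X].+-congˡ r≋[]) (𝕂[X].+-identityʳ _)))
      ...     | inj₁ bg = contradiction bg (monic-nonconstant (normalise l b) (s≤s z≤n))
      ...     | inj₂ bk = contradiction (trans (sym (vanish small n (subst (_≤ n) (ℕ.+-comm 1 e) e<n))) (lead f-monic)) 0≢1
        where
        small : Below f (e ℕ.+ 1)
        small = below-resp (≋-sym (≋-trans f≋ (≋-trans (𝕂[X].+-congˡ r≋[]) (𝕂[X].+-identityʳ _))))
          (below-⊗ _ k e 1 (below (normalise l b)) bk)
      go e@(suc _) rec g l b e<n | k , r , f≋ , br | inj₂ (e′ , lr , br′)
        with rec e′<e r lr br′ (ℕ.<-trans e′<e e<n)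
        where
        e′<e : e′ < e
        e′<e = ℕ.≰⇒> (λ e≤e′ → lr (vanish br e′ e≤e′))
      -- From r = f - c g k and r h ≡ 1 the inverse of g is -c k h.
      ... | h , (k′ , rh≋) = c ⊗ ⊝ (k ⊗ h) , (k′ ⊕ ⊝ h , (begin
        g ⊗ (c ⊗ ⊝ (k ⊗ h))  ≈⟨ solve 5 (λ g c k h f → g :* (c :* :- (k :* h)) := (:- (c :* g :* k)) :* h) ≋-refl g c k h f ⟩
        (⊝ (c ⊗ g ⊗ k)) ⊗ h  ≈⟨ ⊗-cong -gk≋ ≋-refl ⟩
        (r ⊕ ⊝ f) ⊗ h  ≈⟨ solve 3 (λ r f h → (r :+ :- f) :* h := r :* h :+ :- (f :* h)) ≋-refl r f h ⟩
        r ⊗ h ⊕ ⊝ (f ⊗ h)  ≈⟨ 𝕂[X].+-congʳ rh≋ ⟩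
        (κ 1# ⊕ f ⊗ k′) ⊕ ⊝ (f ⊗ h)  ≈⟨ solve 4 (λ u f k h → (u :+ f :* k) :+ :- (f :* h) := u :+ f :* (k :+ :- h)) ≋-refl (κ 1#) f k′ h ⟩
        κ 1# ⊕ f ⊗ (k′ ⊕ ⊝ h)  ∎))
        where
        open import Relation.Binary.Reasoning.Setoid 𝕂[X].setoid
        c : Poly
        c = κ (coeff g e ⁻¹)
        -gk≋ : ⊝ (c ⊗ g ⊗ k) ≋ r ⊕ ⊝ f
        -gk≋ = ≋-trans (solve 4 (λ c g k r → :- (c :* g :* k) := r :+ :- (c :* g :* k :+ r)) ≋-refl c g k r)
          (𝕂[X].+-congˡ (𝕂[X].-‿cong (≋-sym f≋)))

    ≈/[]? : ∀ g → Dec (g ≈/ [])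
    ≈/[]? g = map′ ∣ₚ⇒≈/[] ≈/[]⇒∣ₚ (divides? f-monic g)

    _≈/?_ : ∀ g h → Dec (g ≈/ h)
    g ≈/? h = map′ (Evaluation.x-y≈0⇒x≈y R/f) (Evaluation.x≈y⇒x-y≈0 R/f) (≈/[]? (g ⊕ ⊝ h))

    inverse/ : ∀ g → ¬ g ≈/ [] → ∃ λ h → g ⊗ h ≈/ κ 1#
    inverse/ g g≉0 with divide f-monic g
    ... | k , r , g≋ , br with zero⊎degree r
    ...   | inj₁ r≋[] = contradiction (k , ≋-trans g≋ (≋-trans (𝕂[X].+-comm _ _) (𝕂[X].+-congʳ r≋[]))) g≉0
    ...   | inj₂ (e , l , b) with invertible e r l b (ℕ.≰⇒> (λ n≤e → l (vanish br e n≤e)))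
    ...     | h , rh = h , R/f.trans (R/f.*-congʳ (k , ≋-trans g≋ (𝕂[X].+-comm _ _))) rh

    noZeroDivisors/ : NoZeroDivisors R/f
    noZeroDivisors/ g h gh≈0 with ≈/[]? g
    ... | yes g≈0 = inj₁ g≈0
    ... | no  g≉0 with inverse/ g g≉0
    ...   | g⁻¹ , gg⁻¹ = inj₂ (begin
      h  ≈⟨ R/f.*-identityˡ h ⟨
      κ 1# ⊗ h  ≈⟨ R/f.*-congʳ gg⁻¹ ⟨
      g ⊗ g⁻¹ ⊗ h  ≈⟨ ≈⇒≈/ (solve 3 (λ g i h → g :* i :* h := i :* (g :* h)) ≋-refl g g⁻¹ h) ⟩
      g⁻¹ ⊗ (g ⊗ h)  ≈⟨ R/f.*-congˡ gh≈0 ⟩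
      g⁻¹ ⊗ []  ≈⟨ R/f.zeroʳ g⁻¹ ⟩
      []  ∎)
      where open import Relation.Binary.Reasoning.Setoid R/f.setoid

    euclid : ∀ {g h} → f ∣ₚ g ⊗ h → f ∣ₚ g ⊎ f ∣ₚ h
    euclid f∣gh = Sum.map ≈/[]⇒∣ₚ ≈/[]⇒∣ₚ (noZeroDivisors/ _ _ (∣ₚ⇒≈/[] f∣gh))

    1≉0 : ¬ κ 1# ≈/ []
    1≉0 e with ≈/[]⇒∣ₚ e
    ... | k , e′ = monic-nonconstant f-monic (irreducible-degree f-monic f-irr) (below-resp (≋-sym f≋1) below-κ)
      where
      f≋1 : f ≋ κ 1#
      f≋1 with monic-cofactor {g = κ 1#} f-monic (refl , below-κ) e′
      ... | d , 0≡n+d , _ = monic-0 (subst (λ z → Monic z f) (ℕ.m+n≡0⇒m≡0 n (sym 0≡n+d)) f-monic)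

  allVecs : ∀ n → List (Vec Carrier n)
  allVecs zero    = [] ∷ []
  allVecs (suc n) = cartesianProductWith _∷_ elements (allVecs n)

  allVecs-unique : ∀ n → Unique (allVecs n)
  allVecs-unique zero    = [] ∷ []
  allVecs-unique (suc n) = Unique.cartesianProductWith⁺ _∷_ ∷-injective elements-unique (allVecs-unique n)

  ∈-allVecs : ∀ {n} (v : Vec Carrier n) → v ∈ allVecs n
  ∈-allVecs []      = here refl
  ∈-allVecs (a ∷ v) = ∈-cartesianProductWith⁺ _∷_ (∈-elements a) (∈-allVecs v)

  length-allVecs : ∀ n → length (allVecs n) ≡ q ℕ.^ n
  length-allVecs zero    = refl
  length-allVecs (suc n) = trans (go elements) (cong₂ ℕ._*_ length-elements (length-allVecs n))
    where
    go : ∀ xs → length (cartesianProductWith Vec._∷_ xs (allVecs n)) ≡ length xs ℕ.* length (allVecs n)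
    go []       = refl
    go (x ∷ xs) = trans (length-++ (map (x Vec.∷_) (allVecs n))) (cong₂ ℕ._+_ (length-map (x Vec.∷_) (allVecs n)) (go xs))

  -- Divisors are given by coefficient vectors of monic polynomials, finitely many in each degree,
  -- so that the search for one terminates and irreducibility becomes decidable.
  record ProperDivisor (n : ℕ) (f : Poly) : Set where
    constructor properDivisor
    field
      {degree} : ℕ
      1≤degree : 1 ≤ degree
      degree<n : degree < n
      divisor  : Vec Carrier degree
      divides  : monic divisor ∣ₚ f

  properDivisor? : ∀ n f → Dec (ProperDivisor n f)
  properDivisor? n f = map′ to from (any? divisorOfDegree? (upTo n))
    where
    DivisorOfDegree : ℕ → Set
    DivisorOfDegree d = 1 ≤ d × d < n × Any (λ v → monic v ∣ₚ f) (allVecs d)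
    divisorOfDegree? : ∀ d → Dec (DivisorOfDegree d)
    divisorOfDegree? d = (1 ℕ.≤? d) ×-dec (d ℕ.<? n) ×-dec any? (λ v → divides? (monic-monic v) f) (allVecs d)
    to : Any DivisorOfDegree (upTo n) → ProperDivisor n f
    to some with d , _ , 1≤d , d<n , some′ ← find some with v , _ , v∣f ← find some′ = properDivisor 1≤d d<n v v∣f
    from : ProperDivisor n f → Any DivisorOfDegree (upTo n)
    from (properDivisor 1≤d d<n v v∣f) = lose (∈-upTo⁺ d<n) (1≤d , d<n , lose (∈-allVecs v) v∣f)

  noProperDivisor⇒irreducible : ∀ {n f} → Monic n f → 1 ≤ n → ¬ ProperDivisor n f → Irreducible f
  noProperDivisor⇒irreducible {n} {f} m 1≤n none = mkIrreducible (monic-nonconstant m 1≤n) split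
    where
    split : ∀ g h → f ≋ g ⊗ h → Below g 1 ⊎ Below h 1
    split g h f≋ with zero⊎degree g
    ... | inj₁ g≋[] = contradiction (≋-trans f≋ (≋-trans (⊗-cong g≋[] ≋-refl) (𝕂[X].zeroˡ h))) (monic≢[] m)
    ... | inj₂ (zero , _ , b) = inj₁ b
    ... | inj₂ (e@(suc _) , l , b) = inj₂ (small cof)
      where
      c : Carrier
      c = coeff g e
      g₀ : Poly
      g₀ = κ (c ⁻¹) ⊗ g
      f≋g₀ : f ≋ g₀ ⊗ (κ c ⊗ h)
      f≋g₀ = ≋-trans f≋ (≋-trans
        (≋-trans (≋-sym (𝕂[X].*-identityˡ _)) (⊗-cong (≋-trans (κ-cong (sym (*-inverseˡ l))) (κ-* _ _)) ≋-refl))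
        (solve 4 (λ i c g h → (i :* c) :* (g :* h) := (i :* g) :* (c :* h)) ≋-refl (κ (c ⁻¹)) (κ c) g h))
      cof : ∃ λ e′ → n ≡ e ℕ.+ e′ × Monic e′ (κ c ⊗ h)
      cof = monic-cofactor (normalise l b) m f≋g₀
      small : (∃ λ e′ → n ≡ e ℕ.+ e′ × Monic e′ (κ c ⊗ h)) → Below h 1
      small (zero , _ , mk) = mkBelow λ i 1≤i → begin
        coeff h i  ≡⟨ 𝕂.*-identityˡ _ ⟨
        1# * coeff h i  ≡⟨ cong (_* coeff h i) (*-inverseˡ l) ⟨
        (c ⁻¹ * c) * coeff h i  ≡⟨ 𝕂.*-assoc _ _ _ ⟩
        c ⁻¹ * (c * coeff h i)  ≡⟨ cong (c ⁻¹ *_) (trans (sym (coeff-κ⊗ c h i)) (vanish (below mk) i 1≤i)) ⟩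
        c ⁻¹ * 0#  ≡⟨ 𝕂.zeroʳ _ ⟩
        0#  ∎
        where open ≡-Reasoning
      small (suc e′ , n≡ , _) = contradiction
        (properDivisor (s≤s z≤n) (subst (e <_) (sym n≡) (ℕ.m<m+n e (s≤s z≤n))) (low e g₀)
          (κ c ⊗ h , ≋-trans f≋g₀ (⊗-cong (≋-sym (monic-low (normalise l b))) ≋-refl)))
        none

  irreducible⇒noProperDivisor : ∀ {n f} → Monic n f → Irreducible f → ¬ ProperDivisor n f
  irreducible⇒noProperDivisor {n} m irr (properDivisor {d} 1≤d d<n v (k , f≋)) with irreducible-split irr f≋
  ... | inj₁ b = monic-nonconstant (monic-monic v) 1≤d b
  ... | inj₂ b with monic-cofactor (monic-monic v) m f≋
  ...   | zero  , n≡ , _  = ℕ.<-irrefl (sym (trans n≡ (ℕ.+-identityʳ d))) d<n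
  ...   | suc e , n≡ , mk = monic-nonconstant mk (s≤s z≤n) b

  irreducible? : ∀ {n f} → Monic n f → Dec (Irreducible f)
  irreducible? {zero} m = no λ irr → proj₁ irr (vanish (below m))
  irreducible? {suc n} {f} m with properDivisor? (suc n) f
  ... | yes d = no λ irr → irreducible⇒noProperDivisor m irr d
  ... | no ¬d = yes (noProperDivisor⇒irreducible m (s≤s z≤n) ¬d)

  ∃-irreducibleFactor : ∀ n {f} → Monic n f → 1 ≤ n → ∃₂ λ d (v : Vec Carrier d) → Irreducible (monic v) × monic v ∣ₚ f
  ∃-irreducibleFactor = <-rec _ go
    where
    go : ∀ n → (∀ {d} → d < n → ∀ {f} → Monic d f → 1 ≤ d → ∃₂ λ e (v : Vec Carrier e) → Irreducible (monic v) × monic v ∣ₚ f) →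
      ∀ {f} → Monic n f → 1 ≤ n → ∃₂ λ d (v : Vec Carrier d) → Irreducible (monic v) × monic v ∣ₚ f
    go n rec {f} m 1≤n with properDivisor? n f
    ... | no ¬d = n , low n f , irreducible-resp (≋-sym (monic-low m)) (noProperDivisor⇒irreducible m 1≤n ¬d) ,
                  (κ 1# , ≋-trans (≋-sym (monic-low m)) (≋-sym (𝕂[X].*-identityʳ _)))
    ... | yes (properDivisor 1≤d d<n v v∣f) with rec d<n (monic-monic v) 1≤d
    ...   | e , w , irr , w∣v = e , w , irr , ∣ₚ-trans w∣v v∣f

-- Conjugates of X modulo f

module Galois (K : FiniteField) where
  open Ring
  open Polynomial K
  open Degree K
  open Algebras K
  open Irreducibility K
  import Algebra.Properties.CommutativeSemiring.Exp as Exp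
  open import Data.Nat.Divisibility using (_∣_; divides; m%n≡0⇒n∣m)
  open import Data.Nat.DivMod using (_%_; _/_; m≡m%n+[m/n]*n; m%n<n)
  open import Data.Nat.Coprimality using () renaming (sym to coprime-sym)
  open import Data.List using (upTo; applyUpTo)
  open import Data.List.Properties using (length-map; length-applyUpTo; length-++)
  open import Data.List.Membership.Propositional using (find; lose)
  open import Data.List.Membership.Propositional.Properties using (∈-upTo⁺; ∈-upTo⁻)
  open import Data.List.Relation.Unary.All as All using (All; []; _∷_)
  import Data.List.Relation.Unary.All.Properties as All
  open import Data.List.Relation.Unary.AllPairs as AllPairs using (AllPairs; []; _∷_)
  import Data.List.Relation.Unary.AllPairs.Properties as AllPairs
  open import Data.List.Relation.Unary.Any using (Any; any?)
  open import Data.Vec using (Vec; []; _∷_; toList)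
  open import Data.Vec.Properties using (length-toList)
  open import Relation.Binary.PropositionalEquality as ≡ using (_≡_; _≢_)
  open import Relation.Nullary.Decidable using (decidable-stable)

  Invariant : Carrier → Poly → Set
  Invariant c f = 𝕂[X]-ev.ev f (X ⊕ κ c) ≋ f

  monic-ev-translate : ∀ c {n f} → Monic n f → Monic n (𝕂[X]-ev.ev f (X ⊕ κ c))
  monic-ev-translate c {n} {[]} m = contradiction ≋-refl (monic≢[] m)
  monic-ev-translate c {zero} {f@(_ ∷ _)} m = monic-resp (≋-sym (≋-trans (𝕂[X]-ev.ev-congˡ _ (monic-0 m)) (𝕂[X]-ev.ev-κ 1# _))) (≡.refl , below-κ)
  monic-ev-translate c {suc n} {a ∷ f} (l , b) = monic-resp (𝕂[X].+-comm _ _)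
    (monic-⊕ (monic-⊗ (monic-X⊕κ c) (monic-ev-translate c {n} {f} (l , below-tail b))) below-κ)

  low-toList : ∀ {n} (v : Vec Carrier n) → low n (toList v) ≡ v
  low-toList []      = ≡.refl
  low-toList (a ∷ v) = ≡.cong (a ∷_) (low-toList v)

  below-toList : ∀ {n} (v : Vec Carrier n) → Below (toList v) n
  below-toList v .vanish = go v
    where
    go : ∀ {n} (v : Vec Carrier n) i → n ≤ i → coeff (toList v) i ≡ 0#
    go []      i       _         = ≡.refl
    go (a ∷ v) (suc i) (s≤s n≤i) = go v i n≤i

  2≤q^ : ∀ {m} → 1 ≤ m → 2 ≤ q ℕ.^ m
  2≤q^ {m} 1≤m = ℕ.≤-trans 2≤q (ℕ.≤-trans (ℕ.≤-reflexive (≡.sym (ℕ.^-identityʳ q)))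
    (ℕ.^-monoʳ-≤ q {{ℕ.>-nonZero (ℕ.≤-trans (s≤s z≤n) 2≤q)}} 1≤m))

  -- A polynomial f divides it exactly when the m-th Frobenius iterate acts on X modulo f as
  -- translation by c; its degree q^m is what the count finally compares.
  artinSchreier : ℕ → Carrier → Poly
  artinSchreier m c = X ⊗^ (q ℕ.^ m) ⊕ ⊝ (X ⊕ κ c)

  monic-artinSchreier : ∀ m c → 1 ≤ m → Monic (q ℕ.^ m) (artinSchreier m c)
  monic-artinSchreier m c 1≤m = monic-⊕ (monic-⊗^ (q ℕ.^ m) monic-X) (below-⊝ (below-mono (2≤q^ 1≤m) (below-X⊕κ c)))

  module ModuloFrobenius (f : Poly) where
    open Modulo f
    open Evaluate algebra public
    open Frobenius algebra public
    open CommutativeRing R/f using (_≈_; refl; sym; trans; reflexive; +-cong; +-congˡ; +-congʳ; *-congˡ; *-congʳ)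

    ev/≈ : ∀ g x → ev g x ≈ 𝕂[X]-ev.ev g x
    ev/≈ []      x = refl
    ev/≈ (a ∷ g) x = +-congˡ (*-congˡ (ev/≈ g x))

    ev-X/ : ∀ g → ev g X ≈ g
    ev-X/ g = trans (ev/≈ g X) (≈⇒≈/ (ev-X≋ g))

    ^/≡⊗^ : ∀ x n → Exp._^_ R/f.commutativeSemiring x n ≡ x ⊗^ n
    ^/≡⊗^ x zero    = ≡.refl
    ^/≡⊗^ x (suc n) = ≡.cong (x ⊗_) (^/≡⊗^ x n)

    φ-ev : ∀ i g → φ i g ≈ ev g (φ i X)
    φ-ev i g = trans (φ-cong i (sym (ev-X/ g))) (sym (ev-φ i g X))

    ∣artinSchreier⇒φ : ∀ m c → f ∣ₚ artinSchreier m c → φ m X ≈ X ⊕ κ c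
    ∣artinSchreier⇒φ m c f∣ = trans (reflexive (^/≡⊗^ X (q ℕ.^ m))) (Evaluation.x-y≈0⇒x≈y R/f (∣ₚ⇒≈/[] f∣))

    φ⇒∣artinSchreier : ∀ m c → φ m X ≈ X ⊕ κ c → f ∣ₚ artinSchreier m c
    φ⇒∣artinSchreier m c e = ≈/[]⇒∣ₚ (Evaluation.x≈y⇒x-y≈0 R/f (trans (reflexive (≡.sym (^/≡⊗^ X (q ℕ.^ m)))) e))

    -- Frobenius fixes the constants, so each further application of φ i adds another c.
    φ-translate : ∀ i k {c} → φ i X ≈ X ⊕ κ c → φ (k ℕ.* i) X ≈ X ⊕ κ (ι k * c)
    φ-translate i zero {c} e = trans (φ-zero X) (≈⇒≈/ (≋-sym (≋-trans
      (𝕂[X].+-congˡ (≋-trans (κ-cong (𝕂.zeroˡ c)) κ-0)) (𝕂[X].+-identityʳ X))))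
    φ-translate i (suc k) {c} e = begin
      φ (i ℕ.+ k ℕ.* i) X  ≈⟨ φ-φ i (k ℕ.* i) X ⟨
      φ i (φ (k ℕ.* i) X)  ≈⟨ φ-cong i (φ-translate i k e) ⟩
      φ i (X ⊕ κ (ι k * c))  ≈⟨ φ-+ i X (κ (ι k * c)) ⟩
      φ i X ⊕ φ i (κ (ι k * c))  ≈⟨ +-cong e (φ-const i (ι k * c)) ⟩
      (X ⊕ κ c) ⊕ κ (ι k * c)  ≈⟨ ≈⇒≈/ (𝕂[X].+-assoc X (κ c) (κ (ι k * c))) ⟩
      X ⊕ (κ c ⊕ κ (ι k * c))  ≈⟨ +-congˡ (≈⇒≈/ (≋-trans (≋-sym (κ-+ _ _)) (κ-cong
                                             (solve𝕂 2 (λ c k → c ⊞ k ⊡ c ⊜ (𝟙 ⊞ k) ⊡ c) ≡.refl c (ι k))))) ⟩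
      X ⊕ κ (ι (suc k) * c)  ∎
      where open import Relation.Binary.Reasoning.Setoid R/f.setoid

  -- Modulo f², raising f to the power q^m gives 0 but also the translate of f, of too small a degree.
  artinSchreier-squareFree : ∀ {n f} → Monic n f → 1 ≤ n → ∀ m c → 1 ≤ m → ¬ (f ⊗ f) ∣ₚ artinSchreier m c
  artinSchreier-squareFree {n} {f} mf 1≤n m c 1≤m f²∣ = ℕ.<-irrefl ≡.refl
    (ℕ.≤-trans (ℕ.m<m+n n 1≤n) (ℕ.≤-trans (ℕ.m≤m+n (n ℕ.+ n) e) (ℕ.≤-reflexive (≡.sym n≡))))
    where
    open Modulo (f ⊗ f)
    open ModuloFrobenius (f ⊗ f)
    translate≈0 : 𝕂[X]-ev.ev f (X ⊕ κ c) ≈/ []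
    translate≈0 = begin
      𝕂[X]-ev.ev f (X ⊕ κ c)  ≈⟨ ev/≈ f (X ⊕ κ c) ⟨
      ev f (X ⊕ κ c)  ≈⟨ ev-congʳ f (∣artinSchreier⇒φ m c f²∣) ⟨
      ev f (φ m X)  ≈⟨ φ-ev m f ⟨
      φ m f  ≈⟨ power (2≤q^ 1≤m) ⟩
      []  ∎
      where
      open import Relation.Binary.Reasoning.Setoid R/f.setoid
      open Exp R/f.commutativeSemiring using (_^_)
      power : ∀ {N} → 2 ≤ N → f ^ N ≈/ []
      power {suc (suc N)} _ = begin
        f ⊗ (f ⊗ f ^ N)  ≈⟨ ≈⇒≈/ (⊗-assoc f f _) ⟨
        f ⊗ f ⊗ f ^ N  ≈⟨ R/f.*-congʳ (∣ₚ⇒≈/[] ∣ₚ-refl) ⟩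
        [] ⊗ f ^ N  ≈⟨ R/f.zeroˡ _ ⟩
        []  ∎
      power {suc zero} (s≤s ())
    cofactor : ∃ λ e → n ≡ (n ℕ.+ n) ℕ.+ e × Monic e (_∣ₚ_.cofactor (≈/[]⇒∣ₚ translate≈0))
    cofactor = monic-cofactor (monic-⊗ mf mf) (monic-ev-translate c mf) (_∣ₚ_.equation (≈/[]⇒∣ₚ translate≈0))
    e : ℕ
    e = proj₁ cofactor
    n≡ : n ≡ (n ℕ.+ n) ℕ.+ e
    n≡ = proj₁ (proj₂ cofactor)

  module IrreducibleGalois {n : ℕ} {f : Poly} (f-monic : Monic n f) (f-irr : Irreducible f) where
    open Field f-monic f-irr
    open ModuloFrobenius f public
    open CommutativeRing R/f using (_≈_; _≉_; refl; sym; trans; reflexive; +-cong; +-congˡ; +-congʳ; *-congˡ; *-congʳ; +-identityʳ)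
    open Exp R/f.commutativeSemiring using (_^_)

    1≤n : 1 ≤ n
    1≤n = irreducible-degree f-monic f-irr

    instance
      n≢0 : NonZero n
      n≢0 = ℕ.>-nonZero 1≤n

    -- `monic (low d g)` is a list of exactly d + 1 coefficients with last entry 1; more than d
    -- roots would make every coefficient vanish modulo f, and with it 1.
    rootBound : ∀ {d g} rs → Monic d g → AllPairs _≉_ rs → All (λ r → ev g r ≈ []) rs → length rs ≤ d
    rootBound {d} {g} rs m distinct roots = ℕ.≮⇒≥ λ d<rs → 1≉0 (last (low d g)
      (Evaluation.tooManyRoots⇒zero R/f noZeroDivisors/ (map κ (monic (low d g))) rs distinct
        (All.map root roots)
        (ℕ.≤-trans (ℕ.≤-reflexive (≡.trans (length-map κ (monic (low d g))) (length-monic (low d g)))) d<rs)))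
      where
      root : ∀ {r} → ev g r ≈ [] → ev (monic (low d g)) r ≈ []
      root {r} e = trans (ev-congˡ r (monic-low m)) e
      length-monic : ∀ {d} (v : Vec Carrier d) → length (monic v) ≡ suc d
      length-monic v = ≡.trans (length-++ (toList v)) (≡.trans (≡.cong (ℕ._+ 1) (length-toList v)) (ℕ.+-comm _ 1))
      last : ∀ {d} (v : Vec Carrier d) → All (_≈ []) (map κ (monic v)) → κ 1# ≈ []
      last []      (e ∷ _)  = e
      last (a ∷ v) (_ ∷ es) = last v es

    ^≈0⇒≈0 : ∀ k x → x ^ k ≈ [] → x ≈ []
    ^≈0⇒≈0 zero    x e = contradiction e 1≉0
    ^≈0⇒≈0 (suc k) x e with noZeroDivisors/ x (x ^ k) e
    ... | inj₁ x≈0 = x≈0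
    ... | inj₂ e′  = ^≈0⇒≈0 k x e′

    -- By additivity some power of x - y vanishes, and the residue field has no nilpotent elements
    -- other than 0.
    φ-injective : ∀ i {x y} → φ i x ≈ φ i y → x ≈ y
    φ-injective i {x} {y} e = Evaluation.x-y≈0⇒x≈y R/f (^≈0⇒≈0 (q ℕ.^ i) (x ⊕ ⊝ y) (begin
      φ i (x ⊕ ⊝ y)  ≈⟨ R/f.+-identityʳ _ ⟨
      φ i (x ⊕ ⊝ y) ⊕ []  ≈⟨ +-congˡ (R/f.-‿inverseʳ (φ i y)) ⟨
      φ i (x ⊕ ⊝ y) ⊕ (φ i y ⊕ ⊝ φ i y)  ≈⟨ R/f.+-assoc _ _ _ ⟨
      φ i (x ⊕ ⊝ y) ⊕ φ i y ⊕ ⊝ φ i y  ≈⟨ +-congʳ (φ-+ i (x ⊕ ⊝ y) y) ⟨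
      φ i (x ⊕ ⊝ y ⊕ y) ⊕ ⊝ φ i y  ≈⟨ +-congʳ (φ-cong i (≈⇒≈/ (RingSolver.solve 𝕂[X] 2 (λ x y → x :+ :- y :+ y := x) ≋-refl x y))) ⟩
      φ i x ⊕ ⊝ φ i y  ≈⟨ Evaluation.x≈y⇒x-y≈0 R/f e ⟩
      []  ∎))
      where
      open import Relation.Binary.Reasoning.Setoid R/f.setoid
      open RingSolver 𝕂[X] using (_:+_; :-_; _:=_)

    -- A difference c - d ≠ 0 is a unit of K; if it vanished modulo f, so would 1.
    const-injective : ∀ {c d} → X ⊕ κ c ≈ X ⊕ κ d → c ≡ d
    const-injective {c} {d} e = decidable-stable (c ≟ d) λ c≢d →
      let c-d≢0 : c + - d ≢ 0#
          c-d≢0 = λ z → c≢d (Evaluation.x-y≈0⇒x≈y 𝕂 z)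
      in 1≉0 (begin
        κ 1#  ≈⟨ ≈⇒≈/ (≋-trans (κ-cong (≡.sym (*-inverseˡ c-d≢0))) (κ-* _ _)) ⟩
        κ ((c + - d) ⁻¹) ⊗ κ (c + - d)  ≈⟨ *-congˡ difference ⟩
        κ ((c + - d) ⁻¹) ⊗ []  ≈⟨ R/f.zeroʳ _ ⟩
        []  ∎)
      where
      open import Relation.Binary.Reasoning.Setoid R/f.setoid
      open RingSolver 𝕂[X] using (_:+_; :-_; _:=_)
      difference : κ (c + - d) ≈ []
      difference = begin
        κ (c + - d)  ≈⟨ ≈⇒≈/ (κ-+ c (- d)) ⟩
        κ c ⊕ κ (- d)  ≈⟨ ≈⇒≈/ (RingSolver.solve 𝕂[X] 3 (λ x c d → c :+ d := :- x :+ ((x :+ c) :+ d)) ≋-refl X (κ c) (κ (- d))) ⟩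
        ⊝ X ⊕ ((X ⊕ κ c) ⊕ κ (- d))  ≈⟨ +-congˡ (+-congʳ e) ⟩
        ⊝ X ⊕ ((X ⊕ κ d) ⊕ κ (- d))  ≈⟨ ≈⇒≈/ (RingSolver.solve 𝕂[X] 3 (λ x c d → :- x :+ ((x :+ c) :+ d) := c :+ d) ≋-refl X (κ d) (κ (- d))) ⟩
        κ d ⊕ κ (- d)  ≈⟨ ≈⇒≈/ (≋-trans (≋-sym (κ-+ d (- d))) (≋-trans (κ-cong (𝕂.-‿inverseʳ d)) κ-0)) ⟩
        []  ∎

    -- All q^n residues are roots of T^(q^t) - T.
    φ-fixed⇒n≤ : ∀ t → 1 ≤ t → φ t X ≈ X → n ≤ t
    φ-fixed⇒n≤ t 1≤t e = ℕ.≮⇒≥ λ t<n → ℕ.<⇒≱ (ℕ.^-monoʳ-< q 2≤q t<n)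
      (≡.subst (_≤ q ℕ.^ t) (≡.trans (length-map toList (allVecs n)) (length-allVecs n))
        (rootBound residues monic-P (AllPairs.map⁺ (AllPairs.map distinct (allVecs-unique n))) (All.tabulate (λ {g} _ → root g))))
      where
      residues : List Poly
      residues = map toList (allVecs n)
      P : Poly
      P = X ⊗^ (q ℕ.^ t) ⊕ ⊝ X
      monic-P : Monic (q ℕ.^ t) P
      monic-P = monic-⊕ (monic-⊗^ (q ℕ.^ t) monic-X) (below-⊝ (below-mono (2≤q^ 1≤t) (below monic-X)))
      distinct : ∀ {v w : Vec Carrier n} → v ≢ w → toList v ≉ toList w
      distinct {v} {w} v≢w (k , v≋) = v≢w (≡.trans (≡.sym (low-toList v)) (≡.trans (low-cong n v≋w) (low-toList w)))
        where
        fk≋ : f ⊗ k ≋ toList v ⊕ ⊝ toList w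
        fk≋ = ≋-trans (RingSolver.solve 𝕂[X] 2 (λ a b → b := (a :+ b) :+ :- a) ≋-refl (toList w) (f ⊗ k)) (𝕂[X].+-congʳ (≋-sym v≋))
          where open RingSolver 𝕂[X] using (_:+_; :-_; _:=_)
        v≋w : toList v ≋ toList w
        v≋w = ≋-trans v≋ (≋-trans (𝕂[X].+-congˡ (≋-trans
          (⊗-cong ≋-refl (below-cancel f-monic (below-resp (≋-sym fk≋) (below-⊕ (below-toList v) (below-⊝ (below-toList w))))))
          (𝕂[X].zeroʳ f))) (𝕂[X].+-identityʳ _))
      root : ∀ g → ev P g ≈ []
      root g = trans (ev-⊕ _ _ g) (trans (+-cong (trans (ev-⊗^ X (q ℕ.^ t) g) (φ-cong t (ev-X g))) (trans (ev-⊝ X g) (R/f.-‿cong (ev-X g))))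
        (Evaluation.x≈y⇒x-y≈0 R/f (trans (φ-ev t g) (trans (ev-congʳ g e) (ev-X/ g)))))

    φ-difference : ∀ i j → i ≤ j → φ i X ≈ φ j X → φ (j ℕ.∸ i) X ≈ X
    φ-difference i j i≤j e = φ-injective i (trans (φ-φ i (j ℕ.∸ i) X)
      (trans (reflexive (≡.cong (λ z → φ z X) (ℕ.m+[n∸m]≡n i≤j))) (sym e)))

    φ-distinct : ∀ {i j} → i < j → j < n → φ i X ≉ φ j X
    φ-distinct {i} {j} i<j j<n e = ℕ.<⇒≱ (ℕ.≤-<-trans (ℕ.m∸n≤m j i) j<n)
      (φ-fixed⇒n≤ (j ℕ.∸ i) (ℕ.m<n⇒0<n∸m i<j) (φ-difference i j (ℕ.<⇒≤ i<j) e))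

    φ-root : ∀ i → ev f (φ i X) ≈ []
    φ-root i = trans (sym (φ-ev i f)) (trans (φ-cong i (∣ₚ⇒≈/[] ∣ₚ-refl)) (φ-0 i))

    -- The iterates of X with indices 0 to n are roots of f, which has at most n, so two of them
    -- agree. The difference of their indices fixes X, is at most n and, by `φ-fixed⇒n≤`, at least
    -- n.
    φ-n : φ n X ≈ X
    φ-n = decidable-stable (φ n X ≈/? X) λ φn≉ → ℕ.<-irrefl ≡.refl
      (≡.subst (_≤ n) (length-applyUpTo (λ i → φ i X) (suc n))
        (rootBound (applyUpTo (λ i → φ i X) (suc n)) f-monic
          (AllPairs.applyUpTo⁺₁ (λ i → φ i X) (suc n) λ {i} {j} i<j j≤n e →
            φn≉ (wrap i j i<j j≤n (φ-difference i j (ℕ.<⇒≤ i<j) e)))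
          (All.applyUpTo⁺₂ (λ i → φ i X) (suc n) φ-root)))
      where
      wrap : ∀ i j → i < j → j < suc n → φ (j ℕ.∸ i) X ≈ X → φ n X ≈ X
      wrap i j i<j (s≤s j≤n) e = trans (reflexive (≡.cong (λ z → φ z X) (ℕ.≤-antisym
        (φ-fixed⇒n≤ (j ℕ.∸ i) (ℕ.m<n⇒0<n∸m i<j) e) (ℕ.≤-trans (ℕ.m∸n≤m j i) j≤n)))) e

    φ-multiple : ∀ k → φ (k ℕ.* n) X ≈ X
    φ-multiple zero    = φ-zero X
    φ-multiple (suc k) = trans (sym (φ-φ n (k ℕ.* n) X)) (trans (φ-cong n (φ-multiple k)) φ-n)

    n∣⇒φ-fixed : ∀ {t} → n ∣ t → φ t X ≈ X
    n∣⇒φ-fixed (divides k ≡.refl) = φ-multiple k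

    -- Multiples of n act trivially on X, so t may be reduced modulo n, and a nonzero remainder
    -- below n cannot fix X.
    φ-fixed⇒n∣ : ∀ t → φ t X ≈ X → n ∣ t
    φ-fixed⇒n∣ t e = m%n≡0⇒n∣m t n (zero? (t % n) (m%n<n t n) fixed)
      where
      fixed : φ (t % n) X ≈ X
      fixed = trans (φ-cong (t % n) (sym (φ-multiple (t / n)))) (trans (φ-φ (t % n) (t / n ℕ.* n) X)
        (trans (reflexive (≡.cong (λ z → φ z X) (≡.sym (m≡m%n+[m/n]*n t n)))) e))
      zero? : ∀ r → r < n → φ r X ≈ X → r ≡ 0
      zero? zero    _   _  = ≡.refl
      zero? (suc r) r<n e′ = contradiction (φ-fixed⇒n≤ (suc r) (s≤s z≤n) e′) (ℕ.<⇒≱ r<n)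

    -- The iterates with index below n are n distinct roots of f; one more root would exceed its
    -- degree.
    root⇒φ : ∀ g → ev f g ≈ [] → ∃ λ i → i < n × φ i X ≈ g
    root⇒φ g root = search (any? (λ i → φ i X ≈/? g) (upTo n))
      where
      search : Dec (Any (λ i → φ i X ≈ g) (upTo n)) → ∃ λ i → i < n × φ i X ≈ g
      search (yes some) with i , i∈ , e ← find some = i , ∈-upTo⁻ i∈ , e
      search (no none) = contradiction
        (≡.subst (_≤ n) (≡.cong suc (length-applyUpTo (λ i → φ i X) n))
          (rootBound (g ∷ applyUpTo (λ i → φ i X) n) f-monic
            (All.applyUpTo⁺₁ (λ i → φ i X) n (λ i<n e → none (lose (∈-upTo⁺ i<n) (sym e)))
              ∷ AllPairs.applyUpTo⁺₁ (λ i → φ i X) n φ-distinct)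
            (root ∷ All.applyUpTo⁺₂ (λ i → φ i X) n φ-root)))
        (ℕ.<-irrefl ≡.refl)

    -- Modulo f, f(X + c) ≡ f(φ i X) ≡ 0, so f divides its translate, and both are monic of degree
    -- n.
    φ⇒invariant : ∀ i {c} → φ i X ≈ X ⊕ κ c → Invariant c f
    φ⇒invariant i {c} e = ≋-sym (monic-∣-monic f-monic (monic-ev-translate c f-monic) (≈/[]⇒∣ₚ
      (trans (sym (ev/≈ f (X ⊕ κ c))) (trans (ev-congʳ f (sym e)) (φ-root i)))))

    -- Invariance makes X + c a root of f modulo f, and every root there is a conjugate of X.
    invariant⇒φ : ∀ {c} → Invariant c f → ∃ λ i → i < n × φ i X ≈ X ⊕ κ c
    invariant⇒φ {c} inv = root⇒φ (X ⊕ κ c) (trans (ev/≈ f (X ⊕ κ c)) (trans (≈⇒≈/ inv) (∣ₚ⇒≈/[] ∣ₚ-refl)))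

-- Translations in characteristic p

module Characteristic (K : FiniteField) (p : ℕ) (p-prime : Prime p) (char : Over.HasCharacteristic K p) where
  open Moebius using (prime∤⇒coprime; prime∤1)
  open Polynomial K
  open Degree K
  open Algebras K
  open Irreducibility K
  open Galois K
  open import Data.Nat.Divisibility
  open import Data.Nat.DivMod using (_%_; _/_; m≡m%n+[m/n]*n; m%n<n)
  open import Data.Nat.Coprimality using (coprime-divisor; coprime-Bézout)
  open import Data.Nat.GCD using (module Bézout)
  open import Data.Nat.Primality using (euclidsLemma; prime⇒nonZero)
  open import Data.Nat.Solver using (module +-*-Solver)
  open import Data.Sum using ([_,_]′)
  open import Relation.Binary.Definitions using (tri<; tri≈; tri>)
  open import Relation.Binary.PropositionalEquality

  instance
    p≢0 : NonZero p
    p≢0 = prime⇒nonZero p-prime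

  ι-+ : ∀ a b → ι (a ℕ.+ b) ≡ ι a + ι b
  ι-+ zero    b = sym (𝕂.+-identityˡ _)
  ι-+ (suc a) b = trans (cong (1# +_) (ι-+ a b)) (sym (𝕂.+-assoc _ _ _))

  ι-* : ∀ a b → ι (a ℕ.* b) ≡ ι a * ι b
  ι-* zero    b = sym (𝕂.zeroˡ _)
  ι-* (suc a) b = trans (ι-+ b (a ℕ.* b)) (trans (cong (ι b +_) (ι-* a b))
    (solve𝕂 2 (λ a b → b ⊞ a ⊡ b ⊜ (𝟙 ⊞ a) ⊡ b) refl (ι a) (ι b)))

  ι-*p : ∀ a → ι (a ℕ.* p) ≡ 0#
  ι-*p a = trans (ι-* a p) (trans (cong (ι a *_) char) (𝕂.zeroʳ _))

  ι-+*p : ∀ a b → ι (a ℕ.+ b ℕ.* p) ≡ ι a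
  ι-+*p a b = trans (ι-+ a (b ℕ.* p)) (trans (cong (ι a +_) (ι-*p b)) (𝕂.+-identityʳ _))

  ι-1 : ι 1 ≡ 1#
  ι-1 = 𝕂.+-identityʳ 1#

  inverseMod : ∀ j → ¬ p ∣ j → ∃₂ λ s y → s ℕ.* j ≡ 1 ℕ.+ y ℕ.* p
  inverseMod j p∤j with coprime-Bézout (prime∤⇒coprime p-prime p∤j)
  ... | Bézout.+- x y e = x , y , sym e
  ... | Bézout.-+ x y e with x ℕ.* j in xj
  ...   | zero  = contradiction (divides y e) (prime∤1 p-prime)
  -- Here x j ≡ -1 modulo p, so (x j)² ≡ 1 and x (x j) inverts j. With x j = w + 1 this reads (w +
  -- 1)² = 1 + w (w + 2), where w + 2 = y p.
  ...   | suc w = x ℕ.* suc w , w ℕ.* y , (begin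
    x ℕ.* suc w ℕ.* j  ≡⟨ solve 3 (λ x w j → x :* w :* j := x :* j :* w) refl x (suc w) j ⟩
    x ℕ.* j ℕ.* suc w  ≡⟨ cong (ℕ._* suc w) xj ⟩
    suc w ℕ.* suc w  ≡⟨ solve 1 (λ w → (con 1 :+ w) :* (con 1 :+ w) := con 1 :+ w :* (con 2 :+ w)) refl w ⟩
    1 ℕ.+ w ℕ.* (2 ℕ.+ w)  ≡⟨ cong (λ z → 1 ℕ.+ w ℕ.* z) e ⟩
    1 ℕ.+ w ℕ.* (y ℕ.* p)  ≡⟨ cong (1 ℕ.+_) (sym (ℕ.*-assoc w y p)) ⟩
    1 ℕ.+ w ℕ.* y ℕ.* p  ∎)
    where
    open ≡-Reasoning
    open +-*-Solver

  ι≢0 : ∀ j → ¬ p ∣ j → ι j ≢ 0#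
  ι≢0 j p∤j ιj≡0 with s , y , e ← inverseMod j p∤j = 0≢1 (begin
    0#  ≡⟨ 𝕂.zeroʳ _ ⟨
    ι s * 0#  ≡⟨ cong (ι s *_) ιj≡0 ⟨
    ι s * ι j  ≡⟨ ι-* s j ⟨
    ι (s ℕ.* j)  ≡⟨ cong ι e ⟩
    ι (1 ℕ.+ y ℕ.* p)  ≡⟨ ι-+*p 1 y ⟩
    ι 1  ≡⟨ ι-1 ⟩
    1#  ∎)
    where open ≡-Reasoning

  ∤-of-< : ∀ {j} → 1 ≤ j → j < p → ¬ p ∣ j
  ∤-of-< 1≤j j<p p∣j = ℕ.<⇒≱ j<p (∣⇒≤ {{ℕ.>-nonZero 1≤j}} p∣j)

  private
    ι-injective-< : ∀ {i j} → i < j → j < p → ι i ≢ ι j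
    ι-injective-< {i} {j} i<j j<p e = ι≢0 (j ℕ.∸ i) (∤-of-< (ℕ.m<n⇒0<n∸m i<j) (ℕ.≤-<-trans (ℕ.m∸n≤m j i) j<p)) (begin
      ι (j ℕ.∸ i)  ≡⟨ solve𝕂 2 (λ a b → b ⊜ ⊟ a ⊞ (a ⊞ b)) refl (ι i) _ ⟩
      - ι i + (ι i + ι (j ℕ.∸ i))  ≡⟨ cong (- ι i +_) (trans (sym (ι-+ i (j ℕ.∸ i))) (cong ι (ℕ.m+[n∸m]≡n (ℕ.<⇒≤ i<j)))) ⟩
      - ι i + ι j  ≡⟨ cong (- ι i +_) (sym e) ⟩
      - ι i + ι i  ≡⟨ 𝕂.-‿inverseˡ _ ⟩
      0#  ∎)
      where open ≡-Reasoning

  ι-injective : ∀ {i j} → i < p → j < p → ι i ≡ ι j → i ≡ j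
  ι-injective {i} {j} i<p j<p e with ℕ.<-cmp i j
  ... | tri< i<j _ _ = contradiction e (ι-injective-< i<j j<p)
  ... | tri≈ _ i≡j _ = i≡j
  ... | tri> _ _ j<i = contradiction (sym e) (ι-injective-< j<i i<p)

  module Translations {n : ℕ} {f : Poly} (f-monic : Monic n f) (f-irr : Irreducible f) where
    open IrreducibleGalois f-monic f-irr
    open Field f-monic f-irr using (_≈/_; ≈⇒≈/; module R/f)

    X⊕κ0 : ∀ {c} → c ≡ 0# → X ⊕ κ c ≈/ X
    X⊕κ0 refl = ≈⇒≈/ (≋-trans (𝕂[X].+-congˡ κ-0) (𝕂[X].+-identityʳ X))

    -- Repeating the translation by c altogether p times gives the translation by p c = 0, so index
    -- p i fixes X.
    φ-translate⇒n∣p* : ∀ i {c} → φ i X ≈/ X ⊕ κ c → n ∣ p ℕ.* i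
    φ-translate⇒n∣p* i {c} e = φ-fixed⇒n∣ (p ℕ.* i) (R/f.trans (φ-translate i p e)
      (X⊕κ0 (trans (cong (_* c) char) (𝕂.zeroˡ c))))

    φ-translate⇒n∤ : ∀ i {c} → c ≢ 0# → φ i X ≈/ X ⊕ κ c → ¬ n ∣ i
    φ-translate⇒n∤ i c≢0 e n∣i = c≢0 (const-injective
      (R/f.trans (R/f.sym e) (R/f.trans (n∣⇒φ-fixed n∣i) (R/f.sym (X⊕κ0 refl)))))

    invariant⇒p∣n : ∀ {c} → c ≢ 0# → Invariant c f → p ∣ n
    invariant⇒p∣n {c} c≢0 inv = go (invariant⇒φ inv) (p ∣? n)
      where
      go : (∃ λ i → i < n × φ i X ≈/ X ⊕ κ c) → Dec (p ∣ n) → p ∣ n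
      go _           (yes p∣n) = p∣n
      go (i , _ , e) (no p∤n)  = contradiction
        (coprime-divisor (prime∤⇒coprime p-prime p∤n) (φ-translate⇒n∣p* i e))
        (φ-translate⇒n∤ i c≢0 e)

    -- If s j ≡ 1 modulo p, index s m translates X by 1. For the degrees, n divides p m, say p m = e
    -- n. If p divided e, then n would divide m and the translation would be trivial; so p ∤ e, and
    -- Euclid's lemma gives p ∣ n.
    factor⇒ : ∀ m j → ¬ p ∣ j → f ∣ₚ artinSchreier m (ι j) →
      Invariant 1# f × ∃₂ λ d e → n ≡ p ℕ.* d × m ≡ e ℕ.* d × ¬ p ∣ e
    factor⇒ m j p∤j f∣ = invariant , degree
      where
      φm : φ m X ≈/ X ⊕ κ (ι j)
      φm = ∣artinSchreier⇒φ m (ι j) f∣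
      invariant : Invariant 1# f
      invariant with s , y , e ← inverseMod j p∤j = φ⇒invariant (s ℕ.* m) (R/f.trans (φ-translate m s φm)
        (R/f.reflexive (cong (λ z → X ⊕ κ z) (trans (sym (ι-* s j)) (trans (cong ι e) (trans (ι-+*p 1 y) ι-1))))))
      degree : ∃₂ λ d e → n ≡ p ℕ.* d × m ≡ e ℕ.* d × ¬ p ∣ e
      degree = start (φ-translate⇒n∣p* m φm)
        where
        go : ∀ e → p ℕ.* m ≡ e ℕ.* n → ∃₂ λ d e → n ≡ p ℕ.* d × m ≡ e ℕ.* d × ¬ p ∣ e
        go e pm≡en with p ∣? e
        ... | yes (divides e′ refl) = contradiction
          (divides e′ (ℕ.*-cancelˡ-≡ m (e′ ℕ.* n) p (trans pm≡en
            (solve 3 (λ e p n → e :* p :* n := p :* (e :* n)) refl e′ p n))))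
          (φ-translate⇒n∤ m (ι≢0 j p∤j) φm)
          where open +-*-Solver
        ... | no p∤e with euclidsLemma e n p-prime (divides m (trans (sym pm≡en) (ℕ.*-comm p m)))
        ...   | inj₁ p∣e = contradiction p∣e p∤e
        ...   | inj₂ (divides d n≡dp) = d , e , trans n≡dp (ℕ.*-comm d p) ,
          ℕ.*-cancelˡ-≡ m (e ℕ.* d) p (trans pm≡en (trans (cong (e ℕ.*_) n≡dp)
            (solve 3 (λ e p d → e :* (d :* p) := p :* (e :* d)) refl e p d))) , p∤e
          where open +-*-Solver
        start : n ∣ p ℕ.* m → ∃₂ λ d e → n ≡ p ℕ.* d × m ≡ e ℕ.* d × ¬ p ∣ e
        start (divides e pm≡en) = go e pm≡en

    -- Some index i translates X by 1, and n ∣ p i with n ∤ i gives i = j₀ d with p ∤ j₀. If s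
    -- inverts j₀ modulo p, then u = s e satisfies u i ≡ e d modulo n, so index e d translates X by
    -- u; this is nonzero since p divides neither s nor e.
    ⇒factor : Invariant 1# f → ∀ d e → n ≡ p ℕ.* d → ¬ p ∣ e →
      ∃ λ j → 1 ≤ j × j < p × f ∣ₚ artinSchreier (e ℕ.* d) (ι j)
    ⇒factor inv d e n≡pd p∤e = start (invariant⇒φ inv)
      where
      go : ∀ i → φ i X ≈/ X ⊕ κ 1# → d ∣ i → ¬ n ∣ i → ∃ λ j → 1 ≤ j × j < p × f ∣ₚ artinSchreier (e ℕ.* d) (ι j)
      go i φi (divides j₀ i≡j₀d) n∤i = finish (inverseMod j₀ p∤j₀)
        where
        p∤j₀ : ¬ p ∣ j₀
        p∤j₀ (divides k refl) = n∤i (divides k (trans i≡j₀d (trans (ℕ.*-assoc k p d) (cong (k ℕ.*_) (sym n≡pd)))))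
        finish : (∃₂ λ s y → s ℕ.* j₀ ≡ 1 ℕ.+ y ℕ.* p) → ∃ λ j → 1 ≤ j × j < p × f ∣ₚ artinSchreier (e ℕ.* d) (ι j)
        finish (s , y , sj₀) = j , 1≤j , m%n<n u p , φ⇒∣artinSchreier (e ℕ.* d) (ι j) (begin
          φ (e ℕ.* d) X  ≈⟨ φ-cong (e ℕ.* d) (φ-multiple (y ℕ.* e)) ⟨
          φ (e ℕ.* d) (φ (y ℕ.* e ℕ.* n) X)  ≈⟨ φ-φ (e ℕ.* d) (y ℕ.* e ℕ.* n) X ⟩
          φ (e ℕ.* d ℕ.+ y ℕ.* e ℕ.* n) X  ≈⟨ R/f.reflexive (cong (λ z → φ z X) (sym ui≡)) ⟩
          φ (u ℕ.* i) X  ≈⟨ φ-translate i u φi ⟩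
          X ⊕ κ (ι u * 1#)  ≈⟨ R/f.reflexive (cong (λ z → X ⊕ κ z) (trans (𝕂.*-identityʳ (ι u)) ιu)) ⟩
          X ⊕ κ (ι j)  ∎)
          where
          open import Relation.Binary.Reasoning.Setoid R/f.setoid
          u j : ℕ
          u = s ℕ.* e
          j = u % p
          ιu : ι u ≡ ι j
          ιu = trans (cong ι (m≡m%n+[m/n]*n u p)) (ι-+*p j (u / p))
          ui≡ : u ℕ.* i ≡ e ℕ.* d ℕ.+ y ℕ.* e ℕ.* n
          ui≡ = trans (cong (u ℕ.*_) i≡j₀d) (trans (solve 4 (λ s e j d → s :* e :* (j :* d) := s :* j :* (e :* d)) refl s e j₀ d)
            (trans (cong (ℕ._* (e ℕ.* d)) sj₀) (trans (solve 4 (λ y p e d → (con 1 :+ y :* p) :* (e :* d) := e :* d :+ y :* e :* (p :* d)) refl y p e d)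
              (cong (λ z → e ℕ.* d ℕ.+ y ℕ.* e ℕ.* z) (sym n≡pd)))))
            where open +-*-Solver
          p∤s : ¬ p ∣ s
          p∤s p∣s = prime∤1 p-prime (∣m+n∣m⇒∣n (subst (p ∣_) (trans sj₀ (ℕ.+-comm 1 _)) (∣m⇒∣m*n j₀ p∣s)) (n∣m*n y))
          1≤j : 1 ≤ j
          1≤j = ℕ.n≢0⇒n>0 λ j≡0 → [ p∤s , p∤e ]′ (euclidsLemma s e p-prime (m%n≡0⇒n∣m u p j≡0))

      start : (∃ λ i → i < n × φ i X ≈/ X ⊕ κ 1#) → ∃ λ j → 1 ≤ j × j < p × f ∣ₚ artinSchreier (e ℕ.* d) (ι j)
      start (i , _ , φi) = go i φi (*-cancelˡ-∣ p (subst (_∣ p ℕ.* i) n≡pd (φ-translate⇒n∣p* i φi)))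
        (φ-translate⇒n∤ i (λ z → 0≢1 (sym z)) φi)

    factor-unique : ∀ m {i j} → i < p → j < p → f ∣ₚ artinSchreier m (ι i) → f ∣ₚ artinSchreier m (ι j) → i ≡ j
    factor-unique m {i} {j} i<p j<p f∣i f∣j = ι-injective i<p j<p (const-injective
      (R/f.trans (R/f.sym (∣artinSchreier⇒φ m (ι i) f∣i)) (∣artinSchreier⇒φ m (ι j) f∣j)))

    invariant-ι : Invariant 1# f → ∀ j → Invariant (ι j) f
    invariant-ι inv j = go (invariant⇒φ inv)
      where
      go : (∃ λ i → i < n × φ i X ≈/ X ⊕ κ 1#) → Invariant (ι j) f
      go (i , _ , φi) = subst (λ c → Invariant c f) (𝕂.*-identityʳ (ι j)) (φ⇒invariant (j ℕ.* i) (φ-translate i j φi))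

    -- The indices i₁ and i of the translations by 1 and by c are both multiples of d = n / p. As i₁
    -- / d is prime to p, some multiple u i₁ is congruent to i modulo n, and c = u. This is the
    -- bound of p on the number of translations.
    invariant⇒ι : Invariant 1# f → ∀ {c} → Invariant c f → ∃ λ j → j < p × c ≡ ι j
    invariant⇒ι inv₁ {c} inv = go (invariant⇒p∣n (λ z → 0≢1 (sym z)) inv₁) (invariant⇒φ inv₁) (invariant⇒φ inv)
      where
      go : p ∣ n → (∃ λ i → i < n × φ i X ≈/ X ⊕ κ 1#) → (∃ λ i → i < n × φ i X ≈/ X ⊕ κ c) → ∃ λ j → j < p × c ≡ ι j
      go (divides d n≡dp) (i₁ , _ , φ₁) (i , _ , φc) = go′ (d∣ i₁ φ₁) (d∣ i φc)
        where
        n≡pd : n ≡ p ℕ.* d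
        n≡pd = trans n≡dp (ℕ.*-comm d p)
        d∣ : ∀ k {c} → φ k X ≈/ X ⊕ κ c → d ∣ k
        d∣ k e = *-cancelˡ-∣ p (subst (_∣ p ℕ.* k) n≡pd (φ-translate⇒n∣p* k e))
        go′ : d ∣ i₁ → d ∣ i → ∃ λ j → j < p × c ≡ ι j
        go′ (divides j₁ i₁≡) (divides j i≡) = go″ (inverseMod j₁ p∤j₁)
          where
          p∤j₁ : ¬ p ∣ j₁
          p∤j₁ (divides k refl) = φ-translate⇒n∤ i₁ (λ z → 0≢1 (sym z)) φ₁
            (divides k (trans i₁≡ (trans (ℕ.*-assoc k p d) (cong (k ℕ.*_) (sym n≡pd)))))
          go″ : (∃₂ λ s y → s ℕ.* j₁ ≡ 1 ℕ.+ y ℕ.* p) → ∃ λ j → j < p × c ≡ ι j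
          go″ (s , y , sj₁) = u % p , m%n<n u p , trans (const-injective (begin
            X ⊕ κ c  ≈⟨ φc ⟨
            φ i X  ≈⟨ φ-cong i (φ-multiple (j ℕ.* y)) ⟨
            φ i (φ (j ℕ.* y ℕ.* n) X)  ≈⟨ φ-φ i (j ℕ.* y ℕ.* n) X ⟩
            φ (i ℕ.+ j ℕ.* y ℕ.* n) X  ≈⟨ R/f.reflexive (cong (λ z → φ z X) (sym ui₁≡)) ⟩
            φ (u ℕ.* i₁) X  ≈⟨ φ-translate i₁ u φ₁ ⟩
            X ⊕ κ (ι u * 1#)  ∎))
            (trans (𝕂.*-identityʳ (ι u)) (trans (cong ι (m≡m%n+[m/n]*n u p)) (ι-+*p (u % p) (u / p))))
            where
            open import Relation.Binary.Reasoning.Setoid R/f.setoid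
            u : ℕ
            u = s ℕ.* j
            ui₁≡ : u ℕ.* i₁ ≡ i ℕ.+ j ℕ.* y ℕ.* n
            ui₁≡ = trans (cong (u ℕ.*_) i₁≡) (trans (solve 4 (λ s j k d → s :* j :* (k :* d) := s :* k :* (j :* d)) refl s j j₁ d)
              (trans (cong (ℕ._* (j ℕ.* d)) sj₁) (trans (solve 4 (λ y p j d → (con 1 :+ y :* p) :* (j :* d) := j :* d :+ j :* y :* (p :* d)) refl y p j d)
                (cong₂ (λ a b → a ℕ.+ j ℕ.* y ℕ.* b) (sym i≡) (sym n≡pd)))))
              where open +-*-Solver

-- Counting the irreducible polynomials invariant under x ↦ x + 1

module Counting (K : FiniteField) (p : ℕ) (p-prime : Prime p) (char : Over.HasCharacteristic K p) where
  open Ring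
  open Sums
  open Moebius
  open Polynomial K
  open Degree K
  open Algebras K
  open Irreducibility K
  open Galois K
  open Characteristic K p p-prime char
  open import Data.Nat.Divisibility
  open import Data.Integer using (ℤ; 0ℤ; +_) renaming (_+_ to _+ℤ_; _*_ to _*ℤ_)
  import Data.Integer.Properties as ℤ
  open import Data.List using (_++_; filter)
  open import Data.List.Membership.Propositional.Properties using (∈-map⁺; ∈-map⁻; ∈-++⁺ˡ; ∈-++⁺ʳ; ∈-++⁻; ∈-filter⁺; ∈-filter⁻)
  open import Data.List.Relation.Unary.All as All using (All; []; _∷_)
  open import Data.List.Relation.Unary.AllPairs using ([]; _∷_)
  open import Data.List.Relation.Unary.Any using (here; there)
  import Data.List.Relation.Unary.Unique.Propositional.Properties as Unique
  open import Data.Vec using (Vec)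
  open import Data.Product using (Σ)
  open import Relation.Binary.PropositionalEquality
  open import Relation.Nullary.Decidable using (_×-dec_; map′)

  MonicPoly : Set
  MonicPoly = Σ ℕ (Vec Carrier)

  degree : MonicPoly → ℤ
  degree (d , _) = + d

  irreducible-∣-irreducible : ∀ {d e} (v : Vec Carrier d) (w : Vec Carrier e) → Irreducible (monic v) → Irreducible (monic w) →
    monic w ∣ₚ monic v → _≡_ {A = MonicPoly} (e , w) (d , v)
  irreducible-∣-irreducible {d} {e} v w iv iw (k , v≋) with irreducible-split iv v≋
  ... | inj₁ b = contradiction (vanish b) (proj₁ iw)
  ... | inj₂ b = go (monic-cofactor (monic-monic w) (monic-monic v) v≋)
    where
    go : (∃ λ c → d ≡ e ℕ.+ c × Monic c k) → _≡_ {A = MonicPoly} (e , w) (d , v)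
    go (suc c , _ , mk)  = contradiction b (monic-nonconstant mk (s≤s z≤n))
    go (zero , d≡e+0 , mk) with trans d≡e+0 (ℕ.+-identityʳ e)
    ... | refl = cong (d ,_) (monic-injective (≋-sym (≋-trans v≋
      (≋-trans (⊗-cong ≋-refl (monic-0 mk)) (𝕂[X].*-identityʳ _)))))

  -- Dividing F by the first listed factor leaves a cofactor whose irreducible factors are the rest
  -- of the list: by squarefreeness the removed one does not occur again. When the list is
  -- exhausted, a cofactor of positive degree would still have an irreducible factor.
  factorDegrees : ∀ ys {N F} → Monic N F →
    (∀ {d} (v : Vec Carrier d) → Irreducible (monic v) → ¬ (monic v ⊗ monic v) ∣ₚ F) →
    Unique ys → (∀ {x} → x ∈ ys → Irreducible (monic (proj₂ x)) × monic (proj₂ x) ∣ₚ F) →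
    (∀ {d} (v : Vec Carrier d) → Irreducible (monic v) → monic v ∣ₚ F → (d , v) ∈ ys) →
    ∑ᴸ ys degree ≡ + N
  factorDegrees [] {zero} mF _ _ _ _ = refl
  factorDegrees [] {suc N} mF _ _ _ complete = absurd (∃-irreducibleFactor (suc N) mF (s≤s z≤n))
    where
    absurd : (∃₂ λ d (v : Vec Carrier d) → Irreducible (monic v) × monic v ∣ₚ _) → 0ℤ ≡ + suc N
    absurd (d , v , irr , v∣F) with () ← complete v irr v∣F
  factorDegrees ((d , v) ∷ ys) {N} {F} mF sqf (x∉ys ∷ ys!) factors complete = go (proj₂ (factors (here refl)))
    where
    iv : Irreducible (monic v)
    iv = proj₁ (factors (here refl))
    go : monic v ∣ₚ F → + d +ℤ ∑ᴸ ys degree ≡ + N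
    go (F′ , F≋) = go′ (monic-cofactor (monic-monic v) mF F≋)
      where
      F′∣F : F′ ∣ₚ F
      F′∣F = monic v , ≋-trans F≋ (⊗-comm (monic v) F′)
      go′ : (∃ λ e → N ≡ d ℕ.+ e × Monic e F′) → + d +ℤ ∑ᴸ ys degree ≡ + N
      go′ (e , N≡ , mF′) = trans (cong (+ d +ℤ_) (factorDegrees ys mF′
        (λ w iw w²∣ → sqf w iw (∣ₚ-trans w²∣ F′∣F)) ys! factors′ complete′)) (cong +_ (sym N≡))
        where
        factors′ : ∀ {x} → x ∈ ys → Irreducible (monic (proj₂ x)) × monic (proj₂ x) ∣ₚ F′
        factors′ {b , w} x∈ = iw , pick (Field.euclid (monic-monic w) iw (∣ₚ-resp (proj₂ (factors (there x∈)))))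
          where
          iw : Irreducible (monic w)
          iw = proj₁ (factors (there x∈))
          ∣ₚ-resp : monic w ∣ₚ F → monic w ∣ₚ monic v ⊗ F′
          ∣ₚ-resp (k , e) = k , ≋-trans (≋-sym F≋) e
          pick : monic w ∣ₚ monic v ⊎ monic w ∣ₚ F′ → monic w ∣ₚ F′
          pick (inj₁ w∣v) = contradiction (sym (irreducible-∣-irreducible v w iv iw w∣v)) (All.lookup x∉ys x∈)
          pick (inj₂ w∣F′) = w∣F′
        complete′ : ∀ {b} (w : Vec Carrier b) → Irreducible (monic w) → monic w ∣ₚ F′ → (b , w) ∈ ys
        complete′ {b} w iw w∣F′ with complete w iw (∣ₚ-trans w∣F′ F′∣F)
        ... | there x∈ = x∈
        ... | here refl = contradiction (square w∣F′) (sqf v iv)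
          where
          square : monic v ∣ₚ F′ → (monic v ⊗ monic v) ∣ₚ F
          square (k , e) = k , ≋-trans F≋ (≋-trans (⊗-cong ≋-refl e) (≋-sym (⊗-assoc (monic v) (monic v) k)))

  _≋?_ : ∀ f g → Dec (f ≋ g)
  f ≋? g = map′ (Evaluation.x-y≈0⇒x≈y 𝕂[X]) (Evaluation.x≈y⇒x-y≈0 𝕂[X]) (≋[]? (f ⊕ ⊝ g))

  TranslationInvariant : ∀ n → Vec Carrier n → Set
  TranslationInvariant n v = Irreducible (monic v) × Invariant 1# (monic v)

  invariant? : ∀ n v → Dec (TranslationInvariant n v)
  invariant? n v = irreducible? (monic-monic v) ×-dec (𝕂[X]-ev.ev (monic v) (X ⊕ κ 1#) ≋? monic v)

  opaque
    invariants : ∀ n → List (Vec Carrier n)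
    invariants n = filter (invariant? n) (allVecs n)

    invariants-unique : ∀ n → Unique (invariants n)
    invariants-unique n = Unique.filter⁺ (invariant? n) (allVecs-unique n)

    ∈-invariants⁺ : ∀ {n v} → TranslationInvariant n v → v ∈ invariants n
    ∈-invariants⁺ {n} {v} = ∈-filter⁺ (invariant? n) (∈-allVecs v)

    ∈-invariants⁻ : ∀ {n v} → v ∈ invariants n → TranslationInvariant n v
    ∈-invariants⁻ {n} v∈ = proj₂ (∈-filter⁻ (invariant? n) {xs = allVecs n} v∈)

  ∑ᴸ-++ : ∀ {A : Set} (xs ys : List A) g → ∑ᴸ (xs ++ ys) g ≡ ∑ᴸ xs g +ℤ ∑ᴸ ys g
  ∑ᴸ-++ []       ys g = sym (ℤ.+-identityˡ _)
  ∑ᴸ-++ (x ∷ xs) ys g = trans (cong (g x +ℤ_) (∑ᴸ-++ xs ys g)) (sym (ℤ.+-assoc (g x) _ _))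

  ∑ᴸ-filter : ∀ {A : Set} {P : A → Set} (P? : ∀ x → Dec (P x)) xs g → ∑ᴸ (filter P? xs) g ≡ ∑ᴸ xs (λ x → when (P? x) (g x))
  ∑ᴸ-filter P? [] g = refl
  ∑ᴸ-filter P? (x ∷ xs) g with P? x
  ... | yes _ = cong (g x +ℤ_) (∑ᴸ-filter P? xs g)
  ... | no  _ = trans (∑ᴸ-filter P? xs g) (sym (ℤ.+-identityˡ _))

  ∑ᴸ-cong : ∀ {A : Set} (xs : List A) {g h} → (∀ {x} → x ∈ xs → g x ≡ h x) → ∑ᴸ xs g ≡ ∑ᴸ xs h
  ∑ᴸ-cong []       e = refl
  ∑ᴸ-cong (x ∷ xs) e = cong₂ _+ℤ_ (e (here refl)) (∑ᴸ-cong xs (λ x∈ → e (there x∈)))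

  ∑-const : ∀ n c → ∑ n (λ _ → c) ≡ + n *ℤ c
  ∑-const zero    c = sym (ℤ.*-zeroˡ c)
  ∑-const (suc n) c = trans (cong (_+ℤ c) (∑-const n c)) (trans (ℤ.+-comm _ c) (sym (ℤ.suc-* (+ n) c)))

  ∑-single : ∀ n j {P : ℕ → Set} (P? : ∀ k → Dec (P k)) x → 1 ≤ j → j ≤ n → P j → (∀ k → 1 ≤ k → k ≤ n → P k → k ≡ j) →
    ∑ n (λ k → when (P? k) x) ≡ x
  ∑-single n j P? x 1≤j j≤n Pj unique = trans
    (∑-cong n (λ k 1≤k k≤n → when-cong (P? k) (k ℕ.≟ j) (unique k 1≤k k≤n) (λ { refl → Pj }) (λ _ _ → refl)))
    (go n j≤n)
    where
    go : ∀ n → j ≤ n → ∑ n (λ k → when (k ℕ.≟ j) x) ≡ x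
    go zero j≤0 = contradiction (ℕ.≤-trans 1≤j j≤0) λ ()
    go (suc n) j≤n with ℕ.m≤n⇒m<n∨m≡n j≤n
    ... | inj₁ (s≤s j≤n′) = trans (cong₂ _+ℤ_ (go n j≤n′) (when-no (suc n ℕ.≟ j) (λ e → ℕ.<⇒≢ (s≤s j≤n′) (sym e)))) (ℤ.+-identityʳ x)
    ... | inj₂ refl = trans (∑-last n _ (λ k _ k<j → when-no (k ℕ.≟ suc n) (ℕ.<⇒≢ k<j))) (when-yes (suc n ℕ.≟ suc n) refl)

  module _ (m : ℕ) (1≤m : 1 ≤ m) where
    private
      D : ∀ e → Dec (e ∣ m × ¬ p ∣ e)
      D = coprimeDivisor? p p-prime m

      block : ∀ e → Dec (e ∣ m × ¬ p ∣ e) → List MonicPoly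
      block e (yes _) = map (p ℕ.* (m /′ e) ,_) (invariants (p ℕ.* (m /′ e)))
      block e (no _)  = []

      -- Stage k collects the invariant polynomials of degree p m / e for the admissible e ≤ k;
      -- stage m is the common supply from which the factors of all p - 1 Artin-Schreier polynomials
      -- are drawn.
      candidatesUpTo : ℕ → List MonicPoly
      candidatesUpTo zero    = []
      candidatesUpTo (suc k) = block (suc k) (D (suc k)) ++ candidatesUpTo k

      U : List MonicPoly
      U = candidatesUpTo m

      In : MonicPoly → ℕ → Set
      In (d , v) e = 1 ≤ e × e ∣ m × ¬ p ∣ e × d ≡ p ℕ.* (m /′ e) × TranslationInvariant d v

      block⁻ : ∀ e D? {x} → 1 ≤ e → x ∈ block e D? → In x e
      block⁻ e (yes (e∣m , p∤e)) 1≤e x∈ with v , v∈ , refl ← ∈-map⁻ (p ℕ.* (m /′ e) ,_) x∈ =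
        1≤e , e∣m , p∤e , refl , ∈-invariants⁻ v∈

      candidates⁻ : ∀ k {x} → x ∈ candidatesUpTo k → ∃ λ e → e ≤ k × In x e
      candidates⁻ (suc k) x∈ with ∈-++⁻ (block (suc k) (D (suc k))) x∈
      ... | inj₁ x∈ˡ = suc k , ℕ.≤-refl , block⁻ (suc k) (D (suc k)) (s≤s z≤n) x∈ˡ
      ... | inj₂ x∈ʳ with e , e≤k , h ← candidates⁻ k x∈ʳ = e , ℕ.m≤n⇒m≤1+n e≤k , h

      block⁺ : ∀ e D? {x} → In x e → x ∈ block e D?
      block⁺ e (no ¬D) (_ , e∣m , p∤e , _) = contradiction (e∣m , p∤e) ¬D
      block⁺ e (yes _) (_ , _ , _ , refl , j) = ∈-map⁺ (p ℕ.* (m /′ e) ,_) (∈-invariants⁺ j)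

      candidates⁺ : ∀ k {e x} → e ≤ k → In x e → x ∈ candidatesUpTo k
      candidates⁺ zero e≤0 (1≤e , _) = contradiction (ℕ.≤-trans 1≤e e≤0) λ ()
      candidates⁺ (suc k) e≤ h with ℕ.m≤n⇒m<n∨m≡n e≤
      ... | inj₁ (s≤s e≤k) = ∈-++⁺ʳ (block (suc k) (D (suc k))) (candidates⁺ k e≤k h)
      ... | inj₂ refl = ∈-++⁺ˡ (block⁺ (suc k) (D (suc k)) h)

      m≡e*m/e : ∀ e → 1 ≤ e → e ∣ m → m ≡ e ℕ.* (m /′ e)
      m≡e*m/e e@(suc _) _ (divides t refl) = trans (ℕ.*-comm t e) (cong (e ℕ.*_) (sym (trans (cong (_/′ e) (ℕ.*-comm t e)) (*-/′ e t))))

      -- The degree p (m / e) determines m / e and hence e, so no polynomial lies in two blocks.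
      In-unique : ∀ {x e e′} → In x e → In x e′ → e ≡ e′
      In-unique {x} {e} {e′} (1≤e , e∣m , _ , d≡ , _) (1≤e′ , e′∣m , _ , d≡′ , _) =
        ℕ.*-cancelʳ-≡ e e′ (m /′ e) {{nonZero}}
          (trans (sym (m≡e*m/e e 1≤e e∣m)) (trans (m≡e*m/e e′ 1≤e′ e′∣m) (cong (e′ ℕ.*_) (sym same))))
        where
        same : m /′ e ≡ m /′ e′
        same = ℕ.*-cancelˡ-≡ (m /′ e) (m /′ e′) p (trans (sym d≡) d≡′)
        nonZero : NonZero (m /′ e)
        nonZero = ℕ.m*n≢0⇒n≢0 e {{subst NonZero (m≡e*m/e e 1≤e e∣m) (ℕ.>-nonZero 1≤m)}}

      block-unique : ∀ e D? → Unique (block e D?)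
      block-unique e (yes _) = Unique.map⁺ (λ { refl → refl }) (invariants-unique _)
      block-unique e (no _)  = []

      candidates-unique′ : ∀ k → Unique (candidatesUpTo k)
      candidates-unique′ zero    = []
      candidates-unique′ (suc k) = Unique.++⁺ (block-unique (suc k) (D (suc k))) (candidates-unique′ k)
        λ { (x∈ˡ , x∈ʳ) → disjoint (block⁻ (suc k) (D (suc k)) (s≤s z≤n) x∈ˡ) (candidates⁻ k x∈ʳ) }
        where
        disjoint : ∀ {x} → In x (suc k) → ¬ (∃ λ e → e ≤ k × In x e)
        disjoint {x} h (e , e≤k , h′) = ℕ.<-irrefl (In-unique {x} h′ h) (s≤s e≤k)

      a : ℕ → ℤ
      a d = + (p ℕ.* d ℕ.* length (invariants (p ℕ.* d)))

      ∑ᴸ-map-degree : ∀ d (vs : List (Vec Carrier d)) → ∑ᴸ (map (λ v → (d , v)) vs) degree ≡ + (d ℕ.* length vs)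
      ∑ᴸ-map-degree d []       = cong +_ (sym (ℕ.*-zeroʳ d))
      ∑ᴸ-map-degree d (v ∷ vs) = trans (cong (+ d +ℤ_) (∑ᴸ-map-degree d vs)) (cong +_ (sym (ℕ.*-suc d (length vs))))

      ∑-block : ∀ e D? → ∑ᴸ (block e D?) degree ≡ when D? (a (m /′ e))
      ∑-block e (yes _) = ∑ᴸ-map-degree (p ℕ.* (m /′ e)) (invariants (p ℕ.* (m /′ e)))
      ∑-block e (no _)  = refl

      ∑-candidates : ∀ k → ∑ᴸ (candidatesUpTo k) degree ≡ ∑ k (λ e → when (coprimeDivisor? p p-prime m e) (a (m /′ e)))
      ∑-candidates zero    = refl
      ∑-candidates (suc k) = trans (∑ᴸ-++ (block (suc k) (D (suc k))) (candidatesUpTo k) degree)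
        (trans (ℤ.+-comm (∑ᴸ (block (suc k) (D (suc k))) degree) _) (cong₂ _+ℤ_ (∑-candidates k) (∑-block (suc k) (D (suc k)))))

      Factor : ℕ → MonicPoly → Set
      Factor j (d , v) = monic v ∣ₚ artinSchreier m (ι j)

      factor? : ∀ j x → Dec (Factor j x)
      factor? j (d , v) = divides? (monic-monic v) (artinSchreier m (ι j))

      <p : ∀ {j} → j ≤ p ℕ.∸ 1 → j < p
      <p j≤ = ℕ.≤-trans (s≤s j≤) (ℕ.≤-reflexive (ℕ.m+[n∸m]≡n {1} (ℕ.>-nonZero⁻¹ p)))

      -- By `factor⇒` every irreducible factor of the polynomial for j already lies in `U`, so
      -- filtering `U` gives a complete list of factors, to which `factorDegrees` applies.
      degreesOfFactors : ∀ j → 1 ≤ j → j ≤ p ℕ.∸ 1 → ∑ᴸ U (λ x → when (factor? j x) (degree x)) ≡ + (q ℕ.^ m)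
      degreesOfFactors j 1≤j j≤ = trans (sym (∑ᴸ-filter (factor? j) U degree))
        (factorDegrees (filter (factor? j) U) (monic-artinSchreier m (ι j) 1≤m)
          (λ v iv → artinSchreier-squareFree (monic-monic v) (irreducible-degree (monic-monic v) iv) m (ι j) 1≤m)
          (Unique.filter⁺ (factor? j) (candidates-unique′ m))
          sound complete)
        where
        sound : ∀ {x} → x ∈ filter (factor? j) U → Irreducible (monic (proj₂ x)) × monic (proj₂ x) ∣ₚ artinSchreier m (ι j)
        sound x∈ with x∈U , f∣ ← ∈-filter⁻ (factor? j) {xs = U} x∈ with _ , _ , _ , _ , _ , _ , (irr , _) ← candidates⁻ m x∈U = irr , f∣
        complete : ∀ {d} (v : Vec Carrier d) → Irreducible (monic v) → monic v ∣ₚ artinSchreier m (ι j) → (d , v) ∈ filter (factor? j) U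
        complete {n} v irr f∣ = ∈-filter⁺ (factor? j) (go (Translations.factor⇒ (monic-monic v) irr m j (∤-of-< 1≤j (<p j≤)) f∣)) f∣
          where
          go : Invariant 1# (monic v) × (∃₂ λ d e → n ≡ p ℕ.* d × m ≡ e ℕ.* d × ¬ p ∣ e) → (n , v) ∈ U
          go (inv , d , zero , _ , _ , p∤e) = contradiction (p ∣0) p∤e
          go (inv , d , e@(suc _) , n≡ , m≡ , p∤e) = candidates⁺ m (∣⇒≤ {{ℕ.>-nonZero 1≤m}} e∣m)
            (s≤s z≤n , e∣m , p∤e , trans n≡ (cong (p ℕ.*_) (sym (trans (cong (_/′ e) m≡) (*-/′ e d)))) , irr , inv)
            where
            e∣m : e ∣ m
            e∣m = divides d (trans m≡ (ℕ.*-comm e d))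

      -- `⇒factor` supplies an index j whose polynomial x divides, and `factor-unique` excludes a
      -- second one.
      oneFactor : ∀ {x} → x ∈ U → ∑ (p ℕ.∸ 1) (λ j → when (factor? j x) (degree x)) ≡ degree x
      oneFactor {d , v} x∈ = start (candidates⁻ m x∈)
        where
        start : (∃ λ e → e ≤ m × In (d , v) e) → _
        start (e , _ , 1≤e , e∣m , p∤e , d≡ , irr , inv) = go (⇒factor inv (m /′ e) e d≡ p∤e)
          where
          open Translations (monic-monic v) irr
          go : (∃ λ j → 1 ≤ j × j < p × monic v ∣ₚ artinSchreier (e ℕ.* (m /′ e)) (ι j)) → _
          go (j , 1≤j , j<p , f∣) = ∑-single (p ℕ.∸ 1) j (λ j → factor? j (d , v)) (degree (d , v)) 1≤j (ℕ.<⇒≤pred j<p) f∣m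
            (λ k 1≤k k≤ f∣k → factor-unique m (<p k≤) j<p f∣k f∣m)
            where
            f∣m : monic v ∣ₚ artinSchreier m (ι j)
            f∣m = subst (λ z → monic v ∣ₚ artinSchreier z (ι j)) (sym (m≡e*m/e e 1≤e e∣m)) f∣

    -- Double counting, weighted by degree, of the pairs of an index j and a polynomial in `U`
    -- dividing the Artin-Schreier polynomial for j: each polynomial has one index, each index has
    -- total degree q^m.
    invariantDegreeSum : ∑ m (λ e → when (coprimeDivisor? p p-prime m e) (+ (p ℕ.* (m /′ e) ℕ.* length (invariants (p ℕ.* (m /′ e))))))
      ≡ + (p ℕ.∸ 1) *ℤ + (q ℕ.^ m)
    invariantDegreeSum = begin
      ∑ m (λ e → when (coprimeDivisor? p p-prime m e) (a (m /′ e)))  ≡⟨ ∑-candidates m ⟨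
      ∑ᴸ U degree  ≡⟨ ∑ᴸ-cong U oneFactor ⟨
      ∑ᴸ U (λ x → ∑ (p ℕ.∸ 1) (λ j → when (factor? j x) (degree x)))  ≡⟨ ∑-∑ᴸ-swap (p ℕ.∸ 1) U _ ⟨
      ∑ (p ℕ.∸ 1) (λ j → ∑ᴸ U (λ x → when (factor? j x) (degree x)))  ≡⟨ ∑-cong (p ℕ.∸ 1) degreesOfFactors ⟩
      ∑ (p ℕ.∸ 1) (λ _ → + (q ℕ.^ m))  ≡⟨ ∑-const (p ℕ.∸ 1) _ ⟩
      + (p ℕ.∸ 1) *ℤ + (q ℕ.^ m)  ∎
      where open ≡-Reasoning

  -- Möbius inversion of d ↦ p d N(p d) against (p - 1) q^d. The factor p m stays on the left, so
  -- that no division of integers occurs.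
  countInvariants : ∀ m → 1 ≤ m → + (p ℕ.* m ℕ.* length (invariants (p ℕ.* m))) ≡ + (p ℕ.∸ 1) *ℤ divisorSum q p m
  countInvariants m 1≤m = begin
    + (p ℕ.* m ℕ.* length (invariants (p ℕ.* m)))
      ≡⟨ moebiusInversion p p-prime (λ d → + (p ℕ.* d ℕ.* length (invariants (p ℕ.* d)))) (λ m → + (p ℕ.∸ 1) *ℤ + (q ℕ.^ m)) invariantDegreeSum m 1≤m ⟩
    ∑ m (λ e → when (coprimeDivisor? p p-prime m e) (+ (p ℕ.∸ 1) *ℤ + (q ℕ.^ (m /′ e)) *ℤ μ e))
      ≡⟨ ∑-cong m (λ e _ _ → trans (cong (when (coprimeDivisor? p p-prime m e)) (ℤ.*-assoc (+ (p ℕ.∸ 1)) (+ (q ℕ.^ (m /′ e))) (μ e)))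
           (sym (when-*ˡ (coprimeDivisor? p p-prime m e) (+ (p ℕ.∸ 1)) _))) ⟩
    ∑ m (λ e → + (p ℕ.∸ 1) *ℤ when (coprimeDivisor? p p-prime m e) (+ (q ℕ.^ (m /′ e)) *ℤ μ e))
      ≡⟨ ∑-*ˡ m (+ (p ℕ.∸ 1)) _ ⟨
    + (p ℕ.∸ 1) *ℤ ∑ m (λ e → when (coprimeDivisor? p p-prime m e) (+ (q ℕ.^ (m /′ e)) *ℤ μ e))
      ≡⟨ cong (+ (p ℕ.∸ 1) *ℤ_) (divisorSum≡∑ p p-prime q m) ⟨
    + (p ℕ.∸ 1) *ℤ divisorSum q p m ∎
    where open ≡-Reasoning

-- The action of matrices on polynomials by substitution

module Action (K : FiniteField) where
  open Ring
  open Polynomial K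
  open Degree K
  open Algebras K
  open Irreducibility K
  open Galois K using (Invariant)
  open import Data.Vec using (Vec)
  open import Relation.Binary.Definitions using (tri<; tri≈; tri>)
  open import Relation.Binary.PropositionalEquality
  open 𝕂[X]-ev using (hom; hom-cong; hom-congʳ; hom-⊕; hom-κ⊗; hom-⊗; hom-⊗^; hom-pad; hom-linear; hom-1)
  open RingSolver 𝕂[X]

  private
    actTerm : (a b c d : Carrier) → ℕ → Poly → ℕ → Poly
    actTerm a b c d n f i = scale (coeff f i) (((b ∷ a ∷ []) ^ₚ i) *ₚ ((d ∷ c ∷ []) ^ₚ (n ℕ.∸ i)))

    sumₚ : (ℕ → Poly) → ℕ → Poly
    sumₚ t zero    = t zero
    sumₚ t (suc i) = t (suc i) +ₚ sumₚ t i

    sumₚ-unique : ∀ t (s : ℕ → Poly) → s 0 ≡ t 0 → (∀ i → s (suc i) ≡ t (suc i) +ₚ s i) → ∀ i → s i ≡ sumₚ t i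
    sumₚ-unique t s base step zero    = base
    sumₚ-unique t s base step (suc i) = trans (step i) (cong (t (suc i) +ₚ_) (sumₚ-unique t s base step i))

    -- A name for the local recursion of act, found by unification: abstracting over suc n
    -- separates the degree from the summation bound.
    mutual
      actSum : (a b c d : Carrier) → ℕ → Poly → ℕ → Poly
      actSum = _

      act-suc : ∀ a b c d n f → act (mat a b c d) (suc n) f ≡ actTerm a b c d (suc n) f (suc n) +ₚ actSum a b c d (suc n) f n
      act-suc a b c d n f with suc n
      ... | N = refl

    actSum≡sumₚ : ∀ a b c d n f i → actSum a b c d n f i ≡ sumₚ (actTerm a b c d n f) i
    actSum≡sumₚ a b c d n f = sumₚ-unique (actTerm a b c d n f) (actSum a b c d n f) refl (λ _ → refl)

    ^ₚ≡⊗^ : ∀ f n → f ^ₚ n ≡ f ⊗^ n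
    ^ₚ≡⊗^ f zero    = refl
    ^ₚ≡⊗^ f (suc n) = trans (cong (f *ₚ_) (^ₚ≡⊗^ f n)) (sym (⊗≡*ₚ f (f ⊗^ n)))

    module _ (a b c d : Carrier) where
      private
        u v : Poly
        u = b ∷ a ∷ []
        v = d ∷ c ∷ []

      term : ℕ → Poly → ℕ → Poly
      term = actTerm a b c d

      term≋ : ∀ n f i → term n f i ≋ κ (coeff f i) ⊗ (u ⊗^ i ⊗ v ⊗^ (n ℕ.∸ i))
      term≋ n f i = ≋-trans (scale≋κ⊗ (coeff f i) _) (⊗-cong ≋-refl (≋-reflexive
        (trans (cong₂ _*ₚ_ (^ₚ≡⊗^ u i) (^ₚ≡⊗^ v (n ℕ.∸ i))) (sym (⊗≡*ₚ _ _)))))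

      term-zero : ∀ n f → term n f 0 ≋ κ (coeff f 0) ⊗ v ⊗^ n
      term-zero n f = ≋-trans (term≋ n f 0) (⊗-cong ≋-refl (𝕂[X].*-identityˡ _))

      term-suc : ∀ n f i → term (suc n) f (suc i) ≋ u ⊗ term n (shift f) i
      term-suc n f i = ≋-trans (term≋ (suc n) f (suc i)) (≋-trans
        (solve 4 (λ k u x y → k :* ((u :* x) :* y) := u :* (k :* (x :* y))) ≋-refl (κ (coeff f (suc i))) u (u ⊗^ i) (v ⊗^ (n ℕ.∸ i)))
        (⊗-cong ≋-refl (≋-trans (⊗-cong (κ-cong (sym (coeff-shift f i))) ≋-refl) (≋-sym (term≋ n (shift f) i)))))

      -- The sum in `act` runs down from the top index, while `hom` recurses from the constant term;
      -- splitting off the term of index 0 reconciles them.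
      sumₚ-suc : ∀ n f j → sumₚ (term (suc n) f) (suc j) ≋ κ (coeff f 0) ⊗ v ⊗^ suc n ⊕ u ⊗ sumₚ (term n (shift f)) j
      sumₚ-suc n f zero = ≋-trans (≋-reflexive (sym (⊕≡+ₚ (term (suc n) f 1) (term (suc n) f 0))))
        (≋-trans (𝕂[X].+-cong (term-suc n f 0) (term-zero (suc n) f)) (𝕂[X].+-comm _ _))
      sumₚ-suc n f (suc j) = ≋-trans (≋-reflexive (sym (⊕≡+ₚ (term (suc n) f (2 ℕ.+ j)) _)))
        (≋-trans (𝕂[X].+-cong (term-suc n f (suc j)) (sumₚ-suc n f j))
        (≋-trans (solve 4 (λ u t k s → u :* t :+ (k :+ u :* s) := k :+ u :* (t :+ s)) ≋-refl u (term n (shift f) (suc j)) (κ (coeff f 0) ⊗ v ⊗^ suc n) (sumₚ (term n (shift f)) j))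
          (𝕂[X].+-congˡ (⊗-cong ≋-refl (≋-reflexive (⊕≡+ₚ (term n (shift f) (suc j)) _))))))

      sumₚ≋hom : ∀ n f → sumₚ (term n f) n ≋ hom u v n f
      sumₚ≋hom zero    f = ≋-trans (term-zero 0 f) (𝕂[X].*-identityʳ _)
      sumₚ≋hom (suc n) f = ≋-trans (sumₚ-suc n f n) (𝕂[X].+-congˡ (⊗-cong ≋-refl (sumₚ≋hom n (shift f))))

  infixl 7 _⋆[_]_
  _⋆[_]_ : Mat2 → ℕ → Poly → Poly
  mat a b c d ⋆[ n ] f = hom (b ∷ a ∷ []) (d ∷ c ∷ []) n f

  act≋⋆ : ∀ A n f → act A n f ≋ A ⋆[ n ] f
  act≋⋆ (mat a b c d) n f = ≋-trans (≋-reflexive (actSum≡sumₚ a b c d n f n)) (sumₚ≋hom a b c d n f)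

  below-linear : ∀ a b → Below (b ∷ a ∷ []) 2
  below-linear a b .vanish (suc (suc i)) _ = refl
  below-linear a b .vanish (suc zero) (s≤s ())

  linear≋ : ∀ a b → b ∷ a ∷ [] ≋ κ a ⊗ X ⊕ κ b
  linear≋ a b = ≋-trans (∷≋ b (κ a)) (≋-trans (𝕂[X].+-comm _ _) (𝕂[X].+-congʳ (⊗-comm X (κ a))))

  below-hom : ∀ {u v} → Below u 2 → Below v 2 → ∀ n f → Below (hom u v n f) (suc n)
  below-hom bu bv zero f = below-κ
  below-hom {u} {v} bu bv (suc n) f = below-⊕ (below-⊗ (κ (coeff f 0)) (v ⊗^ suc n) 0 (2 ℕ.+ n) below-κ (below-⊗^ (suc n) bv))
    (below-⊗ u _ 1 (suc n) bu (below-hom bu bv n (shift f)))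

  below-⋆ : ∀ A n f → Below (A ⋆[ n ] f) (suc n)
  below-⋆ (mat a b c d) = below-hom (below-linear a b) (below-linear c d)

  -- Forms are multiplicative, so substituting into the expanded form amounts to substituting into
  -- its linear forms first. This is the composition rule behind `⋆-·`.
  hom-hom : ∀ u v {u′ v′} → Below u′ 2 → Below v′ 2 → ∀ n f →
    hom u v n (hom u′ v′ n f) ≋ hom (hom u v 1 u′) (hom u v 1 v′) n f
  hom-hom u v bu bv zero f = ≋-refl
  hom-hom u v {u′} {v′} bu bv (suc n) f = ≋-trans (hom-⊕ u v (suc n) _ _) (𝕂[X].+-cong
    (≋-trans (hom-κ⊗ u v (suc n) (coeff f 0) (v′ ⊗^ suc n)) (⊗-cong ≋-refl (hom-⊗^ u v (suc n) v′ bv)))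
    (≋-trans (hom-⊗ u v 1 n u′ _ bu (below-hom bu bv n (shift f))) (⊗-cong ≋-refl (hom-hom u v bu bv n (shift f)))))

  ⋆-congʳ : ∀ A n {f g} → f ≋ g → A ⋆[ n ] f ≋ A ⋆[ n ] g
  ⋆-congʳ (mat a b c d) n = hom-congʳ _ _ n

  ⋆-κ⊗ : ∀ A n k f → A ⋆[ n ] (κ k ⊗ f) ≋ κ k ⊗ (A ⋆[ n ] f)
  ⋆-κ⊗ (mat a b c d) n k f = hom-κ⊗ _ _ n k f

  ⋆-⊗ : ∀ A m n f g → Below f (suc m) → Below g (suc n) → A ⋆[ m ℕ.+ n ] (f ⊗ g) ≋ A ⋆[ m ] f ⊗ (A ⋆[ n ] g)
  ⋆-⊗ (mat a b c d) = hom-⊗ _ _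

  -- Substitution reverses the order: the result of the inner action of B is evaluated at the
  -- fraction given by A. This is why conjugation enters later as the equation P T = A P.
  ⋆-· : ∀ A B n f → A ⋆[ n ] (B ⋆[ n ] f) ≋ (B · A) ⋆[ n ] f
  ⋆-· (mat a b c d) (mat a′ b′ c′ d′) n f = ≋-trans (hom-hom _ _ (below-linear a′ b′) (below-linear c′ d′) n f)
    (hom-cong n (row a′ b′) (row c′ d′) ≋-refl)
    where
    row : ∀ x y → hom (b ∷ a ∷ []) (d ∷ c ∷ []) 1 (y ∷ x ∷ []) ≋ (x * b + y * d) ∷ (x * a + y * c) ∷ []
    row x y = ≋-trans (hom-linear _ _ x y) (≋-trans
      (𝕂[X].+-cong (⊗-cong ≋-refl (linear≋ a b)) (⊗-cong ≋-refl (linear≋ c d)))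
      (≋-trans (solve 7 (λ x y a b c d t → x :* (a :* t :+ b) :+ y :* (c :* t :+ d) := (x :* a :+ y :* c) :* t :+ (x :* b :+ y :* d))
        ≋-refl (κ x) (κ y) (κ a) (κ b) (κ c) (κ d) X)
      (≋-trans (𝕂[X].+-cong (⊗-cong (combine x a y c) ≋-refl) (combine x b y d)) (≋-sym (linear≋ _ _)))))
      where
      combine : ∀ x a y c → κ x ⊗ κ a ⊕ κ y ⊗ κ c ≋ κ (x * a + y * c)
      combine x a y c = ≋-sym (≋-trans (κ-+ _ _) (𝕂[X].+-cong (κ-* x a) (κ-* y c)))

  translation : Carrier → Mat2
  translation t = mat 1# t 0# 1#

  ⋆-translation : ∀ t n {f} → Below f (suc n) → translation t ⋆[ n ] f ≋ 𝕂[X]-ev.ev f (X ⊕ κ t)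
  ⋆-translation t n {f} b = ≋-trans (hom-cong n
      (≋-trans (linear≋ 1# t) (𝕂[X].+-congʳ (𝕂[X].*-identityˡ X)))
      (≋-trans (linear≋ 0# 1#) (≋-trans (𝕂[X].+-congʳ (⊗-cong κ-0 ≋-refl)) (solve 2 (λ x y → :0 :* x :+ y := y) ≋-refl X (κ 1#))))
      ≋-refl)
    (hom-1 (X ⊕ κ t) n f b)

  ⋆-I : ∀ n {f} → Below f (suc n) → I₂ ⋆[ n ] f ≋ f
  ⋆-I n {f} b = ≋-trans (⋆-translation 0# n b) (≋-trans
    (𝕂[X]-ev.ev-congʳ f (≋-trans (𝕂[X].+-congˡ κ-0) (𝕂[X].+-identityʳ X))) (ev-X≋ f))

  degree-unique : ∀ {f m n} → coeff f m ≢ 0# → Below f (suc m) → coeff f n ≢ 0# → Below f (suc n) → m ≡ n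
  degree-unique {f} {m} {n} lm bm ln bn with ℕ.<-cmp m n
  ... | tri< m<n _ _ = contradiction (vanish bm n m<n) ln
  ... | tri≈ _ m≡n _ = m≡n
  ... | tri> _ _ n<m = contradiction (vanish bn m n<m) lm

  irreducible-κ⊗ : ∀ {c f} → c ≢ 0# → Irreducible f → Irreducible (κ c ⊗ f)
  irreducible-κ⊗ {c} {f} c≢0 irr = mkIrreducible
    (λ b → proj₁ irr (vanish (below-resp (cancel f) (below-κ⊗ b))))
    (λ g h e → undo (irreducible-split irr (≋-trans (≋-sym (cancel f)) (≋-trans (⊗-cong ≋-refl e) (≋-sym (⊗-assoc (κ (c ⁻¹)) g h))))))
    where
    cancel : ∀ g → κ (c ⁻¹) ⊗ (κ c ⊗ g) ≋ g
    cancel g = ≋-trans (≋-sym (⊗-assoc (κ (c ⁻¹)) (κ c) g)) (≋-trans (⊗-cong (≋-trans (≋-sym (κ-* _ _)) (κ-cong (*-inverseˡ c≢0))) ≋-refl) (𝕂[X].*-identityˡ g))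
    below-κ⊗ : ∀ {k g n} → Below g n → Below (κ k ⊗ g) n
    below-κ⊗ {k} {g} {n} b = below-⊗ (κ k) g 0 n below-κ b
    undo : ∀ {g h} → Below (κ (c ⁻¹) ⊗ g) 1 ⊎ Below h 1 → Below g 1 ⊎ Below h 1
    undo (inj₂ b) = inj₂ b
    undo {g} (inj₁ b) = inj₁ (below-resp (≋-trans (solve 3 (λ a b g → a :* (b :* g) := b :* (a :* g)) ≋-refl (κ c) (κ (c ⁻¹)) g) (cancel g)) (below-κ⊗ {c} b))

  module Transform {P P′ : Mat2} (PP′≡I : P · P′ ≡ I₂) {n : ℕ} (2≤n : 2 ≤ n)
    {f : Poly} (f-monic : Monic n f) (f-irr : Irreducible f) where

    private
      g : Poly
      g = P ⋆[ n ] f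

      undo : P′ ⋆[ n ] g ≋ f
      undo = ≋-trans (⋆-· P′ P n f) (≋-trans (≋-reflexive (cong (_⋆[ n ] f) PP′≡I)) (⋆-I n (below f-monic)))

      top≢0 : ∀ {m} → m ≤ n → ¬ Below f m
      top≢0 m≤n b = 0≢1 (trans (sym (vanish b n m≤n)) (lead f-monic))

    -- If the degree dropped, transforming back in degree n would split the denominator of P′ off f.
    -- Irreducibility makes one factor constant, which is impossible: a constant denominator leaves
    -- f of degree below n, a constant cofactor leaves degree at most 1, against n ≥ 2.
    ⋆-lead : coeff g n ≢ 0#
    ⋆-lead gn≡0 = go n refl 2≤n
      where
      small : Below g n
      small .vanish i n≤i with ℕ.m≤n⇒m<n∨m≡n n≤i
      ... | inj₁ n<i  = vanish (below-⋆ P n f) i n<i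
      ... | inj₂ refl = gn≡0
      second : Mat2 → Poly
      second (mat a b c d) = d ∷ c ∷ []
      pad : ∀ A k h → Below h (suc k) → A ⋆[ suc k ] h ≋ second A ⊗ (A ⋆[ k ] h)
      pad (mat a b c d) k h small = hom-pad _ _ k h small
      below-second : ∀ A → Below (second A) 2
      below-second (mat a b c d) = below-linear c d
      go : ∀ k → k ≡ n → ¬ 2 ≤ k
      go (suc k) refl 2≤k = absurd (irreducible-split f-irr f≋)
        where
        f≋ : f ≋ second P′ ⊗ (P′ ⋆[ k ] g)
        f≋ = ≋-trans (≋-sym undo) (pad P′ k g small)
        absurd : ¬ (Below (second P′) 1 ⊎ Below (P′ ⋆[ k ] g) 1)
        absurd (inj₁ b) = top≢0 ℕ.≤-refl (below-resp (≋-sym f≋) (below-⊗ _ _ 0 (suc k) b (below-⋆ P′ k g)))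
        absurd (inj₂ b) = top≢0 2≤k (below-resp (≋-sym f≋) (below-⊗ _ _ 1 1 (below-second P′) b))

    -- Nonconstant factors of g, of degrees e₁ + e₂ = n, go back to factors of f of degrees at most
    -- e₁ and e₂. If one of these were constant, f would have degree below n.
    ⋆-irreducible : Irreducible g
    ⋆-irreducible = mkIrreducible (λ b → ⋆-lead (vanish b n (ℕ.≤-trans (s≤s z≤n) 2≤n))) split
      where
      split : ∀ g₁ g₂ → g ≋ g₁ ⊗ g₂ → Below g₁ 1 ⊎ Below g₂ 1
      split g₁ g₂ g≋ = go (zero⊎degree g₁) (zero⊎degree g₂)
        where
        go : (g₁ ≋ [] ⊎ ∃ λ e → coeff g₁ e ≢ 0# × Below g₁ (suc e)) → (g₂ ≋ [] ⊎ ∃ λ e → coeff g₂ e ≢ 0# × Below g₂ (suc e)) →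
          Below g₁ 1 ⊎ Below g₂ 1
        go (inj₁ z) _ = inj₁ (below-resp (≋-sym z) (mkBelow (λ _ _ → refl)))
        go (inj₂ _) (inj₁ z) = inj₂ (below-resp (≋-sym z) (mkBelow (λ _ _ → refl)))
        go (inj₂ (zero , _ , b₁)) _ = inj₁ b₁
        go _ (inj₂ (zero , _ , b₂)) = inj₂ b₂
        go (inj₂ (e₁@(suc _) , l₁ , b₁)) (inj₂ (e₂@(suc _) , l₂ , b₂)) = absurd (irreducible-split f-irr f≋)
          where
          e₁+e₂≡n : e₁ ℕ.+ e₂ ≡ n
          e₁+e₂≡n = degree-unique {g}
            (λ z → *-≢0 l₁ l₂ (trans (sym (coeff-⊗-top g₁ g₂ e₁ e₂ b₁ b₂)) (trans (sym (coeffs g≋ _)) z)))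
            (below-resp (≋-sym g≋) (subst (Below (g₁ ⊗ g₂)) (ℕ.+-suc e₁ e₂) (below-⊗ g₁ g₂ e₁ (suc e₂) b₁ b₂)))
            ⋆-lead (below-⋆ P n f)
          f≋ : f ≋ P′ ⋆[ e₁ ] g₁ ⊗ (P′ ⋆[ e₂ ] g₂)
          f≋ = ≋-trans (≋-sym undo) (≋-trans (⋆-congʳ P′ n g≋) (≋-trans
            (≋-reflexive (cong (λ z → P′ ⋆[ z ] (g₁ ⊗ g₂)) (sym e₁+e₂≡n))) (⋆-⊗ P′ e₁ e₂ g₁ g₂ b₁ b₂)))
          absurd : Below (P′ ⋆[ e₁ ] g₁) 1 ⊎ Below (P′ ⋆[ e₂ ] g₂) 1 → Below g₁ 1 ⊎ Below g₂ 1
          absurd (inj₁ b) = contradiction (below-resp (≋-sym f≋) (below-⊗ _ _ 0 (suc e₂) b (below-⋆ P′ e₂ g₂)))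
            (top≢0 (ℕ.≤-trans (ℕ.+-monoˡ-≤ e₂ (s≤s z≤n)) (ℕ.≤-reflexive e₁+e₂≡n)))
          absurd (inj₂ b) = contradiction (below-resp (≋-sym f≋) (below-⊗ _ _ e₁ 1 (below-⋆ P′ e₁ g₁) b))
            (top≢0 (ℕ.≤-trans (ℕ.+-monoʳ-≤ e₁ (s≤s z≤n)) (ℕ.≤-reflexive e₁+e₂≡n)))

    scalar : Carrier
    scalar = coeff g n ⁻¹

    scalar≢0 : scalar ≢ 0#
    scalar≢0 = ⁻¹-≢0 ⋆-lead

    ⋆-monic : Monic n (κ scalar ⊗ g)
    ⋆-monic = normalise ⋆-lead (below-⋆ P n f)

    ⋆-monic-irreducible : Irreducible (κ scalar ⊗ g)
    ⋆-monic-irreducible = irreducible-κ⊗ scalar≢0 ⋆-irreducible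

  -- Substitution need not preserve the leading coefficient 1, so the result is divided by its
  -- leading coefficient to become monic again.
  transform : Mat2 → ∀ {n} → Vec Carrier n → Vec Carrier n
  transform P {n} v = low n (κ (coeff (P ⋆[ n ] monic v) n ⁻¹) ⊗ (P ⋆[ n ] monic v))

  module _ {P P′ : Mat2} (PP′≡I : P · P′ ≡ I₂) {n : ℕ} (2≤n : 2 ≤ n) (v : Vec Carrier n) (v-irr : Irreducible (monic v)) where
    open Transform PP′≡I 2≤n (monic-monic v) v-irr

    monic-transform : monic (transform P v) ≋ κ scalar ⊗ (P ⋆[ n ] monic v)
    monic-transform = monic-low ⋆-monic

    transform-irreducible : Irreducible (monic (transform P v))
    transform-irreducible = irreducible-resp (≋-sym monic-transform) ⋆-monic-irreducible

    -- Transforming the normalised polynomial back gives `scalar` times the original, with leading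
    -- coefficient `scalar`; the second normalisation cancels it.
    transform-inverse : transform P′ (transform P v) ≡ v
    transform-inverse = trans (low-cong n (≋-trans (⊗-cong ≋-refl back) (≋-trans (≋-sym (⊗-assoc _ _ _))
        (≋-trans (⊗-cong (≋-trans (≋-sym (κ-* _ _)) (κ-cong unit)) ≋-refl) (𝕂[X].*-identityˡ _)))))
      (low-monic v)
      where
      back : P′ ⋆[ n ] monic (transform P v) ≋ κ scalar ⊗ monic v
      back = ≋-trans (⋆-congʳ P′ n monic-transform) (≋-trans (⋆-κ⊗ P′ n scalar _) (⊗-cong ≋-refl
        (≋-trans (⋆-· P′ P n (monic v)) (≋-trans (≋-reflexive (cong (_⋆[ n ] monic v) PP′≡I)) (⋆-I n (below (monic-monic v)))))))
      top : coeff (P′ ⋆[ n ] monic (transform P v)) n ≡ scalar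
      top = trans (coeffs back n) (trans (coeff-κ⊗ scalar (monic v) n) (trans (cong (scalar *_) (lead (monic-monic v))) (𝕂.*-identityʳ scalar)))
      unit : coeff (P′ ⋆[ n ] monic (transform P v)) n ⁻¹ * scalar ≡ 1#
      unit = trans (cong (λ z → z ⁻¹ * scalar) top) (*-inverseˡ scalar≢0)

    -- T ∘ (P ∘ f) = (P T) ∘ f = (A P) ∘ f = P ∘ (A ∘ f) = P ∘ f; the normalising scalar passes
    -- through by linearity.
    transform-fixed : ∀ {A T} → P · T ≡ A · P → A ⋆[ n ] monic v ≋ monic v →
      T ⋆[ n ] monic (transform P v) ≋ monic (transform P v)
    transform-fixed {A} {T} PT≡AP fixed = ≋-trans (⋆-congʳ T n monic-transform) (≋-trans (⋆-κ⊗ T n scalar _) (≋-trans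
      (⊗-cong ≋-refl (≋-trans (⋆-· T P n (monic v)) (≋-trans (≋-reflexive (cong (_⋆[ n ] monic v) PT≡AP))
        (≋-trans (≋-sym (⋆-· P A n (monic v))) (⋆-congʳ P n fixed)))))
      (≋-sym monic-transform)))

  translation-fixed⇒invariant : ∀ t {n} (v : Vec Carrier n) → translation t ⋆[ n ] monic v ≋ monic v → Invariant t (monic v)
  translation-fixed⇒invariant t {n} v e = ≋-trans (≋-sym (⋆-translation t n (below (monic-monic v)))) e

  invariant⇒translation-fixed : ∀ t {n} (v : Vec Carrier n) → Invariant t (monic v) → translation t ⋆[ n ] monic v ≋ monic v
  invariant⇒translation-fixed t {n} v e = ≋-trans (⋆-translation t n (below (monic-monic v))) e

-- Subgroups of order p^r in GL₂ as groups of translations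

module PSubgroups (K : FiniteField) (p : ℕ) (p-prime : Prime p) (char : Over.HasCharacteristic K p) where
  open Lists
  open Orbits
  open Polynomial K
  open Degree K
  open Algebras K
  open Action K using (translation)
  open Characteristic K p p-prime char
  open import Data.Nat.Divisibility
  open import Data.Nat.Primality using (prime⇒nonTrivial)
  open import Data.List using (cartesianProduct)
  open import Data.List.Properties using (length-map; length-++)
  open import Data.List.Membership.Propositional.Properties using (∈-cartesianProduct⁺)
  open import Data.List.Relation.Unary.All as All using (All; []; _∷_)
  open import Data.List.Relation.Unary.AllPairs using ([]; _∷_)
  open import Data.List.Relation.Unary.Any using (here; there)
  import Data.List.Relation.Unary.Unique.Propositional.Properties as Unique
  open import Data.Product.Properties using (≡-dec)
  open import Function.Bundles using (_⇔_; Equivalence)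
  open import Relation.Binary.Definitions using (DecidableEquality)
  open import Relation.Binary.PropositionalEquality
  open import Relation.Nullary.Decidable using (map′; _×-dec_; decidable-stable)

  mat-cong : ∀ {a b c d a′ b′ c′ d′} → a ≡ a′ → b ≡ b′ → c ≡ c′ → d ≡ d′ → mat a b c d ≡ mat a′ b′ c′ d′
  mat-cong refl refl refl refl = refl

  private
    rowColumn-assoc : ∀ a b a′ b′ c′ d′ x y →
      (a * a′ + b * c′) * x + (a * b′ + b * d′) * y ≡ a * (a′ * x + b′ * y) + b * (c′ * x + d′ * y)
    rowColumn-assoc = solve𝕂 8 (λ a b a′ b′ c′ d′ x y →
      (a ⊡ a′ ⊞ b ⊡ c′) ⊡ x ⊞ (a ⊡ b′ ⊞ b ⊡ d′) ⊡ y ⊜ a ⊡ (a′ ⊡ x ⊞ b′ ⊡ y) ⊞ b ⊡ (c′ ⊡ x ⊞ d′ ⊡ y)) refl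

  ·-assoc : ∀ A B C → (A · B) · C ≡ A · (B · C)
  ·-assoc (mat a b c d) (mat a′ b′ c′ d′) (mat a″ b″ c″ d″) = mat-cong (entry a b a″ c″) (entry a b b″ d″) (entry c d a″ c″) (entry c d b″ d″)
    where
    entry : ∀ a b x y → _
    entry a b = rowColumn-assoc a b a′ b′ c′ d′

  ·-identityˡ : ∀ A → I₂ · A ≡ A
  ·-identityˡ (mat a b c d) = mat-cong (e₁ a c) (e₁ b d) (e₂ a c) (e₂ b d)
    where
    e₁ : ∀ x y → 1# * x + 0# * y ≡ x
    e₁ = solve𝕂 2 (λ x y → 𝟙 ⊡ x ⊞ 𝟘 ⊡ y ⊜ x) refl
    e₂ : ∀ x y → 0# * x + 1# * y ≡ y
    e₂ = solve𝕂 2 (λ x y → 𝟘 ⊡ x ⊞ 𝟙 ⊡ y ⊜ y) refl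

  ·-identityʳ : ∀ A → A · I₂ ≡ A
  ·-identityʳ (mat a b c d) = mat-cong (e₁ a b) (e₂ a b) (e₁ c d) (e₂ c d)
    where
    e₁ : ∀ x y → x * 1# + y * 0# ≡ x
    e₁ = solve𝕂 2 (λ x y → x ⊡ 𝟙 ⊞ y ⊡ 𝟘 ⊜ x) refl
    e₂ : ∀ x y → x * 0# + y * 1# ≡ y
    e₂ = solve𝕂 2 (λ x y → x ⊡ 𝟘 ⊞ y ⊡ 𝟙 ⊜ y) refl

  det-· : ∀ A B → det (A · B) ≡ det A * det B
  det-· (mat a b c d) (mat a′ b′ c′ d′) = solve𝕂 8 (λ a b c d a′ b′ c′ d′ →
    (a ⊡ a′ ⊞ b ⊡ c′) ⊡ (c ⊡ b′ ⊞ d ⊡ d′) ⊞ ⊟ ((a ⊡ b′ ⊞ b ⊡ d′) ⊡ (c ⊡ a′ ⊞ d ⊡ c′))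
      ⊜ (a ⊡ d ⊞ ⊟ (b ⊡ c)) ⊡ (a′ ⊡ d′ ⊞ ⊟ (b′ ⊡ c′))) refl a b c d a′ b′ c′ d′

  det-I : det I₂ ≡ 1#
  det-I = solve𝕂 0 (𝟙 ⊡ 𝟙 ⊞ ⊟ (𝟘 ⊡ 𝟘) ⊜ 𝟙) refl

  apply : Mat2 → Carrier × Carrier → Carrier × Carrier
  apply (mat a b c d) (x , y) = a * x + b * y , c * x + d * y

  apply-· : ∀ A B v → apply (A · B) v ≡ apply A (apply B v)
  apply-· (mat a b c d) (mat a′ b′ c′ d′) (x , y) =
    cong₂ _,_ (rowColumn-assoc a b a′ b′ c′ d′ x y) (rowColumn-assoc c d a′ b′ c′ d′ x y)

  apply-I : ∀ v → apply I₂ v ≡ v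
  apply-I (x , y) = cong₂ _,_ (solve𝕂 2 (λ x y → 𝟙 ⊡ x ⊞ 𝟘 ⊡ y ⊜ x) refl x y) (solve𝕂 2 (λ x y → 𝟘 ⊡ x ⊞ 𝟙 ⊡ y ⊜ y) refl x y)

  _≟ᴹ_ : DecidableEquality Mat2
  mat a b c d ≟ᴹ mat a′ b′ c′ d′ = map′ (λ (e₁ , e₂ , e₃ , e₄) → mat-cong e₁ e₂ e₃ e₄)
    (λ { refl → refl , refl , refl , refl }) ((a ≟ a′) ×-dec (b ≟ b′) ×-dec (c ≟ c′) ×-dec (d ≟ d′))

  -- The coefficient of X in (X + 1)^q = X^q + 1 is both q and 0.
  p∣q : p ∣ q
  p∣q = decidable-stable (p ∣? q) λ p∤q → ι≢0 q p∤q (begin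
    ι q  ≡⟨ proj₂ (binomial q) ⟨
    coeff ((X ⊕ κ 1#) ⊗^ q) 1  ≡⟨ coeffs [X+1]^q 1 ⟩
    coeff (X ⊗^ q ⊕ κ 1#) 1  ≡⟨ coeff-⊕ (X ⊗^ q) (κ 1#) 1 ⟩
    coeff (X ⊗^ q) 1 + 0#  ≡⟨ 𝕂.+-identityʳ _ ⟩
    coeff (X ⊗^ q) 1  ≡⟨ X^ 2≤q ⟩
    0#  ∎)
    where
    open ≡-Reasoning
    coeff-[X+1]⊗ : ∀ g i → coeff ((X ⊕ κ 1#) ⊗ g) (suc i) ≡ coeff g i + coeff g (suc i)
    coeff-[X+1]⊗ g i = trans (coeffs (⊗-distribʳ g X (κ 1#)) (suc i)) (trans (coeff-⊕ (X ⊗ g) (κ 1# ⊗ g) (suc i))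
      (cong₂ _+_ (sym (coeffs (0∷≋X⊗ g) (suc i))) (trans (coeff-κ⊗ 1# g (suc i)) (𝕂.*-identityˡ _))))
    coeff-[X+1]⊗-0 : ∀ g → coeff ((X ⊕ κ 1#) ⊗ g) 0 ≡ coeff g 0
    coeff-[X+1]⊗-0 g = trans (coeffs (⊗-distribʳ g X (κ 1#)) 0) (trans (coeff-⊕ (X ⊗ g) (κ 1# ⊗ g) 0)
      (trans (cong₂ _+_ (sym (coeffs (0∷≋X⊗ g) 0)) (trans (coeff-κ⊗ 1# g 0) (𝕂.*-identityˡ _))) (𝕂.+-identityˡ _)))
    binomial : ∀ n → coeff ((X ⊕ κ 1#) ⊗^ n) 0 ≡ 1# × coeff ((X ⊕ κ 1#) ⊗^ n) 1 ≡ ι n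
    binomial zero = refl , refl
    binomial (suc n) with c₀ , c₁ ← binomial n =
      trans (coeff-[X+1]⊗-0 _) c₀ , trans (coeff-[X+1]⊗ _ 0) (cong₂ _+_ c₀ c₁)
    X^ : ∀ {n} → 2 ≤ n → coeff (X ⊗^ n) 1 ≡ 0#
    X^ {suc (suc n)} _ = trans (sym (coeffs (0∷≋X⊗ (X ⊗ X ⊗^ n)) 1)) (sym (coeffs (0∷≋X⊗ (X ⊗^ n)) 0))
    X^ {suc zero} (s≤s ())

  vectors : List (Carrier × Carrier)
  vectors = cartesianProduct elements elements

  p∣vectors : p ∣ length vectors
  p∣vectors = subst (p ∣_) (sym (trans (go elements) (cong₂ ℕ._*_ length-elements length-elements))) (∣m⇒∣m*n q p∣q)
    where
    go : ∀ xs → length (cartesianProduct xs elements) ≡ length xs ℕ.* length elements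
    go []       = refl
    go (x ∷ xs) = trans (length-++ (map (x ,_) elements)) (cong₂ ℕ._+_ (length-map (x ,_) elements) (go xs))

  -- By Cramer's rule, the coordinate along (x , y) of the image of (u , w) in the basis (x , y), (u
  -- , w).
  shear : (x y u w : Carrier) → Mat2 → Carrier
  shear x y u w (mat a b c d) = (x * w + - (u * y)) ⁻¹ * (w * (a * u + b * w) + - (u * (c * u + d * w)))

  -- In the basis (x , y), (u , w), a matrix of determinant 1 fixing (x , y) is a translation.
  shear-conjugates : ∀ x y u w → x * w + - (u * y) ≢ 0# → ∀ A → apply A (x , y) ≡ (x , y) → det A ≡ 1# →
    A · mat x u y w ≡ mat x u y w · translation (shear x y u w A)
  shear-conjugates x y u w δ≢0 A@(mat a b c d) fixed det≡1 = mat-cong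
    (trans fx (solve𝕂 2 (λ x u → x ⊜ x ⊡ 𝟙 ⊞ u ⊡ 𝟘) refl x u))
    (sym (expand x u α (solve𝕂 6 (λ x y u w α β → x ⊡ (w ⊡ α ⊞ ⊟ (u ⊡ β)) ⊞ u ⊡ (x ⊡ β ⊞ ⊟ (y ⊡ α)) ⊜ (x ⊡ w ⊞ ⊟ (u ⊡ y)) ⊡ α) refl x y u w α β)))
    (trans fy (solve𝕂 2 (λ x u → x ⊜ x ⊡ 𝟙 ⊞ u ⊡ 𝟘) refl y w))
    (sym (expand y w β (solve𝕂 6 (λ x y u w α β → y ⊡ (w ⊡ α ⊞ ⊟ (u ⊡ β)) ⊞ w ⊡ (x ⊡ β ⊞ ⊟ (y ⊡ α)) ⊜ (x ⊡ w ⊞ ⊟ (u ⊡ y)) ⊡ β) refl x y u w α β)))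
    where
    open ≡-Reasoning
    fx : a * x + b * y ≡ x
    fx = cong proj₁ fixed
    fy : c * x + d * y ≡ y
    fy = cong proj₂ fixed
    α β δ : Carrier
    α = a * u + b * w
    β = c * u + d * w
    δ = x * w + - (u * y)
    -- The coordinate of the image of (u , w) along (u , w) is this expression over δ. As (x , y) is
    -- fixed, that coordinate is det A, hence 1.
    determinant : x * β + - (y * α) ≡ δ
    determinant = begin
      x * β + - (y * α)  ≡⟨ cong₂ (λ x y → x * β + - (y * α)) fx fy ⟨
      (a * x + b * y) * β + - ((c * x + d * y) * α)  ≡⟨ solve𝕂 8 (λ a b c d x y u w →
          (a ⊡ x ⊞ b ⊡ y) ⊡ (c ⊡ u ⊞ d ⊡ w) ⊞ ⊟ ((c ⊡ x ⊞ d ⊡ y) ⊡ (a ⊡ u ⊞ b ⊡ w)) ⊜ (a ⊡ d ⊞ ⊟ (b ⊡ c)) ⊡ (x ⊡ w ⊞ ⊟ (u ⊡ y)))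
          refl a b c d x y u w ⟩
      det A * δ  ≡⟨ cong (_* δ) det≡1 ⟩
      1# * δ  ≡⟨ 𝕂.*-identityˡ δ ⟩
      δ  ∎
    expand : ∀ s r γ → s * (w * α + - (u * β)) + r * (x * β + - (y * α)) ≡ δ * γ → s * shear x y u w A + r * 1# ≡ γ
    expand s r γ e = begin
      s * (δ ⁻¹ * (w * α + - (u * β))) + r * 1#  ≡⟨ cong (λ z → s * (δ ⁻¹ * (w * α + - (u * β))) + r * z) (*-inverseˡ δ≢0) ⟨
      s * (δ ⁻¹ * (w * α + - (u * β))) + r * (δ ⁻¹ * δ)  ≡⟨ solve𝕂 5 (λ s i m r δ → s ⊡ (i ⊡ m) ⊞ r ⊡ (i ⊡ δ) ⊜ i ⊡ (s ⊡ m ⊞ r ⊡ δ)) refl s (δ ⁻¹) _ r δ ⟩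
      δ ⁻¹ * (s * (w * α + - (u * β)) + r * δ)  ≡⟨ cong (λ z → δ ⁻¹ * (s * (w * α + - (u * β)) + r * z)) determinant ⟨
      δ ⁻¹ * (s * (w * α + - (u * β)) + r * (x * β + - (y * α)))  ≡⟨ cong (δ ⁻¹ *_) e ⟩
      δ ⁻¹ * (δ * γ)  ≡⟨ 𝕂.*-assoc _ _ _ ⟨
      δ ⁻¹ * δ * γ  ≡⟨ cong (_* γ) (*-inverseˡ δ≢0) ⟩
      1# * γ  ≡⟨ 𝕂.*-identityˡ γ ⟩
      γ  ∎

  module Subgroup (H : Mat2 → Set) (H-subgroup : IsSubgroupGL2 H) (r : ℕ) (1≤r : 1 ≤ r)
    (l : List Mat2) (l! : Unique l) (|l| : length l ≡ p ℕ.^ r) (H⇔∈l : ∀ A → H A ⇔ A ∈ l) where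
    open IsSubgroupGL2 H-subgroup

    private
      H⇒∈ : ∀ {A} → H A → A ∈ l
      H⇒∈ {A} = Equivalence.to (H⇔∈l A)
      ∈⇒H : ∀ {A} → A ∈ l → H A
      ∈⇒H {A} = Equivalence.from (H⇔∈l A)

      closed∈ : ∀ {A B} → A ∈ l → B ∈ l → (A · B) ∈ l
      closed∈ A∈ B∈ = H⇒∈ (closed _ _ (∈⇒H A∈) (∈⇒H B∈))

      inverse∈ : ∀ {A} → A ∈ l → ∃ λ B → B ∈ l × A · B ≡ I₂ × B · A ≡ I₂
      inverse∈ {A} A∈ with B , HB , e ← inv A (∈⇒H A∈) = B , H⇒∈ HB , e

      cancel∈ : ∀ {A B C} → A ∈ l → A · B ≡ A · C → B ≡ C
      cancel∈ {A} {B} {C} A∈ e with A′ , _ , _ , A′A ← inverse∈ A∈ = begin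
        B  ≡⟨ ·-identityˡ B ⟨
        I₂ · B  ≡⟨ cong (_· B) A′A ⟨
        (A′ · A) · B  ≡⟨ ·-assoc A′ A B ⟩
        A′ · (A · B)  ≡⟨ cong (A′ ·_) e ⟩
        A′ · (A · C)  ≡⟨ ·-assoc A′ A C ⟨
        (A′ · A) · C  ≡⟨ cong (_· C) A′A ⟩
        I₂ · C  ≡⟨ ·-identityˡ C ⟩
        C  ∎
        where open ≡-Reasoning

      0≡ : ∀ a b → a * 0# + b * 0# ≡ 0#
      0≡ = solve𝕂 2 (λ a b → a ⊡ 𝟘 ⊞ b ⊡ 𝟘 ⊜ 𝟘) refl

    ∃-fixedVector : ∃ λ v → v ≢ (0# , 0#) × (∀ {A} → A ∈ l → apply A v ≡ v)
    ∃-fixedVector = conclude (∃-anotherFixedPoint (≡-dec _≟_ _≟_) _·_ I₂ l l! (H⇒∈ has-I) closed∈ inverse∈ cancel∈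
      apply apply-· apply-I p-prime r |l| vectors (Unique.cartesianProduct⁺ elements-unique elements-unique)
      (λ (x , y) → ∈-cartesianProduct⁺ (∈-elements x) (∈-elements y)) p∣vectors (0# , 0#)
      (All.tabulate (λ { {mat a b c d} _ → cong₂ _,_ (0≡ a b) (0≡ c d) })))
      where
      conclude : (∃ λ v → v ≢ (0# , 0#) × All (λ A → apply A v ≡ v) l) → ∃ λ v → v ≢ (0# , 0#) × (∀ {A} → A ∈ l → apply A v ≡ v)
      conclude (v , v≢0 , fixed) = v , v≢0 , All.lookup fixed

    -- H acts on K through the determinant and fixes 0; a second fixed point x ≠ 0 can be cancelled
    -- from det A x = x.
    det≡1 : ∀ {A} → A ∈ l → det A ≡ 1#
    det≡1 {A} A∈ = conclude (∃-anotherFixedPoint _≟_ _·_ I₂ l l! (H⇒∈ has-I) closed∈ inverse∈ cancel∈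
      (λ A x → det A * x) (λ A B x → trans (cong (_* x) (det-· A B)) (𝕂.*-assoc _ _ x))
      (λ x → trans (cong (_* x) det-I) (𝕂.*-identityˡ x)) p-prime r |l| elements elements-unique ∈-elements
      (subst (p ∣_) (sym length-elements) p∣q) 0# (All.tabulate (λ {A} _ → 𝕂.zeroʳ (det A))))
      where
      open ≡-Reasoning
      conclude : (∃ λ x → x ≢ 0# × All (λ A → det A * x ≡ x) l) → det A ≡ 1#
      conclude (x , x≢0 , fixed) = begin
        det A  ≡⟨ 𝕂.*-identityʳ _ ⟨
        det A * 1#  ≡⟨ cong (det A *_) (*-inverseʳ x≢0) ⟨
        det A * (x * x ⁻¹)  ≡⟨ 𝕂.*-assoc _ _ _ ⟨
        det A * x * x ⁻¹  ≡⟨ cong (_* x ⁻¹) (All.lookup fixed A∈) ⟩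
        x * x ⁻¹  ≡⟨ *-inverseʳ x≢0 ⟩
        1#  ∎

    2≤p : 2 ≤ p
    2≤p = ℕ.nonTrivial⇒n>1 p {{prime⇒nonTrivial p-prime}}

    ∃-nonIdentity : ∃ λ A → A ∈ l × A ≢ I₂
    ∃-nonIdentity = go l l! (subst (2 ≤_) (sym |l|) (ℕ.≤-trans 2≤p
      (ℕ.≤-trans (ℕ.≤-reflexive (sym (ℕ.^-identityʳ p))) (ℕ.^-monoʳ-≤ p 1≤r))))
      where
      go : ∀ l → Unique l → 2 ≤ length l → ∃ λ A → A ∈ l × A ≢ I₂
      go (A ∷ B ∷ l) ((A≢B ∷ _) ∷ _) _ with A ≟ᴹ I₂
      ... | no A≢I = A , here refl , A≢I
      ... | yes A≡I = B , there (here refl) , λ B≡I → A≢B (trans A≡I (sym B≡I))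
      go (_ ∷ []) _ (s≤s ())

    record Conjugation : Set where
      field
        P P′       : Mat2
        PP′≡I      : P · P′ ≡ I₂
        P′P≡I      : P′ · P ≡ I₂
        t          : Mat2 → Carrier
        conjugates : ∀ {A} → A ∈ l → A · P ≡ P · translation (t A)

    -- The columns of P are the fixed vector (x , y) and a complement (u , w); P′ is the adjugate
    -- divided by the determinant.
    conjugateBy : ∀ x y u w → x * w + - (u * y) ≢ 0# → (∀ {A} → A ∈ l → apply A (x , y) ≡ (x , y)) → Conjugation
    conjugateBy x y u w δ≢0 fixed = record
      { P = mat x u y w
      ; P′ = mat (i * w) (i * - u) (i * - y) (i * x)
      ; PP′≡I = mat-cong
          (unit (solve𝕂 5 (λ i x y u w → x ⊡ (i ⊡ w) ⊞ u ⊡ (i ⊡ ⊟ y) ⊜ i ⊡ (x ⊡ w ⊞ ⊟ (u ⊡ y))) refl i x y u w))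
          (solve𝕂 5 (λ i x y u w → x ⊡ (i ⊡ ⊟ u) ⊞ u ⊡ (i ⊡ x) ⊜ 𝟘) refl i x y u w)
          (solve𝕂 5 (λ i x y u w → y ⊡ (i ⊡ w) ⊞ w ⊡ (i ⊡ ⊟ y) ⊜ 𝟘) refl i x y u w)
          (unit (solve𝕂 5 (λ i x y u w → y ⊡ (i ⊡ ⊟ u) ⊞ w ⊡ (i ⊡ x) ⊜ i ⊡ (x ⊡ w ⊞ ⊟ (u ⊡ y))) refl i x y u w))
      ; P′P≡I = mat-cong
          (unit (solve𝕂 5 (λ i x y u w → i ⊡ w ⊡ x ⊞ i ⊡ ⊟ u ⊡ y ⊜ i ⊡ (x ⊡ w ⊞ ⊟ (u ⊡ y))) refl i x y u w))
          (solve𝕂 5 (λ i x y u w → i ⊡ w ⊡ u ⊞ i ⊡ ⊟ u ⊡ w ⊜ 𝟘) refl i x y u w)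
          (solve𝕂 5 (λ i x y u w → i ⊡ ⊟ y ⊡ x ⊞ i ⊡ x ⊡ y ⊜ 𝟘) refl i x y u w)
          (unit (solve𝕂 5 (λ i x y u w → i ⊡ ⊟ y ⊡ u ⊞ i ⊡ x ⊡ w ⊜ i ⊡ (x ⊡ w ⊞ ⊟ (u ⊡ y))) refl i x y u w))
      ; t = shear x y u w
      ; conjugates = λ {A} A∈ → shear-conjugates x y u w δ≢0 A (fixed A∈) (det≡1 A∈)
      }
      where
      i : Carrier
      i = (x * w + - (u * y)) ⁻¹
      unit : ∀ {e} → e ≡ i * (x * w + - (u * y)) → e ≡ 1#
      unit e = trans e (*-inverseˡ δ≢0)

    module _ (C : Conjugation) where
      open Conjugation C

      P-cancelˡ : ∀ {A B} → P · A ≡ P · B → A ≡ B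
      P-cancelˡ {A} {B} e = trans (sym (undo A)) (trans (cong (P′ ·_) e) (undo B))
        where
        undo : ∀ A → P′ · (P · A) ≡ A
        undo A = trans (sym (·-assoc P′ P A)) (trans (cong (_· A) P′P≡I) (·-identityˡ A))

      P-cancelʳ : ∀ {A B} → A · P ≡ B · P → A ≡ B
      P-cancelʳ {A} {B} e = trans (sym (undo A)) (trans (cong (_· P′) e) (undo B))
        where
        undo : ∀ A → (A · P) · P′ ≡ A
        undo A = trans (·-assoc A P P′) (trans (cong (A ·_) PP′≡I) (·-identityʳ A))

      -- The mirrored equation is the form in which `transform-fixed` leads from translations back
      -- to H along P′.
      conjugates′ : ∀ {A} → A ∈ l → P′ · A ≡ translation (t A) · P′
      conjugates′ {A} A∈ = P-cancelˡ (P-cancelʳ (begin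
        (P · (P′ · A)) · P  ≡⟨ cong (_· P) (sym (·-assoc P P′ A)) ⟩
        ((P · P′) · A) · P  ≡⟨ cong (λ z → (z · A) · P) PP′≡I ⟩
        (I₂ · A) · P  ≡⟨ cong (_· P) (·-identityˡ A) ⟩
        A · P  ≡⟨ conjugates A∈ ⟩
        P · translation (t A)  ≡⟨ ·-identityʳ _ ⟨
        (P · translation (t A)) · I₂  ≡⟨ cong ((P · translation (t A)) ·_) P′P≡I ⟨
        (P · translation (t A)) · (P′ · P)  ≡⟨ ·-assoc _ P′ P ⟨
        ((P · translation (t A)) · P′) · P  ≡⟨ cong (_· P) (·-assoc P _ P′) ⟩
        (P · (translation (t A) · P′)) · P  ∎))
        where open ≡-Reasoning

      t-unique : ∀ {A s} → A ∈ l → A · P ≡ P · translation s → t A ≡ s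
      t-unique A∈ e = cong Mat2.b (P-cancelˡ (trans (sym (conjugates A∈)) e))

      t-injective : ∀ {A B} → A ∈ l → B ∈ l → t A ≡ t B → A ≡ B
      t-injective A∈ B∈ e = P-cancelʳ (trans (conjugates A∈) (trans (cong (λ z → P · translation z) e) (sym (conjugates B∈))))

    -- Replacing (x , y) by t₀ (x , y) divides every translation length by t₀. For t₀ = t A₀ with A₀
    -- ≠ I, which is nonzero as only I becomes the translation by 0, this turns A₀ into x ↦ x + 1.
    ∃-normalisedConjugation : ∃ λ C → ∃ λ A → A ∈ l × Conjugation.t C A ≡ 1#
    ∃-normalisedConjugation = start ∃-fixedVector
      where
      normalise₁ : ∀ x y u w → x * w + - (u * y) ≢ 0# → (∀ {A} → A ∈ l → apply A (x , y) ≡ (x , y)) →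
        ∃ λ C → ∃ λ A → A ∈ l × Conjugation.t C A ≡ 1#
      normalise₁ x y u w δ≢0 fixed = go ∃-nonIdentity
        where
        C₁ : Conjugation
        C₁ = conjugateBy x y u w δ≢0 fixed
        open Conjugation C₁
        go : (∃ λ A → A ∈ l × A ≢ I₂) → ∃ λ C → ∃ λ A → A ∈ l × Conjugation.t C A ≡ 1#
        go (A₀ , A₀∈ , A₀≢I) = C₂ , A₀ , A₀∈ , t-unique C₂ A₀∈ (mat-cong
          (trans (cong proj₁ (fixed₂ A₀∈)) (solve𝕂 2 (λ x u → x ⊜ x ⊡ 𝟙 ⊞ u ⊡ 𝟘) refl (t₀ * x) u))
          (trans (cong Mat2.b (conjugates A₀∈)) (solve𝕂 3 (λ t x u → x ⊡ t ⊞ u ⊡ 𝟙 ⊜ t ⊡ x ⊡ 𝟙 ⊞ u ⊡ 𝟙) refl t₀ x u))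
          (trans (cong proj₂ (fixed₂ A₀∈)) (solve𝕂 2 (λ x u → x ⊜ x ⊡ 𝟙 ⊞ u ⊡ 𝟘) refl (t₀ * y) w))
          (trans (cong Mat2.d (conjugates A₀∈)) (solve𝕂 3 (λ t x u → x ⊡ t ⊞ u ⊡ 𝟙 ⊜ t ⊡ x ⊡ 𝟙 ⊞ u ⊡ 𝟙) refl t₀ y w)))
          where
          t₀ : Carrier
          t₀ = t A₀
          t₀≢0 : t₀ ≢ 0#
          t₀≢0 t₀≡0 = A₀≢I (P-cancelʳ C₁ (trans (conjugates A₀∈) (trans (cong (λ z → P · translation z) t₀≡0)
            (trans (·-identityʳ P) (sym (·-identityˡ P))))))
          fixed₂ : ∀ {A} → A ∈ l → apply A (t₀ * x , t₀ * y) ≡ (t₀ * x , t₀ * y)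
          fixed₂ {mat a b c d} A∈ = cong₂ _,_ (trans (pull a b) (cong (t₀ *_) (cong proj₁ (fixed A∈))))
                                              (trans (pull c d) (cong (t₀ *_) (cong proj₂ (fixed A∈))))
            where
            pull : ∀ a b → a * (t₀ * x) + b * (t₀ * y) ≡ t₀ * (a * x + b * y)
            pull a b = solve𝕂 5 (λ a b t x y → a ⊡ (t ⊡ x) ⊞ b ⊡ (t ⊡ y) ⊜ t ⊡ (a ⊡ x ⊞ b ⊡ y)) refl a b t₀ x y
          C₂ : Conjugation
          C₂ = conjugateBy (t₀ * x) (t₀ * y) u w
            (λ e → *-≢0 t₀≢0 δ≢0 (trans (solve𝕂 5 (λ t x y u w → t ⊡ (x ⊡ w ⊞ ⊟ (u ⊡ y)) ⊜ t ⊡ x ⊡ w ⊞ ⊟ (u ⊡ (t ⊡ y))) refl t₀ x y u w) e))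
            fixed₂
      start : (∃ λ v → v ≢ (0# , 0#) × (∀ {A} → A ∈ l → apply A v ≡ v)) → ∃ λ C → ∃ λ A → A ∈ l × Conjugation.t C A ≡ 1#
      start ((x , y) , v≢0 , fixed) = choose (x ≟ 0#)
        where
        -- The complement is (0 , 1) if x ≠ 0 and (1 , 0) otherwise; the determinants are x and -y.
        choose : Dec (x ≡ 0#) → ∃ λ C → ∃ λ A → A ∈ l × Conjugation.t C A ≡ 1#
        choose (no x≢0) = normalise₁ x y 0# 1#
          (λ e → x≢0 (trans (solve𝕂 2 (λ x y → x ⊜ x ⊡ 𝟙 ⊞ ⊟ (𝟘 ⊡ y)) refl x y) e)) fixed
        choose (yes x≡0) = normalise₁ x y 1# 0#
          (λ e → v≢0 (cong₂ _,_ x≡0 (trans (solve𝕂 2 (λ x y → y ⊜ ⊟ (x ⊡ 𝟘 ⊞ ⊟ (𝟙 ⊡ y))) refl x y) (trans (cong -_ e) (solve𝕂 0 (⊟ 𝟘 ⊜ 𝟘) refl))))) fixed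

    -- Translations compose by adding their lengths, so the powers of a member with length 1 realise
    -- the whole prime field.
    power∈ : ∀ (C : Conjugation) {A} → A ∈ l → Conjugation.t C A ≡ 1# → ∀ j → ∃ λ B → B ∈ l × Conjugation.t C B ≡ ι j
    power∈ C {A} A∈ tA≡1 zero = I₂ , H⇒∈ has-I , t-unique C (H⇒∈ has-I) (trans (·-identityˡ _) (sym (·-identityʳ _)))
    power∈ C {A} A∈ tA≡1 (suc j) with B , B∈ , tB ← power∈ C A∈ tA≡1 j = A · B , closed∈ A∈ B∈ , t-unique C (closed∈ A∈ B∈) (begin
      (A · B) · P  ≡⟨ ·-assoc A B P ⟩
      A · (B · P)  ≡⟨ cong (A ·_) (conjugates B∈) ⟩
      A · (P · translation (t B))  ≡⟨ ·-assoc A P _ ⟨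
      (A · P) · translation (t B)  ≡⟨ cong (_· translation (t B)) (conjugates A∈) ⟩
      (P · translation (t A)) · translation (t B)  ≡⟨ ·-assoc P _ _ ⟩
      P · (translation (t A) · translation (t B))  ≡⟨ cong (P ·_) (cong₂ (λ x y → translation x · translation y) tA≡1 tB) ⟩
      P · (translation 1# · translation (ι j))  ≡⟨ cong (P ·_) (mat-cong
        (solve𝕂 0 (𝟙 ⊡ 𝟙 ⊞ 𝟙 ⊡ 𝟘 ⊜ 𝟙) refl) (solve𝕂 1 (λ s → 𝟙 ⊡ s ⊞ 𝟙 ⊡ 𝟙 ⊜ 𝟙 ⊞ s) refl (ι j))
        (solve𝕂 0 (𝟘 ⊡ 𝟙 ⊞ 𝟙 ⊡ 𝟘 ⊜ 𝟘) refl) (solve𝕂 1 (λ s → 𝟘 ⊡ s ⊞ 𝟙 ⊡ 𝟙 ⊜ 𝟙) refl (ι j))) ⟩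
      P · translation (ι (suc j))  ∎)
      where
      open Conjugation C
      open ≡-Reasoning


-- Transfer of the count from translations to H

open Lists
open import Data.Nat using (_*_; _^_; _∸_)
open import Data.Nat.Divisibility using (_∣_)
open import Data.Integer using (+_) renaming (_*_ to _*ℤ_)
open import Data.List using (upTo)
open import Data.List.Properties using (length-map; length-applyUpTo)
open import Data.List.Membership.Propositional.Properties using (∈-map⁺; ∈-map⁻; ∈-upTo⁺; ∈-upTo⁻)
open import Data.List.Relation.Unary.All as All using (All; [])
import Data.List.Relation.Unary.All.Properties as All
open import Data.List.Relation.Unary.AllPairs as AllPairs using ([])
import Data.List.Relation.Unary.AllPairs.Properties as AllPairs
open import Data.List.Relation.Unary.Unique.Propositional.Properties using (upTo⁺)
open import Data.Vec using (Vec)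
open import Function.Bundles using (Equivalence; mk⇔)
open import Relation.Binary.PropositionalEquality using (_≡_; refl; sym; trans; cong; subst)

module Main (K : FiniteField) (p : ℕ) (p-prime : Prime p) (char : Over.HasCharacteristic K p)
  (H : Over.Mat2 K → Set) (H-subgroup : Over.IsSubgroupGL2 K H) (r : ℕ) (1≤r : 1 ≤ r) (H-size : HasSize H (p ^ r))
  (n : ℕ) (2≤n : 2 ≤ n) where

  open Polynomial K using (Carrier; Mat2; Irreducible; I; ι; monic; mk≋; coeffs; ≋-trans; ≋-sym; 0≢1; _≟_)
  open Galois K using (Invariant)
  open Degree K using (monic-monic)
  open Action K
  open Characteristic K p p-prime char
  open Counting K p p-prime char using (TranslationInvariant; invariants; invariants-unique; ∈-invariants⁺; ∈-invariants⁻; countInvariants)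
  open PSubgroups K p p-prime char

  private
    l : List Mat2
    l = proj₁ H-size
    l! : Unique l
    l! = proj₁ (proj₂ H-size)
    |l| : length l ≡ p ^ r
    |l| = proj₁ (proj₂ (proj₂ H-size))
    H⇔∈l : ∀ A → _
    H⇔∈l = proj₂ (proj₂ (proj₂ H-size))

  open Subgroup H H-subgroup r 1≤r l l! |l| H⇔∈l

  module Conjugated (C : Conjugation) (A₀ : Mat2) (A₀∈ : A₀ ∈ l) (tA₀≡1 : Conjugation.t C A₀ ≡ FiniteField.1# K) where
    open Conjugation C

    private
      H⇒∈ : ∀ {A} → H A → A ∈ l
      H⇒∈ {A} = Equivalence.to (H⇔∈l A)
      ∈⇒H : ∀ {A} → A ∈ l → H A
      ∈⇒H {A} = Equivalence.from (H⇔∈l A)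

    module _ (v : Vec Carrier n) (v∈I : I H n v) where
      v̂ : Vec Carrier n
      v̂ = transform P v

      v̂-irreducible : Irreducible (monic v̂)
      v̂-irreducible = transform-irreducible PP′≡I 2≤n v (proj₁ v∈I)

      v̂-invariant : ∀ {A} → A ∈ l → Invariant (t A) (monic v̂)
      v̂-invariant {A} A∈ = translation-fixed⇒invariant (t A) v̂ (transform-fixed PP′≡I 2≤n v (proj₁ v∈I) {A} (sym (conjugates A∈))
        (≋-trans (≋-sym (act≋⋆ A n (monic v))) (mk≋ (proj₂ v∈I A (∈⇒H A∈)))))

      v̂-invariant₁ : Invariant (FiniteField.1# K) (monic v̂)
      v̂-invariant₁ = subst (λ c → Invariant c (monic v̂)) tA₀≡1 (v̂-invariant A₀∈)

      p∣n : p ∣ n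
      p∣n = Translations.invariant⇒p∣n (monic-monic v̂) v̂-irreducible (λ z → 0≢1 (sym z)) v̂-invariant₁

      -- `t` is injective on the p^r members of `l`, and the transformed polynomial admits only
      -- translations by the p elements of the prime field; so p^r ≤ p.
      r≤1 : ¬ 1 < r
      r≤1 1<r = ℕ.<⇒≱ p<p^r (subst (_≤ p) (trans (length-map t l) |l|)
        (subst (length (map t l) ≤_) (trans (length-map ι (upTo p)) (length-applyUpTo (λ i → i) p))
          (unique-⊆⇒length≤ (unique-map t (t-injective C) l!) sub)))
        where
        p<p^r : p < p ^ r
        p<p^r = ℕ.≤-trans (s≤s (ℕ.≤-reflexive (sym (ℕ.^-identityʳ p)))) (ℕ.^-monoʳ-< p 2≤p 1<r)
        sub : ∀ {c} → c ∈ map t l → c ∈ map ι (upTo p)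
        sub c∈ with A , A∈ , refl ← ∈-map⁻ t c∈ =
          conclude (Translations.invariant⇒ι (monic-monic v̂) v̂-irreducible v̂-invariant₁ (v̂-invariant A∈))
          where
          conclude : (∃ λ j → j < p × t A ≡ ι j) → t A ∈ map ι (upTo p)
          conclude (j , j<p , e) = subst (_∈ map ι (upTo p)) (sym e) (∈-map⁺ ι (∈-upTo⁺ j<p))

    empty : (1 < r ⊎ ¬ p ∣ n) → HasSize (I H n) 0
    empty reason = [] , [] , refl , λ v → mk⇔ (λ v∈I → contradiction reason (absurd v v∈I)) (λ ())
      where
      absurd : ∀ v → I H n v → ¬ (1 < r ⊎ ¬ p ∣ n)
      absurd v v∈I (inj₁ 1<r) = r≤1 v v∈I 1<r
      absurd v v∈I (inj₂ p∤n) = p∤n (p∣n v v∈I)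

    module _ (r≡1 : r ≡ 1) where
      -- The prime field lies among the values of `t`; for r = 1 there are only p values, so there
      -- are no others.
      t∈ι : ∀ {A} → A ∈ l → t A ∈ map ι (upTo p)
      t∈ι A∈ = unique-⊆-long⇒⊇ _≟_ ι-unique sub
        (ℕ.≤-reflexive (trans (length-map t l) (trans |l| (trans (cong (p ^_) r≡1) (trans (ℕ.^-identityʳ p)
          (sym (trans (length-map ι (upTo p)) (length-applyUpTo (λ i → i) p))))))))
        (∈-map⁺ t A∈)
        where
        ι-unique : Unique (map ι (upTo p))
        ι-unique = unique-map ι (λ i∈ j∈ → ι-injective (∈-upTo⁻ i∈) (∈-upTo⁻ j∈)) (upTo⁺ p)
        sub : ∀ {c} → c ∈ map ι (upTo p) → c ∈ map t l
        sub c∈ with j , _ , refl ← ∈-map⁻ ι c∈ = conclude (power∈ C A₀∈ tA₀≡1 j)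
          where
          conclude : (∃ λ B → B ∈ l × t B ≡ ι j) → ι j ∈ map t l
          conclude (B , B∈ , tB≡) = subst (_∈ map t l) tB≡ (∈-map⁺ t B∈)

      -- Invariance under x ↦ x + 1 extends to the prime field, which for r = 1 contains every
      -- `t A`; conjugating back by P′ gives invariance under H.
      fromInvariant : ∀ w → TranslationInvariant n w → I H n (transform P′ w)
      fromInvariant w (irr , inv₁) = transform-irreducible P′P≡I 2≤n w irr , λ A HA →
        coeffs (≋-trans (act≋⋆ A n _) (transform-fixed P′P≡I 2≤n w irr {translation (t A)} (conjugates′ C (H⇒∈ HA))
          (invariant⇒translation-fixed (t A) w (invariant (t∈ι (H⇒∈ HA))))))
        where
        invariant : ∀ {c} → c ∈ map ι (upTo p) → Invariant c (monic w)
        invariant c∈ with j , _ , refl ← ∈-map⁻ ι c∈ = Translations.invariant-ι (monic-monic w) irr inv₁ j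

      -- `transform P` and `transform P′` are inverse bijections between I_H(n) and the irreducible
      -- polynomials of degree n invariant under x ↦ x + 1.
      size : HasSize (I H n) (length (invariants n))
      size = map (transform P′) (invariants n) ,
        unique-map (transform P′) (λ x∈ y∈ e → trans (sym (back x∈)) (trans (cong (transform P) e) (back y∈))) (invariants-unique n) ,
        length-map (transform P′) (invariants n) ,
        λ v → mk⇔
          (λ v∈I → subst (_∈ map (transform P′) (invariants n)) (transform-inverse PP′≡I 2≤n v (proj₁ v∈I))
            (∈-map⁺ (transform P′) (∈-invariants⁺ (v̂-irreducible v v∈I , v̂-invariant₁ v v∈I))))
          (λ v∈ → from (∈-map⁻ (transform P′) v∈))
        where
        back : ∀ {w} → w ∈ invariants n → transform P (transform P′ w) ≡ w
        back {w} w∈ = transform-inverse P′P≡I 2≤n w (proj₁ (∈-invariants⁻ w∈))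
        from : ∀ {v} → (∃ λ w → w ∈ invariants n × v ≡ transform P′ w) → I H n v
        from (w , w∈ , refl) = fromInvariant w (∈-invariants⁻ w∈)

    count : r ≡ 1 → (m : ℕ) → 1 ≤ m → n ≡ p * m →
      ∃ λ k → HasSize (I H n) k × + (p * m * k) ≡ + (p ∸ 1) *ℤ divisorSum (FiniteField.q K) p m
    count r≡1 m 1≤m n≡pm = length (invariants n) , size r≡1 ,
      trans (cong (λ z → + (p * m * length (invariants z))) n≡pm) (countInvariants m 1≤m)

  theorem : ((1 < r ⊎ ¬ (p ∣ n)) → HasSize (I H n) 0)
    × (r ≡ 1 → (m : ℕ) → 1 ≤ m → n ≡ p * m →
        ∃ λ k → HasSize (I H n) k × + (p * m * k) ≡ + (p ∸ 1) *ℤ divisorSum (FiniteField.q K) p m)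
  theorem = conclude ∃-normalisedConjugation
    where
    conclude : (∃ λ C → ∃ λ A → A ∈ l × Conjugation.t C A ≡ FiniteField.1# K) → _
    conclude (C , A₀ , A₀∈ , tA₀) = empty , count
      where open Conjugated C A₀ A₀∈ tA₀

theorem4p1 : (K : FiniteField) (p : ℕ) → Prime p → Over.HasCharacteristic K p →
    (H : Over.Mat2 K → Set) → Over.IsSubgroupGL2 K H →
    (r : ℕ) → 1 ≤ r → HasSize H (p ^ r) →
    (n : ℕ) → 2 ≤ n →
    ((1 < r ⊎ ¬ (p ∣ n)) → HasSize (Over.I K H n) 0)
    × (r ≡ 1 → (m : ℕ) → 1 ≤ m → n ≡ p * m →
    ∃ λ k → HasSize (Over.I K H n) k
    × + (p * m * k) ≡ + (p ∸ 1) *ℤ divisorSum (FiniteField.q K) p m)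
theorem4p1 K p p-prime char H H-subgroup r 1≤r H-size n 2≤n =
  Main.theorem K p p-prime char H H-subgroup r 1≤r H-size n 2≤n
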